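{- With respect to the integer lattices (the lattice $\mathbb{Z}^n$ for $A_{n-1}, B_n, C_n, D_n$), the arithmetic Tutte generating functions of the classical root systems are, as formal power series in $Z$ with coefficients in $\mathbb{Q}[X,Y]$: \[ \Psi_A = F(Z,Y)^X,\qquad \Psi_B = F(2Z,Y)^{\frac X2-1}F(Z,Y^2)F(YZ,Y^2), \] \[ \Psi_C = F(2Z,Y)^{\frac X2-1}F(YZ,Y^2)^2,\qquad \Psi_D = F(2Z,Y)^{\frac X2-1}F(Z,Y^2)^2. \]
   Context: Let $e_1,\dots,e_n$ be the standard basis of $\mathbb{R}^n$. The (positive) classical root systems are the lists $A_{n-1}=\{e_i-e_j:1\le i<j\le n\}$, $D_n=\{e_i-e_j,\ e_i+e_j:1\le i<j\le n\}$, $B_n = D_n\cup\{e_i:1\le i\le n\}$, $C_n = D_n \cup\{2e_i : 1 \le i\le n\}$ (with $A_{ -1}$, $B_0,C_0,D_0$ empty). For a finite list $A$ in a lattice $\Lambda$ and a sublist $B$, $r(B)=\dim\operatorname{span}_{\mathbb{R}}B$ and $m(B)$ is the index of $\mathbb{Z}B$ in $\operatorname{span}_{\mathbb{R}}(B)\cap\Lambda$. The arithmetic coboundary polynomial is $\psi_A(X,Y)=\sum_{B\subseteq A} m(B)\,X^{r(A)-r(B)}(Y-1)^{|B|}$ (equivalently $(Y-1)^{r(A)}M_A(\frac{X+Y-1}{Y-1},Y)$ where $M_A(x,y)=\sum_B m(B)(x-1)^{r(A)-r(B)}(y-1)^{|B|-r(B)}$). Here all $\psi$ are computed with $\Lambda=\mathbb{Z}^n$.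 Define $\Psi_A = 1 + X\sum_{n\ge1}\psi_{A_{n-1}}(X,Y)\frac{Z^n}{n!}$ and, for $\Phi\in\{B,C,D\}$, $\Psi_\Phi=\sum_{n\ge 0} X^{\,n-r(\Phi_n)}\psi_{\Phi_n}(X,Y)\frac{Z^n}{n!}$. The deformed exponential function is the formal power series $F(\alpha,\beta)=\sum_{n\ge0}\frac{\alpha^n\beta^{\binom n2}}{n!}$; when $\alpha$ is a multiple of $Z$, $F$ has constant term $1$ and $F^c := \exp(c\log F)$ for any expression $c$ in $X$. -}

module Defs where

open import Data.Nat as ℕ using (ℕ; zero; suc; _∸_; _≡ᵇ_; _<ᵇ_; _!)
open import Data.Nat.Combinatorics using (_C_)
open import Data.Integer as ℤ using (ℤ)
open import Data.Rational as ℚ using (ℚ; 0ℚ; 1ℚ; ½)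
open import Data.Fin as Fin using (Fin; toℕ)
open import Data.Vec as Vec using (Vec; tabulate; zipWith; replicate)
open import Data.List as List using (List; []; _∷_; _++_; map; concatMap; allFin; length; lookup)
open import Data.List.Membership.Propositional using (_∈_)
open import Data.Product using (Σ; ∃; _×_; _,_)
open import Data.Bool using (Bool; true; false; if_then_else_; _∧_)
open import Relation.Nullary.Decidable using (⌊_⌋)
open import Relation.Binary.PropositionalEquality using (_≡_)

Vecℤ : ℕ → Set
Vecℤ n = Vec ℤ n

_+v_ _-v_ : ∀ {n} → Vecℤ n → Vecℤ n → Vecℤ n
u +v v = zipWith ℤ._+_ u v
u -v v = zipWith ℤ._-_ u v

e : ∀ {n} → Fin n → Vecℤ n
e i = tabulate (λ j → if ⌊ i Fin.≟ j ⌋ then ℤ.+ 1 else ℤ.+ 0)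

pairs : ∀ n → List (Fin n × Fin n)
pairs n = concatMap (λ i → concatMap (λ j → if toℕ i <ᵇ toℕ j then (i , j) ∷ [] else [])
                                      (allFin n)) (allFin n)

-- A_{n-1} ⊆ ℤⁿ
rootA : ∀ n → List (Vecℤ n)
rootA n = map (λ { (i , j) → e i -v e j }) (pairs n)

rootD : ∀ n → List (Vecℤ n)
rootD n = map (λ { (i , j) → e i -v e j }) (pairs n) ++ map (λ { (i , j) → e i +v e j }) (pairs n)

rootB : ∀ n → List (Vecℤ n)
rootB n = rootD n ++ map e (allFin n)

rootC : ∀ n → List (Vecℤ n)
rootC n = rootD n ++ map (λ i → e i +v e i) (allFin n)

sublists : ∀ {a} {A : Set a} → List A → List (List A)
sublists []       = [] ∷ []
sublists (x ∷ xs) = sublists xs ++ map (x ∷_) (sublists xs)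

toℚ : ℤ → ℚ
toℚ k = k ℚ./ 1

lincombℤ : ∀ {n} (B : List (Vecℤ n)) → (Fin (length B) → ℤ) → Vecℤ n
lincombℤ []      c = replicate _ (ℤ.+ 0)
lincombℤ (b ∷ B) c = zipWith ℤ._+_ (Vec.map (c Fin.zero ℤ.*_) b) (lincombℤ B (λ i → c (Fin.suc i)))

lincombℚ : ∀ {n} (B : List (Vecℤ n)) → (Fin (length B) → ℚ) → Vec ℚ n
lincombℚ []      c = replicate _ 0ℚ
lincombℚ (b ∷ B) c = zipWith ℚ._+_ (Vec.map (λ x → c Fin.zero ℚ.* toℚ x) b) (lincombℚ B (λ i → c (Fin.suc i)))

-- v lies in the (real, equivalently rational) span of B
InSpan : ∀ {n} → List (Vecℤ n) → Vecℤ n → Set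
InSpan B v = ∃ λ (c : Fin (length B) → ℚ) → lincombℚ B c ≡ Vec.map toℚ v

InLattice : ∀ {n} → List (Vecℤ n) → Vecℤ n → Set
InLattice B v = ∃ λ (c : Fin (length B) → ℤ) → lincombℤ B c ≡ v

LinIndep : ∀ {n} → List (Vecℤ n) → Set
LinIndep B = (c : Fin (length B) → ℚ) → lincombℚ B c ≡ replicate _ 0ℚ → ∀ i → c i ≡ 0ℚ

IsRank : ∀ {n} → List (Vecℤ n) → ℕ → Set
IsRank B r = (∃ λ S → S ∈ sublists B × LinIndep S × length S ≡ r)
           × (∀ S → S ∈ sublists B → LinIndep S → length S ℕ.≤ r)

-- m = [ span(B) ∩ ℤⁿ : ℤB ] : the quotient (span B ∩ ℤⁿ)/ℤB has exactly m elements,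
-- witnessed by a complete system f of pairwise inequivalent coset representatives
IsIndex : ∀ {n} → List (Vecℤ n) → ℕ → Set
IsIndex {n} B m = Σ (Fin m → Vecℤ n) λ f →
    (∀ i → InSpan B (f i))
  × (∀ i j → InLattice B (f i -v f j) → i ≡ j)
  × (∀ v → InSpan B v → ∃ λ i → InLattice B (v -v f i))

-- Formal power series in X, Y, Z over ℚ: coefficient of X^i Y^j Z^k.
-- (ℚ[X,Y][[Z]] embeds in ℚ[[X,Y,Z]].)

Series : Set
Series = ℕ → ℕ → ℕ → ℚ

infix 4 _≈S_
_≈S_ : Series → Series → Set
f ≈S g = ∀ i j k → f i j k ≡ g i j k

sumTo : ℕ → (ℕ → ℚ) → ℚ
sumTo zero    f = f 0
sumTo (suc n) f = sumTo n f ℚ.+ f (suc n)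

sumList : ∀ {a} {A : Set a} → (A → Series) → List A → Series
sumList f []       i j k = 0ℚ
sumList f (x ∷ xs) i j k = f x i j k ℚ.+ sumList f xs i j k

fromℕ : ℕ → ℚ
fromℕ k = ℤ.+ k ℚ./ 1

-- 1/k for k ≥ 1 (only ever used with k ≥ 1)
invℕ : ℕ → ℚ
invℕ zero    = 0ℚ
invℕ (suc k) = ℤ.+ 1 ℚ./ suc k

mono : ℕ → ℕ → ℕ → Series
mono a b c i j k = if (i ≡ᵇ a) ∧ (j ≡ᵇ b) ∧ (k ≡ᵇ c) then 1ℚ else 0ℚ

zeroS oneS Xs Ys Zs : Series
zeroS _ _ _ = 0ℚ
oneS = mono 0 0 0
Xs = mono 1 0 0
Ys = mono 0 1 0
Zs = mono 0 0 1

_+S_ _-S_ _*S_ : Series → Series → Series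
(f +S g) i j k = f i j k ℚ.+ g i j k
(f -S g) i j k = f i j k ℚ.- g i j k
(f *S g) i j k = sumTo i λ a → sumTo j λ b → sumTo k λ c →
                   f a b c ℚ.* g (i ∸ a) (j ∸ b) (k ∸ c)

_·S_ : ℚ → Series → Series
(q ·S f) i j k = q ℚ.* f i j k

_^S_ : Series → ℕ → Series
f ^S zero  = oneS
f ^S suc n = f *S (f ^S n)

infixl 6 _+S_ _-S_
infixl 7 _*S_ _·S_
infixr 8 _^S_

-- log F = Σ_{m ≥ 1} (-1)^{m+1} (F - 1)^m / m, for F with constant term (in Z) 1;
-- the Z^k coefficient only involves m ≤ k.
logS : Series → Series
logS f i j k = sumTo k λ m → sign m ℚ.* invℕ m ℚ.* ((f -S oneS) ^S m) i j k
  where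
  sign : ℕ → ℚ
  sign zero          = 0ℚ
  sign (suc zero)    = 1ℚ
  sign (suc (suc m)) = ℚ.- (sign (suc m))

-- exp G = Σ_{m ≥ 0} G^m / m!, for G with zero constant term (in Z)
expS : Series → Series
expS g i j k = sumTo k λ m → invℕ (m !) ℚ.* (g ^S m) i j k

infixr 8 _^^_
_^^_ : Series → Series → Series
f ^^ c = expS (c *S logS f)

-- deformed exponential F(α, β) = Σ_n α^n β^(n choose 2) / n!, for α a multiple of Z
Fdef : Series → Series → Series
Fdef α β i j k = sumTo k λ n → invℕ (n !) ℚ.* (α ^S n *S β ^S (n C 2)) i j k

-- exponential generating function Σ_n p_n Z^n / n! of a family of polynomials in X, Y
egf : (ℕ → Series) → Series
egf p i j k = invℕ (k !) ℚ.* p k i j 0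

-- Arithmetic coboundary polynomial, relative to given rank and
-- multiplicity functions (which the theorem requires to be the true ones)

RankFn : Set
RankFn = ∀ {n} → List (Vecℤ n) → ℕ

MultFn : Set
MultFn = ∀ {n} → List (Vecℤ n) → ℕ

ψ : RankFn → MultFn → ∀ {n} → List (Vecℤ n) → Series
ψ r m A = sumList (λ B → fromℕ (m B) ·S (Xs ^S (r A ∸ r B) *S (Ys -S oneS) ^S length B)) (sublists A)

ΨA : RankFn → MultFn → Series
ΨA r m = oneS +S Xs *S egf p
  where
  p : ℕ → Series
  p zero    = zeroS
  p (suc n) = ψ r m (rootA (suc n))

ΨΦ : RankFn → MultFn → (∀ n → List (Vecℤ n)) → Series
ΨΦ r m Φ = egf λ n → Xs ^S (n ∸ r (Φ n)) *S ψ r m (Φ n)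

{-# OPTIONS --safe #-}

-- Finite field method.  For even q, the number of points of (ℤ/q)ⁿ orthogonal to a list B of
-- classical roots is m(B) qⁿ⁻ʳ⁽ᴮ⁾: projecting along a vector with first coordinate ±1 (or, if
-- there is none, ±2) removes one coordinate, and the family of all vectors of ℓ¹-norm at most 2
-- is closed under these projections.  Hence Σ_B m(B) qⁿ⁻ʳ⁽ᴮ⁾ (Y − 1)^|B| is the sum over all
-- points p of Y to the number of roots orthogonal to p.  Grouping the coordinates of p by their
-- residue up to sign (for Aₙ₋₁: by their residue) turns the generating function of these sums
-- into a product with one deformed exponential for each class of residues: G^(q/2−1) J, where
-- G = F(2Z, Y) and J collects the classes of 0 and q/2 (for Aₙ₋₁: F(Z, Y)^q).
--
-- So the series in the statement agree at X = q for q = 2, 4, 8, ….  This is transferred to an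
-- indeterminate X by a linear differential equation in Z, which the left side satisfies because
-- a polynomial vanishing at all these q is zero, and exp(c log G) J by differentiation.  Series
-- are treated as exponential generating functions, where the equation has a unique solution
-- without any division.
module Submission where

open import Defs
open import Level using (0ℓ)
open import Algebra using (CommutativeRing; CommutativeSemiring)
import Algebra.Properties.Ring as RingProperties
import Algebra.Properties.CommutativeSemigroup as CommutativeSemigroupProperties
import Algebra.Properties.Semiring.Exp as Exponentiation
import Algebra.Solver.Ring.NaturalCoefficients.Default as SemiringSolver
import Relation.Binary.Reasoning.Setoid as SetoidReasoning
open import Data.Nat as ℕ using (ℕ; zero; suc; _∸_; _!; z≤n; s≤s)
import Data.Nat.Properties as ℕ
open import Data.Product using (Σ; ∃; _×_; _,_; proj₁; proj₂)
open import Data.Sum using (_⊎_; inj₁; inj₂)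
open import Relation.Binary.PropositionalEquality as ≡ using (_≡_; _≢_)
open import Function using (_∘_)
open import Data.Integer as ℤ using (ℤ)
import Data.Integer.Properties as ℤ
open import Data.Rational as ℚ using (ℚ; 0ℚ; 1ℚ; ½)
import Data.Rational.Properties as ℚ
open import Data.Rational.Unnormalised as ℚᵘ using (mkℚᵘ)
import Data.Rational.Unnormalised.Properties as ℚᵘ
open import Data.List using (List; []; _∷_; _++_; map; concatMap; allFin; length)
open import Data.List.Relation.Unary.All as All using (All; []; _∷_)
open import Data.Fin as Fin using (Fin)
import Data.Fin.Properties as Fin
open import Data.Vec as Vec using (Vec; []; _∷_; lookup)
import Data.Vec.Properties as Vec
open import Data.List.Membership.Propositional using (_∈_; _∉_; find; lose)
open import Data.List.Membership.Propositional.Properties using (∈-map⁺; ∈-map⁻; ∈-++⁺ˡ; ∈-++⁺ʳ; ∈-++⁻)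
open import Data.List.Relation.Unary.Any as Any using (Any; here; there)
import Data.List.Properties as List
open import Data.List.Relation.Binary.Sublist.Propositional using (_⊆_; []; _∷_; _∷ʳ_; ⊆-trans) renaming (lookup to lookup-⊆)
open import Relation.Nullary using (¬_; yes; no; contradiction)
open import Data.Integer.Divisibility.Signed as ℤ∣ using () renaming (_∣_ to _∣ℤ_)
open import Data.Nat.Divisibility as ℕ∣ using ()
open import Data.Integer.Tactic.RingSolver using () renaming (solve-∀ to solveℤ)
import Data.Integer.DivMod as ℤ
open import Data.List.Relation.Binary.Sublist.Heterogeneous using (minimum)
open import Data.Nat.Combinatorics using (nCk+nC[k+1]≡[n+1]C[k+1]; nC1≡n) renaming (_C_ to _choose_)
import Data.List as List
open import Data.Bool using (true; false; if_then_else_)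
open import Relation.Nullary.Decidable using (⌊_⌋)


-- Hurwitz series

-- The exponent X/2 - 1 is a natural number only at even X, and the equation 2c = 0 has two
-- solutions modulo q only for even q; this fixes the parity of the points. Powers of two are taken
-- because they are closed under doubling: comparing p(2x) with p(x) eliminates the coefficients of
-- p one at a time with cancellation of positive integers alone, which is possible over a
-- coefficient ring of series in Y. Rank and index are given only by their defining properties.
-- Elimination produces a rank and an index together with the count of solutions, and uniqueness
-- identifies them with the given ones. For the rank, uniqueness comes from the count again: an
-- independent sublist imposes fewer conditions than the whole list, so it has at least as many
-- solutions, and comparison of growth in q bounds its length. The series of the statement are
-- ordinary ones in three variables. Multiplying their coefficients by factorials, once for each
-- variable, carries them into nested exponential series, and logarithms and exponentials are
-- differentiated only there.

module RingExtras (R : CommutativeRing 0ℓ 0ℓ) where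
  open CommutativeRing R
  open SetoidReasoning setoid

  nat : ℕ → Carrier
  nat zero    = 0#
  nat (suc n) = 1# + nat n

  nat-+ : ∀ m n → nat (m ℕ.+ n) ≈ nat m + nat n
  nat-+ zero    n = sym (+-identityˡ _)
  nat-+ (suc m) n = trans (+-congˡ (nat-+ m n)) (sym (+-assoc _ _ _))

  nat-* : ∀ m n → nat (m ℕ.* n) ≈ nat m * nat n
  nat-* zero    n = sym (zeroˡ _)
  nat-* (suc m) n = begin
    nat (n ℕ.+ m ℕ.* n) ≈⟨ nat-+ n (m ℕ.* n) ⟩
    nat n + nat (m ℕ.* n) ≈⟨ +-cong (sym (*-identityˡ _)) (nat-* m n) ⟩
    1# * nat n + nat m * nat n ≈⟨ distribʳ _ _ _ ⟨
    (1# + nat m) * nat n ∎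

  ∑ : ℕ → (ℕ → Carrier) → Carrier
  ∑ zero    f = f 0
  ∑ (suc n) f = ∑ n f + f (suc n)

  ∑-cong : ∀ n {f g} → (∀ k → k ℕ.≤ n → f k ≈ g k) → ∑ n f ≈ ∑ n g
  ∑-cong zero    h = h 0 z≤n
  ∑-cong (suc n) h = +-cong (∑-cong n λ k k≤n → h k (ℕ.m≤n⇒m≤1+n k≤n)) (h (suc n) ℕ.≤-refl)

  ∑-zero : ∀ n {f} → (∀ k → k ℕ.≤ n → f k ≈ 0#) → ∑ n f ≈ 0#
  ∑-zero zero    h = h 0 z≤n
  ∑-zero (suc n) h = trans (+-cong (∑-zero n λ k k≤n → h k (ℕ.m≤n⇒m≤1+n k≤n)) (h (suc n) ℕ.≤-refl)) (+-identityˡ 0#)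

  ∑-+ : ∀ n f g → ∑ n (λ k → f k + g k) ≈ ∑ n f + ∑ n g
  ∑-+ zero    f g = refl
  ∑-+ (suc n) f g = trans (+-congʳ (∑-+ n f g)) (interchange _ _ _ _)
    where open CommutativeSemigroupProperties +-commutativeSemigroup using (interchange)

  ∑-*ˡ : ∀ n c f → ∑ n (λ k → c * f k) ≈ c * ∑ n f
  ∑-*ˡ zero    c f = refl
  ∑-*ˡ (suc n) c f = trans (+-congʳ (∑-*ˡ n c f)) (sym (distribˡ c _ _))

  ∑-suc : ∀ n f → ∑ (suc n) f ≈ f 0 + ∑ n (f ∘ suc)
  ∑-suc zero    f = refl
  ∑-suc (suc n) f = trans (+-congʳ (∑-suc n f)) (+-assoc _ _ _)

  ∑-extend : ∀ {m n} → m ℕ.≤ n → ∀ f → (∀ k → m ℕ.< k → f k ≈ 0#) → ∑ m f ≈ ∑ n f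
  ∑-extend {m} m≤n f h = go (ℕ.≤⇒≤′ m≤n)
    where
    go : ∀ {n} → m ℕ.≤′ n → ∑ m f ≈ ∑ n f
    go ℕ.≤′-refl        = refl
    go (ℕ.≤′-step m≤′n) = trans (go m≤′n) (trans (sym (+-identityʳ _)) (+-congˡ (sym (h _ (s≤s (ℕ.≤′⇒≤ m≤′n))))))

-- Sequences as exponential generating functions Σ aₙ Tⁿ/n!: the shift D is differentiation,
-- and the Leibniz rule is taken as the definition of the product.
module Hurwitz (R : CommutativeRing 0ℓ 0ℓ) where
  open CommutativeRing R
  open RingExtras R
  open SetoidReasoning setoid
  open CommutativeSemigroupProperties +-commutativeSemigroup using (interchange)

  H : Set
  H = ℕ → Carrier

  infix  4 _≋_
  infixl 7 _⋆_
  infixl 6 _⊕_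

  _≋_ : H → H → Set
  a ≋ b = ∀ n → a n ≈ b n

  D : H → H
  D a n = a (suc n)

  _⊕_ : H → H → H
  (a ⊕ b) n = a n + b n

  ⊖_ : H → H
  (⊖ a) n = - a n

  const : Carrier → H
  const r zero    = r
  const r (suc n) = 0#

  𝟘 : H
  𝟘 n = 0#

  _⋆_ : H → H → H
  (a ⋆ b) zero    = a 0 * b 0
  (a ⋆ b) (suc n) = (D a ⋆ b) n + (a ⋆ D b) n

  -- The coefficient of index n involves only coefficients of index at most n. Hence a factor may be
  -- replaced by any truncation that agrees with it up to n, which is how infinite sums are handled
  -- below.
  ⋆-cong≤ : ∀ n {a a′ b b′} → (∀ k → k ℕ.≤ n → a k ≈ a′ k) → (∀ k → k ℕ.≤ n → b k ≈ b′ k) →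
            (a ⋆ b) n ≈ (a′ ⋆ b′) n
  ⋆-cong≤ zero    p q = *-cong (p 0 z≤n) (q 0 z≤n)
  ⋆-cong≤ (suc n) p q = +-cong
    (⋆-cong≤ n (λ k k≤n → p (suc k) (s≤s k≤n)) (λ k k≤n → q k (ℕ.m≤n⇒m≤1+n k≤n)))
    (⋆-cong≤ n (λ k k≤n → p k (ℕ.m≤n⇒m≤1+n k≤n)) (λ k k≤n → q (suc k) (s≤s k≤n)))

  ⋆-cong : ∀ {a a′ b b′} → a ≋ a′ → b ≋ b′ → a ⋆ b ≋ a′ ⋆ b′
  ⋆-cong p q n = ⋆-cong≤ n (λ k _ → p k) (λ k _ → q k)

  ⋆-comm : ∀ a b → a ⋆ b ≋ b ⋆ a
  ⋆-comm a b zero    = *-comm _ _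
  ⋆-comm a b (suc n) = trans (+-comm _ _) (+-cong (⋆-comm a (D b) n) (⋆-comm (D a) b n))

  ⋆-distribʳ : ∀ c a b → (a ⊕ b) ⋆ c ≋ (a ⋆ c) ⊕ (b ⋆ c)
  ⋆-distribʳ c a b zero    = distribʳ _ _ _
  ⋆-distribʳ c a b (suc n) = trans (+-cong (⋆-distribʳ c (D a) (D b) n) (⋆-distribʳ (D c) a b n)) (interchange _ _ _ _)

  ⋆-distribˡ : ∀ c a b → c ⋆ (a ⊕ b) ≋ (c ⋆ a) ⊕ (c ⋆ b)
  ⋆-distribˡ c a b n = trans (⋆-comm c (a ⊕ b) n) (trans (⋆-distribʳ c a b n) (+-cong (⋆-comm a c n) (⋆-comm b c n)))

  ⋆-zeroˡ : ∀ a → 𝟘 ⋆ a ≋ 𝟘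
  ⋆-zeroˡ a zero    = zeroˡ _
  ⋆-zeroˡ a (suc n) = trans (+-cong (⋆-zeroˡ a n) (⋆-zeroˡ (D a) n)) (+-identityˡ 0#)

  const-⋆ : ∀ r a n → (const r ⋆ a) n ≈ r * a n
  const-⋆ r a zero    = refl
  const-⋆ r a (suc n) = trans (+-cong (⋆-zeroˡ a n) (const-⋆ r (D a) n)) (+-identityˡ _)

  ⋆-assoc : ∀ a b c → (a ⋆ b) ⋆ c ≋ a ⋆ (b ⋆ c)
  ⋆-assoc a b c zero    = *-assoc _ _ _
  ⋆-assoc a b c (suc n) = begin
    ((D a ⋆ b ⊕ a ⋆ D b) ⋆ c) n + ((a ⋆ b) ⋆ D c) n
      ≈⟨ +-congʳ (⋆-distribʳ c (D a ⋆ b) (a ⋆ D b) n) ⟩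
    (D a ⋆ b ⋆ c) n + (a ⋆ D b ⋆ c) n + (a ⋆ b ⋆ D c) n
      ≈⟨ +-assoc _ _ _ ⟩
    (D a ⋆ b ⋆ c) n + ((a ⋆ D b ⋆ c) n + (a ⋆ b ⋆ D c) n)
      ≈⟨ +-cong (⋆-assoc (D a) b c n) (+-cong (⋆-assoc a (D b) c n) (⋆-assoc a b (D c) n)) ⟩
    (D a ⋆ (b ⋆ c)) n + ((a ⋆ (D b ⋆ c)) n + (a ⋆ (b ⋆ D c)) n)
      ≈⟨ +-congˡ (⋆-distribˡ a (D b ⋆ c) (b ⋆ D c) n) ⟨
    (D a ⋆ (b ⋆ c)) n + (a ⋆ (D b ⋆ c ⊕ b ⋆ D c)) n ∎

  hurwitzRing : CommutativeRing 0ℓ 0ℓ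
  hurwitzRing = record
    { Carrier = H ; _≈_ = _≋_ ; _+_ = _⊕_ ; _*_ = _⋆_ ; -_ = ⊖_ ; 0# = 𝟘 ; 1# = const 1#
    ; isCommutativeRing = record
      { isRing = record
        { +-isAbelianGroup = record
          { isGroup = record
            { isMonoid = record
              { isSemigroup = record
                { isMagma = record
                  { isEquivalence = record
                    { refl = λ n → refl ; sym = λ p n → sym (p n) ; trans = λ p q n → trans (p n) (q n) }
                  ; ∙-cong = λ p q n → +-cong (p n) (q n) }
                ; assoc = λ a b c n → +-assoc _ _ _ }
              ; identity = (λ a n → +-identityˡ _) , (λ a n → +-identityʳ _) }
            ; inverse = (λ a n → -‿inverseˡ _) , (λ a n → -‿inverseʳ _)
            ; ⁻¹-cong = λ p n → -‿cong (p n) }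
          ; comm = λ a b n → +-comm _ _ }
        ; *-cong = ⋆-cong
        ; *-assoc = ⋆-assoc
        ; *-identity = ⋆-identityˡ , λ a n → trans (⋆-comm a _ n) (⋆-identityˡ a n)
        ; distrib = ⋆-distribˡ , ⋆-distribʳ }
      ; *-comm = ⋆-comm } }
    where
    ⋆-identityˡ : ∀ a → const 1# ⋆ a ≋ a
    ⋆-identityˡ a n = trans (const-⋆ 1# a n) (*-identityˡ _)

  module HR = CommutativeRing hurwitzRing
  open Exponentiation HR.semiring public renaming (_^_ to _^⋆_) using ()

  const-cong : ∀ {r s} → r ≈ s → const r ≋ const s
  const-cong p zero    = p
  const-cong p (suc n) = refl

  const-* : ∀ r s → const (r * s) ≋ const r ⋆ const s
  const-* r s zero    = refl
  const-* r s (suc n) = sym (trans (const-⋆ r (const s) (suc n)) (zeroʳ r))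

  const-+ : ∀ r s → const (r + s) ≋ const r ⊕ const s
  const-+ r s zero    = refl
  const-+ r s (suc n) = sym (+-identityˡ 0#)

  var : H
  var zero          = 0#
  var (suc zero)    = 1#
  var (suc (suc n)) = 0#

  -- The factor comes from the normalisation: T times aₙ Tⁿ/n! is (n + 1) aₙ Tⁿ⁺¹/(n + 1)!.
  var-⋆-suc : ∀ a n → (var ⋆ a) (suc n) ≈ nat (suc n) * a n
  var-⋆-suc a zero    = trans (+-cong (*-identityˡ _) (zeroˡ _)) (trans (+-identityʳ _) (sym (trans (*-congʳ (+-identityʳ 1#)) (*-identityˡ _))))
  var-⋆-suc a (suc n) = begin
    (D var ⋆ a) (suc n) + (var ⋆ D a) (suc n)
      ≈⟨ +-cong (⋆-cong {b = a} D-var (λ _ → refl) (suc n)) (var-⋆-suc (D a) n) ⟩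
    (const 1# ⋆ a) (suc n) + nat (suc n) * a (suc n)
      ≈⟨ +-congʳ (const-⋆ 1# a (suc n)) ⟩
    1# * a (suc n) + nat (suc n) * a (suc n)
      ≈⟨ distribʳ _ _ _ ⟨
    nat (suc (suc n)) * a (suc n) ∎
    where
    D-var : D var ≋ const 1#
    D-var zero    = refl
    D-var (suc n) = refl

  ⋆-leading : ∀ n a b → (∀ k → k ℕ.< n → b k ≈ 0#) → (a ⋆ b) n ≈ a 0 * b n
  ⋆-leading zero    a b h = refl
  ⋆-leading (suc n) a b h = begin
    (D a ⋆ b) n + (a ⋆ D b) n
      ≈⟨ +-cong (⋆-cong≤ n {D a} (λ _ _ → refl) (λ k k≤n → h k (s≤s k≤n)))
                (⋆-leading n a (D b) λ k k<n → h (suc k) (s≤s k<n)) ⟩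
    (D a ⋆ 𝟘) n + a 0 * b (suc n)
      ≈⟨ +-congʳ (trans (⋆-comm (D a) 𝟘 n) (⋆-zeroˡ (D a) n)) ⟩
    0# + a 0 * b (suc n) ≈⟨ +-identityˡ _ ⟩
    a 0 * b (suc n) ∎

  D-^ : ∀ g m → D (g ^⋆ suc m) ≋ const (nat (suc m)) ⋆ (D g ⋆ g ^⋆ m)
  D-^ g zero n = begin
    (D g ⋆ const 1#) n + (g ⋆ 𝟘) n ≈⟨ +-congˡ (trans (⋆-comm g 𝟘 n) (⋆-zeroˡ g n)) ⟩
    (D g ⋆ const 1#) n + 0# ≈⟨ +-identityʳ _ ⟩
    (D g ⋆ const 1#) n ≈⟨ *-identityˡ _ ⟨
    1# * (D g ⋆ const 1#) n ≈⟨ *-congʳ (+-identityʳ 1#) ⟨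
    nat 1 * (D g ⋆ const 1#) n ≈⟨ const-⋆ _ (D g ⋆ const 1#) n ⟨
    (const (nat 1) ⋆ (D g ⋆ const 1#)) n ∎
  D-^ g (suc m) n = begin
    (D g ⋆ g ^⋆ suc m) n + (g ⋆ D (g ^⋆ suc m)) n
      ≈⟨ +-congˡ (⋆-cong {g} (λ _ → refl) (D-^ g m) n) ⟩
    (D g ⋆ g ^⋆ suc m) n + (g ⋆ (const (nat (suc m)) ⋆ (D g ⋆ g ^⋆ m))) n
      ≈⟨ +-congˡ (rearr g (const (nat (suc m))) (D g) (g ^⋆ m) n) ⟩
    (D g ⋆ g ^⋆ suc m) n + (const (nat (suc m)) ⋆ (D g ⋆ g ^⋆ suc m)) n
      ≈⟨ +-cong (sym (*-identityˡ _)) (const-⋆ _ (D g ⋆ g ^⋆ suc m) n) ⟩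
    1# * (D g ⋆ g ^⋆ suc m) n + nat (suc m) * (D g ⋆ g ^⋆ suc m) n
      ≈⟨ distribʳ _ _ _ ⟨
    nat (suc (suc m)) * (D g ⋆ g ^⋆ suc m) n
      ≈⟨ const-⋆ _ (D g ⋆ g ^⋆ suc m) n ⟨
    (const (nat (suc (suc m))) ⋆ (D g ⋆ g ^⋆ suc m)) n ∎
    where
    open SemiringSolver HR.commutativeSemiring
    rearr : ∀ a b c d → a ⋆ (b ⋆ (c ⋆ d)) ≋ b ⋆ (c ⋆ (a ⋆ d))
    rearr = solve 4 (λ a b c d → a :* (b :* (c :* d)) := b :* (c :* (a :* d))) HR.refl

  -- By induction with the power rule: differentiation lowers both the index and the exponent by
  -- one. This makes sums over all powers of g finite in each degree.
  ^-order : ∀ g → g 0 ≈ 0# → ∀ m k → k ℕ.< m → (g ^⋆ m) k ≈ 0#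
  ^-order g g₀ (suc m) zero    _         = trans (*-congʳ g₀) (zeroˡ _)
  ^-order g g₀ (suc m) (suc k) (s≤s k<m) = begin
    D (g ^⋆ suc m) k ≈⟨ D-^ g m k ⟩
    (const (nat (suc m)) ⋆ (D g ⋆ g ^⋆ m)) k ≈⟨ const-⋆ _ (D g ⋆ g ^⋆ m) k ⟩
    nat (suc m) * (D g ⋆ g ^⋆ m) k
      ≈⟨ *-congˡ (⋆-cong≤ k {D g} (λ _ _ → refl) λ j j≤k → ^-order g g₀ m j (ℕ.≤-<-trans j≤k k<m)) ⟩
    nat (suc m) * (D g ⋆ 𝟘) k ≈⟨ *-congˡ (trans (⋆-comm (D g) 𝟘 k) (⋆-zeroˡ (D g) k)) ⟩
    nat (suc m) * 0# ≈⟨ zeroʳ _ ⟩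
    0# ∎

  ∑-coeff : ∀ n f k → RingExtras.∑ hurwitzRing n f k ≈ ∑ n (λ m → f m k)
  ∑-coeff zero    f k = refl
  ∑-coeff (suc n) f k = +-congʳ (∑-coeff n f k)

  nat-const : ∀ n → RingExtras.nat hurwitzRing n ≋ const (nat n)
  nat-const zero    zero    = refl
  nat-const zero    (suc k) = refl
  nat-const (suc n) k = trans (+-congˡ (nat-const n k)) (sym (const-+ 1# (nat n) k))

  -- The difference E of two solutions solves the same equation. If E vanishes up to index n, then B
  -- ⋆ E vanishes there, while the coefficient n of A ⋆ D E is A₀ Eₙ₊₁ = Eₙ₊₁, so the next
  -- coefficient of E vanishes too.
  linear-ode-unique : ∀ A B P Q → A 0 ≈ 1# → P 0 ≈ Q 0 → A ⋆ D P ≋ B ⋆ P → A ⋆ D Q ≋ B ⋆ Q → P ≋ Q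
  linear-ode-unique A B P Q A₀ P₀≈Q₀ odeP odeQ n = x∙y⁻¹≈ε⇒x≈y _ _ (E-zero (suc n) n ℕ.≤-refl)
    where
    E : H
    E = P ⊕ (⊖ Q)
    open RingProperties HR.ring using () renaming (-‿distribʳ-* to ⋆-⊖)
    open RingProperties ring using (x≈y⇒x∙y⁻¹≈ε; x∙y⁻¹≈ε⇒x≈y)
    ⋆-diff : ∀ C a b → C ⋆ (a ⊕ (⊖ b)) ≋ C ⋆ a ⊕ (⊖ (C ⋆ b))
    ⋆-diff C a b = HR.trans (⋆-distribˡ C a (⊖ b)) (HR.+-cong (HR.refl {C ⋆ a}) (HR.sym (⋆-⊖ C b)))
    odeE : A ⋆ D E ≋ B ⋆ E
    odeE = HR.trans (⋆-diff A (D P) (D Q))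
             (HR.trans (HR.+-cong odeP (HR.-‿cong odeQ)) (HR.sym (⋆-diff B P Q)))
    E-zero : ∀ n k → k ℕ.< n → E k ≈ 0#
    E-zero (suc n) k k<1+n with ℕ.m<1+n⇒m<n∨m≡n k<1+n
    ... | inj₁ k<n = E-zero n k k<n
    E-zero (suc zero)    .0       _ | inj₂ ≡.refl = x≈y⇒x∙y⁻¹≈ε P₀≈Q₀
    E-zero (suc (suc n)) .(suc n) _ | inj₂ ≡.refl = begin
      E (suc n) ≈⟨ *-identityˡ _ ⟨
      1# * D E n ≈⟨ *-congʳ A₀ ⟨
      A 0 * D E n ≈⟨ ⋆-leading n A (D E) (λ k k<n → E-zero (suc n) (suc k) (s≤s k<n)) ⟨
      (A ⋆ D E) n ≈⟨ odeE n ⟩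
      (B ⋆ E) n ≈⟨ ⋆-cong≤ n {B} (λ _ _ → refl) (λ k k≤n → E-zero (suc n) k (s≤s k≤n)) ⟩
      (B ⋆ 𝟘) n ≈⟨ trans (⋆-comm B 𝟘 n) (⋆-zeroˡ B n) ⟩
      0# ∎

-- ℚ-algebras, exponential and logarithm

toℚ-≃ : ∀ x → ℚ.toℚᵘ (toℚ x) ℚᵘ.≃ mkℚᵘ x 0
toℚ-≃ x = ℚ.toℚᵘ-fromℚᵘ (mkℚᵘ x 0)

toℚ-+ : ∀ x y → toℚ (x ℤ.+ y) ≡ toℚ x ℚ.+ toℚ y
toℚ-+ x y = ℚ.toℚᵘ-injective (begin-equality
  ℚ.toℚᵘ (toℚ (x ℤ.+ y))                      ≃⟨ toℚ-≃ (x ℤ.+ y) ⟩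
  mkℚᵘ (x ℤ.+ y) 0 ≡⟨ ≡.cong₂ (λ u v → mkℚᵘ (u ℤ.+ v) 0) (ℤ.*-identityʳ x) (ℤ.*-identityʳ y) ⟨
  mkℚᵘ x 0 ℚᵘ.+ mkℚᵘ y 0                      ≃⟨ ℚᵘ.+-cong (toℚ-≃ x) (toℚ-≃ y) ⟨
  ℚ.toℚᵘ (toℚ x) ℚᵘ.+ ℚ.toℚᵘ (toℚ y)          ≃⟨ ℚ.toℚᵘ-homo-+ (toℚ x) (toℚ y) ⟨
  ℚ.toℚᵘ (toℚ x ℚ.+ toℚ y) ∎)
  where open ℚᵘ.≤-Reasoning

toℚ-* : ∀ x y → toℚ (x ℤ.* y) ≡ toℚ x ℚ.* toℚ y
toℚ-* x y = ℚ.toℚᵘ-injective (begin-equality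
  ℚ.toℚᵘ (toℚ (x ℤ.* y))                      ≃⟨ toℚ-≃ (x ℤ.* y) ⟩
  mkℚᵘ x 0 ℚᵘ.* mkℚᵘ y 0                      ≃⟨ ℚᵘ.*-cong (toℚ-≃ x) (toℚ-≃ y) ⟨
  ℚ.toℚᵘ (toℚ x) ℚᵘ.* ℚ.toℚᵘ (toℚ y)          ≃⟨ ℚ.toℚᵘ-homo-* (toℚ x) (toℚ y) ⟨
  ℚ.toℚᵘ (toℚ x ℚ.* toℚ y) ∎)
  where open ℚᵘ.≤-Reasoning

toℚ-injective : ∀ {x y} → toℚ x ≡ toℚ y → x ≡ y
toℚ-injective {x} {y} p = ≡.trans (≡.sym (ℤ.*-identityʳ x)) (≡.trans (ℚᵘ.drop-*≡* x≃y) (ℤ.*-identityʳ y))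
  where
  x≃y : mkℚᵘ x 0 ℚᵘ.≃ mkℚᵘ y 0
  x≃y = ℚᵘ.≃-trans (ℚᵘ.≃-sym (toℚ-≃ x)) (ℚᵘ.≃-trans (ℚᵘ.≃-reflexive (≡.cong ℚ.toℚᵘ p)) (toℚ-≃ y))

invℕ-inverse : ∀ n .{{_ : ℕ.NonZero n}} → invℕ n ℚ.* fromℕ n ≡ 1ℚ
invℕ-inverse (suc n) = ℚ.toℚᵘ-injective (begin-equality
  ℚ.toℚᵘ (invℕ (suc n) ℚ.* fromℕ (suc n))                 ≃⟨ ℚ.toℚᵘ-homo-* (invℕ (suc n)) (fromℕ (suc n)) ⟩
  ℚ.toℚᵘ (invℕ (suc n)) ℚᵘ.* ℚ.toℚᵘ (fromℕ (suc n))
    ≃⟨ ℚᵘ.*-cong (ℚ.toℚᵘ-fromℚᵘ (mkℚᵘ (ℤ.+ 1) n)) (toℚ-≃ (ℤ.+ suc n)) ⟩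
  mkℚᵘ (ℤ.+ 1) n ℚᵘ.* mkℚᵘ (ℤ.+ suc n) 0                  ≃⟨ ℚᵘ.*≡* num≡den ⟩
  ℚᵘ.1ℚᵘ ∎)
  where
  open ℚᵘ.≤-Reasoning
  num≡den : (ℤ.+ 1 ℤ.* ℤ.+ suc n) ℤ.* ℤ.+ 1 ≡ ℤ.+ 1 ℤ.* (ℤ.+ suc n ℤ.* ℤ.+ 1)
  num≡den = ℤ.*-assoc (ℤ.+ 1) (ℤ.+ suc n) (ℤ.+ 1)

record ℚAlgebra : Set₁ where
  field
    commRing : CommutativeRing 0ℓ 0ℓ
  open CommutativeRing commRing public
  open RingExtras commRing public
  field
    ι   : ℚ → Carrier
    ι-+ : ∀ p q → ι (p ℚ.+ q) ≈ ι p + ι q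
    ι-* : ∀ p q → ι (p ℚ.* q) ≈ ι p * ι q
    ι-1 : ι 1ℚ ≈ 1#

  open RingProperties ring using (+-identityʳ-unique; +-cancelˡ)

  ι-0 : ι 0ℚ ≈ 0#
  ι-0 = +-identityʳ-unique (ι 0ℚ) (ι 0ℚ) (trans (sym (ι-+ 0ℚ 0ℚ)) (reflexive ≡.refl))

  ι-neg : ∀ p → ι (ℚ.- p) ≈ - ι p
  ι-neg p = +-cancelˡ (ι p) _ _ (trans (sym (ι-+ p (ℚ.- p)))
              (trans (reflexive (≡.cong ι (ℚ.+-inverseʳ p))) (trans ι-0 (sym (-‿inverseʳ (ι p))))))

  ι-nat : ∀ n → ι (fromℕ n) ≈ nat n
  ι-nat zero    = ι-0
  ι-nat (suc n) = trans (reflexive (≡.cong ι (toℚ-+ (ℤ.+ 1) (ℤ.+ n)))) (trans (ι-+ _ _) (+-cong ι-1 (ι-nat n)))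

  invnat-nat : ∀ n .{{_ : ℕ.NonZero n}} → ι (invℕ n) * nat n ≈ 1#
  invnat-nat n = trans (*-congˡ (sym (ι-nat n)))
                   (trans (sym (ι-* _ _)) (trans (reflexive (≡.cong ι (invℕ-inverse n))) ι-1))

  nat-cancel : ∀ n .{{_ : ℕ.NonZero n}} {x} → nat n * x ≈ 0# → x ≈ 0#
  nat-cancel n {x} p = begin
    x ≈⟨ *-identityˡ x ⟨
    1# * x ≈⟨ *-congʳ (invnat-nat n) ⟨
    ι (invℕ n) * nat n * x ≈⟨ *-assoc _ _ _ ⟩
    ι (invℕ n) * (nat n * x) ≈⟨ *-congˡ p ⟩
    ι (invℕ n) * 0# ≈⟨ zeroʳ _ ⟩
    0# ∎
    where open SetoidReasoning setoid

  -- The reason why the exponential is its own derivative: the factor m + 1 from the power rule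
  -- turns 1/(m + 1)! into 1/m!.
  inv!-step : ∀ m → ι (invℕ (suc m !)) * nat (suc m) ≈ ι (invℕ (m !))
  inv!-step m = begin
    a * s ≈⟨ *-identityʳ _ ⟨
    a * s * 1# ≈⟨ *-congˡ (trans (*-comm _ _) (invnat-nat (m !))) ⟨
    a * s * (f * b) ≈⟨ solve 4 (λ a s f b → a :* s :* (f :* b) := a :* (s :* f) :* b) refl a s f b ⟩
    a * (s * f) * b ≈⟨ *-congʳ (*-congˡ (nat-* (suc m) (m !))) ⟨
    a * nat (suc m !) * b ≈⟨ *-congʳ (invnat-nat (suc m !)) ⟩
    1# * b ≈⟨ *-identityˡ b ⟩
    b ∎
    where
    open SetoidReasoning setoid
    open SemiringSolver commutativeSemiring
    instance
      _ = ℕ._!≢0 m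
      _ = ℕ._!≢0 (suc m)
    a = ι (invℕ (suc m !))
    s = nat (suc m)
    f = nat (m !)
    b = ι (invℕ (m !))

hurwitzAlgebra : ℚAlgebra → ℚAlgebra
hurwitzAlgebra A = record
  { commRing = hurwitzRing
  ; ι    = λ q → const (ι q)
  ; ι-+  = λ p q → HR.trans (const-cong (ι-+ p q)) (const-+ _ _)
  ; ι-*  = λ p q → HR.trans (const-cong (ι-* p q)) (const-* _ _)
  ; ι-1  = const-cong ι-1 }
  where
  open ℚAlgebra A
  open Hurwitz commRing

ℚ-algebra : ℚAlgebra
ℚ-algebra = record
  { commRing = ℚ.+-*-commutativeRing ; ι = λ q → q
  ; ι-+ = λ _ _ → ≡.refl ; ι-* = λ _ _ → ≡.refl ; ι-1 = ≡.refl }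

-- A copy of the sign that is local to `logS`, so that it can be named; `τ-log` identifies the two.
altSign : ℕ → ℚ
altSign zero          = 0ℚ
altSign (suc zero)    = 1ℚ
altSign (suc (suc m)) = ℚ.- (altSign (suc m))

module ExpLog (A : ℚAlgebra) where
  open ℚAlgebra A
  open Hurwitz commRing
  open SetoidReasoning setoid

  -- The cut-off at k follows `expS` and `logS`. It loses nothing when the series that is raised to
  -- powers has no constant term, since its m-th power then starts in degree m.
  expH logH : H → H
  expH g k = ∑ k λ m → ι (invℕ (m !)) * (g ^⋆ m) k
  logH f k = ∑ k λ m → ι (altSign m ℚ.* invℕ m) * ((f ⊕ (⊖ const 1#)) ^⋆ m) k

  private
    D-term : ∀ m {p q} g k → p * nat (suc m) ≈ q →
             p * (g ^⋆ suc m) (suc k) ≈ q * (D g ⋆ g ^⋆ m) k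
    D-term m {p} {q} g k h = begin
      p * D (g ^⋆ suc m) k ≈⟨ *-congˡ (D-^ g m k) ⟩
      p * (const (nat (suc m)) ⋆ (D g ⋆ g ^⋆ m)) k ≈⟨ *-congˡ (const-⋆ _ (D g ⋆ g ^⋆ m) k) ⟩
      p * (nat (suc m) * (D g ⋆ g ^⋆ m) k) ≈⟨ *-assoc _ _ _ ⟨
      p * nat (suc m) * (D g ⋆ g ^⋆ m) k ≈⟨ *-congʳ h ⟩
      q * (D g ⋆ g ^⋆ m) k ∎

    -- Termwise differentiation. The summand m = 0 is constant and disappears, so after the shift of
    -- index the cut-off drops from k + 1 to k.
    D-series : ∀ g (p q : ℕ → Carrier) k → (∀ m → p (suc m) * nat (suc m) ≈ q m) →
               ∑ (suc k) (λ m → p m * (g ^⋆ m) (suc k)) ≈ ∑ k (λ m → q m * (D g ⋆ g ^⋆ m) k)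
    D-series g p q k h = begin
      ∑ (suc k) (λ m → p m * (g ^⋆ m) (suc k)) ≈⟨ ∑-suc k _ ⟩
      p 0 * 0# + ∑ k (λ m → p (suc m) * (g ^⋆ suc m) (suc k)) ≈⟨ +-congʳ (zeroʳ _) ⟩
      0# + ∑ k (λ m → p (suc m) * (g ^⋆ suc m) (suc k)) ≈⟨ +-identityˡ _ ⟩
      ∑ k (λ m → p (suc m) * (g ^⋆ suc m) (suc k)) ≈⟨ ∑-cong k (λ m _ → D-term m g k (h m)) ⟩
      ∑ k (λ m → q m * (D g ⋆ g ^⋆ m) k) ∎

    -- In `expH` and `logH` the cut-off moves with the coefficient, so they are not finite sums in
    -- the ring of series. Here the cut-off is fixed, ring laws apply, and `partial-stable` shows
    -- that a coefficient no longer changes once the cut-off has reached its index.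
    partial : H → (ℕ → Carrier) → ℕ → H
    partial g q n = RingExtras.∑ hurwitzRing n (λ m → const (q m) ⋆ g ^⋆ m)

    partial-coeff : ∀ g q n k → partial g q n k ≈ ∑ n (λ m → q m * (g ^⋆ m) k)
    partial-coeff g q n k = trans (∑-coeff n _ k) (∑-cong n λ m _ → const-⋆ (q m) (g ^⋆ m) k)

    ∑-⋆-partial : ∀ a g q k → ∑ k (λ m → q m * (a ⋆ g ^⋆ m) k) ≈ (a ⋆ partial g q k) k
    ∑-⋆-partial a g q k = begin
      ∑ k (λ m → q m * (a ⋆ g ^⋆ m) k) ≈⟨ ∑-cong k (λ m _ → const-⋆ (q m) (a ⋆ g ^⋆ m) k) ⟨
      ∑ k (λ m → (const (q m) ⋆ (a ⋆ g ^⋆ m)) k) ≈⟨ ∑-cong k (λ m _ → x∙yz≈y∙xz (const (q m)) a (g ^⋆ m) k) ⟩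
      ∑ k (λ m → (a ⋆ (const (q m) ⋆ g ^⋆ m)) k) ≈⟨ ∑-coeff k _ k ⟨
      RingExtras.∑ hurwitzRing k (λ m → a ⋆ (const (q m) ⋆ g ^⋆ m)) k
        ≈⟨ RingExtras.∑-*ˡ hurwitzRing k a (λ m → const (q m) ⋆ g ^⋆ m) k ⟩
      (a ⋆ partial g q k) k ∎
      where open CommutativeSemigroupProperties HR.*-commutativeSemigroup using (x∙yz≈y∙xz)

    partial-stable : ∀ g q → g 0 ≈ 0# → ∀ {j k} → j ℕ.≤ k → partial g q j j ≈ partial g q k j
    partial-stable g q g₀ {j} {k} j≤k = begin
      partial g q j j ≈⟨ partial-coeff g q j j ⟩
      ∑ j (λ m → q m * (g ^⋆ m) j)
        ≈⟨ ∑-extend j≤k _ (λ m j<m → trans (*-congˡ (^-order g g₀ m j j<m)) (zeroʳ _)) ⟩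
      ∑ k (λ m → q m * (g ^⋆ m) j) ≈⟨ partial-coeff g q k j ⟨
      partial g q k j ∎

  expH-zero : ∀ g → expH g 0 ≈ 1#
  expH-zero g = trans (*-congʳ ι-1) (*-identityˡ 1#)

  D-expH : ∀ g → g 0 ≈ 0# → D (expH g) ≋ D g ⋆ expH g
  D-expH g g₀ k = begin
    expH g (suc k) ≈⟨ D-series g _ _ k inv!-step ⟩
    ∑ k (λ m → q m * (D g ⋆ g ^⋆ m) k) ≈⟨ ∑-⋆-partial (D g) g q k ⟩
    (D g ⋆ partial g q k) k ≈⟨ ⋆-cong≤ k {D g} (λ _ _ → refl) (λ j j≤k →
                                                   trans (sym (partial-stable g q g₀ j≤k)) (partial-coeff g q j j)) ⟩
    (D g ⋆ expH g) k ∎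
    where
    q : ℕ → Carrier
    q m = ι (invℕ (m !))

  logH-zero : ∀ f → logH f 0 ≈ 0#
  logH-zero f = trans (*-congʳ ι-0) (zeroˡ _)

  -- Multiplied out, as f has no inverse at hand. With u = f - 1 the derivative of the logarithm is
  -- D u times the geometric series of -u, and f = 1 + u inverts that series. With cut-off k the
  -- product telescopes to 1 ± uᵏ⁺¹, and the remainder is invisible up to degree k.
  D-logH : ∀ f → f 0 ≈ 1# → f ⋆ D (logH f) ≋ D f
  D-logH f f₀ k = begin
    (f ⋆ D (logH f)) k
      ≈⟨ ⋆-cong≤ k (λ j _ → f≋1+u j) (λ j j≤k → trans (D-log j) (⋆-cong≤ j {D u} (λ _ _ → refl)
           (λ i i≤j → trans (sym (partial-stable u q u₀ i≤j)) (partial-stable u q u₀ (ℕ.≤-trans i≤j j≤k))))) ⟩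
    ((const 1# ⊕ u) ⋆ (D u ⋆ partial u q k)) k ≈⟨ x∙yz≈y∙xz (const 1# ⊕ u) (D u) (partial u q k) k ⟩
    (D u ⋆ ((const 1# ⊕ u) ⋆ partial u q k)) k ≈⟨ ⋆-cong≤ k {D u} (λ _ _ → refl) (λ j j≤k → geometric k j (s≤s j≤k)) ⟩
    (D u ⋆ const 1#) k ≈⟨ HR.*-identityʳ (D u) k ⟩
    f (suc k) + - 0# ≈⟨ +-congˡ -0#≈0# ⟩
    f (suc k) + 0# ≈⟨ +-identityʳ _ ⟩
    f (suc k) ∎
    where
    open RingProperties ring using (-0#≈0#; -‿distribˡ-*)
    open CommutativeSemigroupProperties HR.*-commutativeSemigroup using (x∙yz≈y∙xz)
    u : H
    u = f ⊕ (⊖ const 1#)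
    u₀ : u 0 ≈ 0#
    u₀ = trans (+-congʳ f₀) (-‿inverseʳ 1#)
    f≋1+u : f ≋ const 1# ⊕ u
    f≋1+u n = sym (begin
      const 1# n + (f n + - const 1# n) ≈⟨ +-comm _ _ ⟩
      (f n + - const 1# n) + const 1# n ≈⟨ +-assoc _ _ _ ⟩
      f n + (- const 1# n + const 1# n) ≈⟨ +-congˡ (-‿inverseˡ _) ⟩
      f n + 0# ≈⟨ +-identityʳ _ ⟩
      f n ∎)
    q : ℕ → Carrier
    q m = ι (altSign (suc m))
    D-log : ∀ j → D (logH f) j ≈ (D u ⋆ partial u q j) j
    D-log j = trans (D-series u _ q j coefficient) (∑-⋆-partial (D u) u q j)
      where
      coefficient : ∀ m → ι (altSign (suc m) ℚ.* invℕ (suc m)) * nat (suc m) ≈ q m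
      coefficient m = begin
        ι (altSign (suc m) ℚ.* invℕ (suc m)) * nat (suc m) ≈⟨ *-congʳ (ι-* _ _) ⟩
        q m * ι (invℕ (suc m)) * nat (suc m) ≈⟨ *-assoc _ _ _ ⟩
        q m * (ι (invℕ (suc m)) * nat (suc m)) ≈⟨ *-congˡ (invnat-nat (suc m)) ⟩
        q m * 1# ≈⟨ *-identityʳ _ ⟩
        q m ∎
    telescope : ∀ k → (const 1# ⊕ u) ⋆ partial u q k ≋ const 1# ⊕ const (q k) ⋆ u ^⋆ suc k
    telescope zero = HR.trans (HR.*-congˡ {const 1# ⊕ u} (HR.trans (HR.*-congʳ {const 1#} q₀) (HR.*-identityˡ _)))
      (HR.trans (HR.*-identityʳ (const 1# ⊕ u)) (HR.+-congˡ {const 1#}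
        (HR.trans (HR.sym (HR.*-identityʳ u)) (HR.trans (HR.sym (HR.*-identityˡ _)) (HR.*-congʳ {u ⋆ const 1#} (HR.sym q₀))))))
      where
      q₀ : const (q 0) ≋ const 1#
      q₀ = const-cong ι-1
    telescope (suc k) = HR.trans (HR.distribˡ (const 1# ⊕ u) (partial u q k) (c′ ⋆ w))
      (HR.trans (HR.+-congʳ {(const 1# ⊕ u) ⋆ (c′ ⋆ w)} (telescope k))
      (HR.trans (solve 5 (λ o c c′ u w → (o :+ c :* w) :+ (con 1 :+ u) :* (c′ :* w)
                                       := (o :+ c′ :* (u :* w)) :+ (c :+ c′) :* w) HR.refl (const 1#) c c′ u w)
      (HR.trans (HR.+-congˡ {const 1# ⊕ c′ ⋆ (u ⋆ w)} (HR.trans (HR.*-congʳ {w} c+c′) (HR.zeroˡ w)))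
        (HR.+-identityʳ _))))
      where
      open SemiringSolver HR.commutativeSemiring
      c c′ w : H
      c  = const (q k)
      c′ = const (q (suc k))
      w  = u ^⋆ suc k
      c+c′ : c ⊕ c′ ≋ 𝟘
      c+c′ zero    = trans (+-congˡ (ι-neg _)) (-‿inverseʳ _)
      c+c′ (suc n) = +-identityʳ 0#
    geometric : ∀ k j → j ℕ.< suc k → ((const 1# ⊕ u) ⋆ partial u q k) j ≈ const 1# j
    geometric k j j<1+k = begin
      ((const 1# ⊕ u) ⋆ partial u q k) j ≈⟨ telescope k j ⟩
      const 1# j + (const (q k) ⋆ u ^⋆ suc k) j ≈⟨ +-congˡ (const-⋆ (q k) (u ^⋆ suc k) j) ⟩
      const 1# j + q k * (u ^⋆ suc k) j ≈⟨ +-congˡ (*-congˡ (^-order u u₀ (suc k) j j<1+k)) ⟩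
      const 1# j + q k * 0# ≈⟨ +-congˡ (zeroʳ _) ⟩
      const 1# j + 0# ≈⟨ +-identityʳ _ ⟩
      const 1# j ∎

-- Polynomials determined by their values

record RingHom (K S : CommutativeRing 0ℓ 0ℓ) : Set where
  private
    module K = CommutativeRing K
    module S = CommutativeRing S
  field
    ⟦_⟧    : K.Carrier → S.Carrier
    ⟦⟧-cong : ∀ {a b} → a K.≈ b → ⟦ a ⟧ S.≈ ⟦ b ⟧
    +-hom  : ∀ a b → ⟦ a K.+ b ⟧ S.≈ ⟦ a ⟧ S.+ ⟦ b ⟧
    *-hom  : ∀ a b → ⟦ a K.* b ⟧ S.≈ ⟦ a ⟧ S.* ⟦ b ⟧
    0-hom  : ⟦ K.0# ⟧ S.≈ S.0#
    1-hom  : ⟦ K.1# ⟧ S.≈ S.1#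

idHom : ∀ K → RingHom K K
idHom K = record { ⟦_⟧ = λ a → a ; ⟦⟧-cong = λ p → p ; +-hom = λ _ _ → refl ; *-hom = λ _ _ → refl ; 0-hom = refl ; 1-hom = refl }
  where open CommutativeRing K

constHom : ∀ K → RingHom K (Hurwitz.hurwitzRing K)
constHom K = record
  { ⟦_⟧ = const ; ⟦⟧-cong = const-cong ; +-hom = const-+ ; *-hom = const-*
  ; 0-hom = λ { zero → refl ; (suc n) → refl } ; 1-hom = HR.refl }
  where
  open CommutativeRing K
  open Hurwitz K

module PolynomialOperations (K : CommutativeRing 0ℓ 0ℓ) where
  open CommutativeRing K
  open RingExtras K

  Poly : Set
  Poly = List Carrier

  addP : Poly → Poly → Poly
  addP []       ds       = ds
  addP (c ∷ cs) []       = c ∷ cs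
  addP (c ∷ cs) (d ∷ ds) = c + d ∷ addP cs ds

  scaleP : Carrier → Poly → Poly
  scaleP c = map (c *_)

  mulP : Poly → Poly → Poly
  mulP []       ds = []
  mulP (c ∷ cs) ds = addP (scaleP c ds) (0# ∷ mulP cs ds)

  -- (1 + t) p(2x) − p(x), which for t = 0 loses the constant coefficient of p
  dilate : ℕ → Poly → Poly
  dilate t []       = []
  dilate t (c ∷ cs) = nat t * c ∷ dilate (suc (2 ℕ.* t)) cs

  length-dilate : ∀ t cs → length (dilate t cs) ≡ length cs
  length-dilate t []       = ≡.refl
  length-dilate t (c ∷ cs) = ≡.cong suc (length-dilate _ cs)

module Horner (K S : CommutativeRing 0ℓ 0ℓ) (h : RingHom K S) where
  private module K = CommutativeRing K
  open PolynomialOperations K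
  open CommutativeRing S
  open RingHom h
  open SetoidReasoning setoid
  open SemiringSolver commutativeSemiring using (solve; _:=_; _:+_; _:*_; con)
  open CommutativeSemigroupProperties +-commutativeSemigroup using (interchange)

  -- The coefficients pass through h, so that one list of coefficients can be evaluated both at
  -- numbers of K and at the indeterminate of the series over K.
  eval : Poly → Carrier → Carrier
  eval []       x = 0#
  eval (c ∷ cs) x = ⟦ c ⟧ + x * eval cs x

  eval-add : ∀ cs ds x → eval (addP cs ds) x ≈ eval cs x + eval ds x
  eval-add []       ds       x = sym (+-identityˡ _)
  eval-add (c ∷ cs) []       x = sym (+-identityʳ _)
  eval-add (c ∷ cs) (d ∷ ds) x = begin
    ⟦ c K.+ d ⟧ + x * eval (addP cs ds) x ≈⟨ +-cong (+-hom c d) (*-congˡ (eval-add cs ds x)) ⟩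
    (⟦ c ⟧ + ⟦ d ⟧) + x * (eval cs x + eval ds x) ≈⟨ +-congˡ (distribˡ _ _ _) ⟩
    (⟦ c ⟧ + ⟦ d ⟧) + (x * eval cs x + x * eval ds x) ≈⟨ interchange _ _ _ _ ⟩
    (⟦ c ⟧ + x * eval cs x) + (⟦ d ⟧ + x * eval ds x) ∎

  eval-scale : ∀ c ds x → eval (scaleP c ds) x ≈ ⟦ c ⟧ * eval ds x
  eval-scale c []       x = sym (zeroʳ _)
  eval-scale c (d ∷ ds) x = begin
    ⟦ c K.* d ⟧ + x * eval (scaleP c ds) x ≈⟨ +-cong (*-hom c d) (*-congˡ (eval-scale c ds x)) ⟩
    ⟦ c ⟧ * ⟦ d ⟧ + x * (⟦ c ⟧ * eval ds x)
      ≈⟨ solve 4 (λ c d x e → c :* d :+ x :* (c :* e) := c :* (d :+ x :* e)) refl _ _ _ _ ⟩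
    ⟦ c ⟧ * (⟦ d ⟧ + x * eval ds x) ∎

  eval-mul : ∀ cs ds x → eval (mulP cs ds) x ≈ eval cs x * eval ds x
  eval-mul []       ds x = sym (zeroˡ _)
  eval-mul (c ∷ cs) ds x = begin
    eval (addP (scaleP c ds) (K.0# ∷ mulP cs ds)) x ≈⟨ eval-add (scaleP c ds) _ x ⟩
    eval (scaleP c ds) x + (⟦ K.0# ⟧ + x * eval (mulP cs ds) x)
      ≈⟨ +-cong (eval-scale c ds x) (+-cong 0-hom (*-congˡ (eval-mul cs ds x))) ⟩
    ⟦ c ⟧ * eval ds x + (0# + x * (eval cs x * eval ds x))
      ≈⟨ solve 4 (λ c d x e → c :* d :+ (con 0 :+ x :* (e :* d)) := (c :+ x :* e) :* d) refl _ _ _ _ ⟩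
    (⟦ c ⟧ + x * eval cs x) * eval ds x ∎

  eval-vanishing : ∀ {cs} → All (K._≈ K.0#) cs → ∀ x → eval cs x ≈ 0#
  eval-vanishing []       x = refl
  eval-vanishing (p ∷ ps) x = begin
    _ + x * _ ≈⟨ +-cong (trans (⟦⟧-cong p) 0-hom) (*-congˡ (eval-vanishing ps x)) ⟩
    0# + x * 0# ≈⟨ +-identityˡ _ ⟩
    x * 0# ≈⟨ zeroʳ x ⟩
    0# ∎

module Polynomials (K : ℚAlgebra) where
  open ℚAlgebra K
  open PolynomialOperations commRing
  open Hurwitz commRing
  private
    module V = Horner commRing commRing (idHom commRing)
    module F = Horner commRing hurwitzRing (constHom commRing)
  open SetoidReasoning setoid

  -- The points 2, 4, 8, ...: even, as the count of solutions requires, and closed under doubling,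
  -- as the elimination by `dilate` requires.
  points : ℕ → ℕ
  points k = 2 ℕ.^ suc k

  value : Poly → ℕ → Carrier
  value cs k = V.eval cs (nat (points k))

  -- The coefficient of index j is multiplied by (1 + t) 2ʲ - 1. Passing from j to j + 1 replaces t
  -- by 2 (1 + t) - 1 = 2t + 1, the parameter of the recursive call. Moving p(x) to the left side
  -- avoids subtraction.
  eval-dilate : ∀ t cs x → V.eval (dilate t cs) x + V.eval cs x ≈ nat (suc t) * V.eval cs (nat 2 * x)
  eval-dilate t []       x = trans (+-identityʳ _) (sym (zeroʳ _))
  eval-dilate t (c ∷ cs) x = begin
    (nat t * c + x * V.eval (dilate (suc (2 ℕ.* t)) cs) x) + (c + x * V.eval cs x)
      ≈⟨ solve 5 (λ t c x d e → (t :* c :+ x :* d) :+ (c :+ x :* e) := (con 1 :+ t) :* c :+ x :* (d :+ e)) refl _ _ _ _ _ ⟩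
    (1# + nat t) * c + x * (V.eval (dilate (suc (2 ℕ.* t)) cs) x + V.eval cs x)
      ≈⟨ +-congˡ (*-congˡ (eval-dilate _ cs x)) ⟩
    (1# + nat t) * c + x * (nat (suc (suc (2 ℕ.* t))) * e′)
      ≈⟨ +-congˡ (*-congˡ (*-congʳ (+-congˡ (+-congˡ (nat-* 2 t))))) ⟩
    (1# + nat t) * c + x * ((1# + (1# + nat 2 * nat t)) * e′)
      ≈⟨ solve 4 (λ t c x e → (con 1 :+ t) :* c :+ x :* ((con 1 :+ (con 1 :+ (con 1 :+ (con 1 :+ con 0)) :* t)) :* e)
                            := (con 1 :+ t) :* (c :+ ((con 1 :+ (con 1 :+ con 0)) :* x) :* e)) refl (nat t) c x e′ ⟩
    (1# + nat t) * (c + (nat 2 * x) * e′) ∎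
    where
    open SemiringSolver commutativeSemiring
    e′ = V.eval cs (nat 2 * x)

  -- For t ≥ 1 all the multipliers (1 + t) 2ʲ - 1 are positive integers, which can be cancelled in a
  -- ℚ-algebra.
  dilate-injective : ∀ t .{{_ : ℕ.NonZero t}} cs → All (_≈ 0#) (dilate t cs) → All (_≈ 0#) cs
  dilate-injective t []       []       = []
  dilate-injective t (c ∷ cs) (p ∷ ps) = nat-cancel t p ∷ dilate-injective _ cs ps

  -- K is not assumed to be a domain, so roots cannot be counted. Let c + x p(x) vanish at all
  -- points. Subtracting its values at x and 2x and cancelling the positive integer x gives 2 p(2x)
  -- - p(x) = 0, which is `dilate 1` applied to p. This polynomial has the length of p, so induction
  -- on the length shows that it is zero, hence p is, and then c is.
  value-zero⇒zero : ∀ cs → (∀ k → value cs k ≈ 0#) → All (_≈ 0#) cs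
  value-zero⇒zero cs h = go (length cs) cs ≡.refl h
    where
    open RingProperties ring using (+-cancelˡ; +-cancelʳ)
    go : ∀ n cs → length cs ≡ n → (∀ k → value cs k ≈ 0#) → All (_≈ 0#) cs
    go zero    []       _  h = []
    go (suc n) (c ∷ cs) eq h = c≈0 ∷ cs≈0
      where
      open SemiringSolver commutativeSemiring
      dilate-zero : ∀ k → value (dilate 1 cs) k ≈ 0#
      dilate-zero k = nat-cancel (points k) {{ℕ.m^n≢0 2 (suc k)}} (+-cancelʳ (c + x * E) _ _ (begin
        x * V.eval (dilate 1 cs) x + (c + x * E)
          ≈⟨ solve 4 (λ x d c e → x :* d :+ (c :+ x :* e) := c :+ x :* (d :+ e)) refl _ _ _ _ ⟩
        c + x * (V.eval (dilate 1 cs) x + E) ≈⟨ +-congˡ (*-congˡ (eval-dilate 1 cs x)) ⟩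
        c + x * (nat 2 * V.eval cs (nat 2 * x))
          ≈⟨ solve 4 (λ x d c e → c :+ x :* (d :* e) := c :+ (d :* x) :* e) refl _ _ _ _ ⟩
        c + (nat 2 * x) * V.eval cs (nat 2 * x) ≈⟨ +-congˡ (*-cong 2x (evalCong cs 2x)) ⟨
        value (c ∷ cs) (suc k) ≈⟨ h (suc k) ⟩
        0# ≈⟨ h k ⟨
        c + x * E ≈⟨ +-identityˡ _ ⟨
        0# + (c + x * E) ∎))
        where
        x E : Carrier
        x = nat (points k)
        E = V.eval cs x
        2x : nat (points (suc k)) ≈ nat 2 * x
        2x = nat-* 2 (points k)
        evalCong : ∀ cs {x y} → x ≈ y → V.eval cs x ≈ V.eval cs y
        evalCong []       p = refl
        evalCong (c ∷ cs) p = +-congˡ (*-cong p (evalCong cs p))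
      cs≈0 : All (_≈ 0#) cs
      cs≈0 = dilate-injective 1 cs (go n (dilate 1 cs) (≡.trans (length-dilate 1 cs) (ℕ.suc-injective eq)) dilate-zero)
      c≈0 : c ≈ 0#
      c≈0 = begin
        c ≈⟨ +-identityʳ c ⟨
        c + 0# ≈⟨ +-congˡ (trans (*-congˡ (V.eval-vanishing cs≈0 _)) (zeroʳ _)) ⟨
        value (c ∷ cs) 0 ≈⟨ h 0 ⟩
        0# ∎

  -- a is a polynomial in X whose value at X = points k is φ k
  HasValues : H → (ℕ → Carrier) → Set
  HasValues a φ = Σ Poly λ cs → (a ≋ F.eval cs var) × (∀ k → φ k ≈ value cs k)

  values-cong : ∀ {a b φ ψ} → a ≋ b → (∀ k → φ k ≈ ψ k) → HasValues a φ → HasValues b ψ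
  values-cong p q (cs , u , v) = cs , HR.trans (HR.sym p) u , λ k → trans (sym (q k)) (v k)

  values-+ : ∀ {a b φ ψ} → HasValues a φ → HasValues b ψ → HasValues (a ⊕ b) (λ k → φ k + ψ k)
  values-+ (cs , p , q) (ds , p′ , q′) = addP cs ds
    , HR.trans (HR.+-cong p p′) (HR.sym (F.eval-add cs ds var))
    , λ k → trans (+-cong (q k) (q′ k)) (sym (V.eval-add cs ds _))

  values-* : ∀ {a b φ ψ} → HasValues a φ → HasValues b ψ → HasValues (a ⋆ b) (λ k → φ k * ψ k)
  values-* (cs , p , q) (ds , p′ , q′) = mulP cs ds
    , HR.trans (HR.*-cong p p′) (HR.sym (F.eval-mul cs ds var))
    , λ k → trans (*-cong (q k) (q′ k)) (sym (V.eval-mul cs ds _))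

  values-const : ∀ c → HasValues (const c) (λ _ → c)
  values-const c = c ∷ []
    , HR.sym (HR.trans (HR.+-congˡ {const c} (HR.zeroʳ var)) (HR.+-identityʳ (const c)))
    , λ k → sym (trans (+-congˡ (zeroʳ _)) (+-identityʳ c))

  values-0 : HasValues 𝟘 (λ _ → 0#)
  values-0 = [] , HR.refl , λ _ → refl

  values-var : HasValues var (λ k → nat (points k))
  values-var = 0# ∷ 1# ∷ []
    , HR.sym (HR.trans (HR.+-cong const0 (HR.trans (HR.*-congˡ {var} (HR.trans (HR.+-congˡ {const 1#} (HR.zeroʳ var)) (HR.+-identityʳ (const 1#)))) (HR.*-identityʳ var))) (HR.+-identityˡ var))
    , λ k → sym (trans (+-identityˡ _) (trans (*-congˡ (trans (+-congˡ (zeroʳ _)) (+-identityʳ 1#))) (*-identityʳ _)))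
    where
    const0 : const 0# ≋ 𝟘
    const0 = RingHom.0-hom (constHom commRing)

  -- The two coefficient lists may differ by trailing zeros, so the difference of a and b is formed
  -- and all its coefficients are shown to vanish. It is written as a + (-1) b because `HasValues`
  -- is closed under sums, products and constants.
  values-determine : ∀ {a b φ} → HasValues a φ → HasValues b φ → a ≋ b
  values-determine {a} {b} {φ} va vb = x∙y⁻¹≈ε⇒x≈y a b (HR.trans (HR.+-congˡ {a} (HR.sym (-1*x≈-x b))) a-b≋0)
    where
    open RingProperties HR.ring using (x∙y⁻¹≈ε⇒x≈y; -1*x≈-x)
    open RingProperties ring using () renaming (-1*x≈-x to -1*x≈-xᴷ; -0#≈0# to -0ᴷ)
    const-neg : const (- 1#) ≋ ⊖ const 1#
    const-neg zero    = refl
    const-neg (suc n) = sym -0ᴷ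
    v : HasValues (a ⊕ (⊖ const 1#) ⋆ b) (λ _ → 0#)
    v = values-cong (HR.+-congˡ {a} (HR.*-congʳ {b} const-neg)) (λ k → trans (+-congˡ (-1*x≈-xᴷ _)) (-‿inverseʳ _))
          (values-+ va (values-* (values-const (- 1#)) vb))
    a-b≋0 : a ⊕ (⊖ const 1#) ⋆ b ≋ 𝟘
    a-b≋0 = let cs , p , q = v in
      HR.trans p (F.eval-vanishing (value-zero⇒zero cs λ k → sym (q k)) var)

-- Differential equations of powers and products

module LinearOde (R : CommutativeRing 0ℓ 0ℓ) where
  open CommutativeRing R
  open Hurwitz R
  open SetoidReasoning HR.setoid
  open SemiringSolver HR.commutativeSemiring

  -- Logarithmic derivatives without division: if that of E is C times that of G, then that of E J
  -- is C G′/G + J′/J; everything is multiplied by G J. It serves both E = Gˢ with C = s, by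
  -- `power-ode`, and E = exp(c log G) with C = c.
  product-ode : ∀ G E J C → G ⋆ D E ≋ C ⋆ (D G ⋆ E) →
                (G ⋆ J) ⋆ D (E ⋆ J) ≋ (C ⋆ (D G ⋆ J) ⊕ G ⋆ D J) ⋆ (E ⋆ J)
  product-ode G E J C h = begin
    (G ⋆ J) ⋆ (D E ⋆ J ⊕ E ⋆ D J)
      ≈⟨ solve 5 (λ g j e′ e j′ → (g :* j) :* (e′ :* j :+ e :* j′) := (g :* e′) :* (j :* j) :+ (g :* j′) :* (e :* j))
           HR.refl G J (D E) E (D J) ⟩
    (G ⋆ D E) ⋆ (J ⋆ J) ⊕ (G ⋆ D J) ⋆ (E ⋆ J)
      ≈⟨ HR.+-congʳ {(G ⋆ D J) ⋆ (E ⋆ J)} (HR.*-congʳ {J ⋆ J} h) ⟩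
    C ⋆ (D G ⋆ E) ⋆ (J ⋆ J) ⊕ (G ⋆ D J) ⋆ (E ⋆ J)
      ≈⟨ solve 6 (λ g j e g′ c j′ → c :* (g′ :* e) :* (j :* j) :+ (g :* j′) :* (e :* j)
                                  := (c :* (g′ :* j) :+ g :* j′) :* (e :* j)) HR.refl G J E (D G) C (D J) ⟩
    (C ⋆ (D G ⋆ J) ⊕ G ⋆ D J) ⋆ (E ⋆ J) ∎

  power-ode : ∀ G s → G ⋆ D (G ^⋆ s) ≋ const (RingExtras.nat R s) ⋆ (D G ⋆ G ^⋆ s)
  power-ode G zero    = HR.trans (HR.zeroʳ G) (HR.sym (HR.trans (HR.*-congʳ {D G ⋆ const 1#} (RingHom.0-hom (constHom R))) (HR.zeroˡ (D G ⋆ const 1#))))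
  power-ode G (suc s) = HR.trans (HR.*-congˡ {G} (D-^ G s))
    (solve 4 (λ g c g′ e → g :* (c :* (g′ :* e)) := c :* (g′ :* (g :* e))) HR.refl G _ (D G) (G ^⋆ s))

module PowerFormula (K : ℚAlgebra) where
  open ℚAlgebra K
  open Polynomials K
  private
    Kr = commRing
    Ra = hurwitzAlgebra K
    Rr = ℚAlgebra.commRing Ra
    module HK = Hurwitz Kr
    module HS = Hurwitz Rr
  open ExpLog Ra

  lift : HK.H → HS.H
  lift a n = HK.const (a n)

  HasValuesH : HS.H → (ℕ → HK.H) → Set
  HasValuesH a Φ = ∀ n → HasValues (a n) (λ k → Φ k n)

  valuesH-lift : ∀ a → HasValuesH (lift a) (λ _ → a)
  valuesH-lift a n = values-const (a n)

  valuesH-const : ∀ {c φ} → HasValues c φ → HasValuesH (HS.const c) (λ k → HK.const (φ k))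
  valuesH-const v zero    = v
  valuesH-const v (suc n) = values-0

  valuesH-⊕ : ∀ {a b Φ Ψ} → HasValuesH a Φ → HasValuesH b Ψ → HasValuesH (a HS.⊕ b) (λ k → Φ k HK.⊕ Ψ k)
  valuesH-⊕ va vb n = values-+ (va n) (vb n)

  valuesH-⋆ : ∀ {a b Φ Ψ} → HasValuesH a Φ → HasValuesH b Ψ → HasValuesH (a HS.⋆ b) (λ k → Φ k HK.⋆ Ψ k)
  valuesH-⋆ va vb zero    = values-* (va 0) (vb 0)
  valuesH-⋆ va vb (suc n) = values-+ (valuesH-⋆ (va ∘ suc) vb n) (valuesH-⋆ va (vb ∘ suc) n)

  valuesH-determine : ∀ {a b Φ Ψ} → (∀ k → Φ k HK.≋ Ψ k) → HasValuesH a Φ → HasValuesH b Ψ → a HS.≋ b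
  valuesH-determine h va vb n = values-determine (values-cong HK.HR.refl (λ k → h k n) (va n)) (vb n)

  -- Only L is evaluated at the points; the exponential satisfies the equation identically in X. The
  -- equation for L can be tested at the points because each of its coefficients is formed by sums
  -- and products from c and the coefficients of L, G and J, all of them polynomial in X.
  power-formula : ∀ (L : HS.H) (G J : HK.H) (c : HK.H) (s : ℕ → ℕ) → G 0 ≈ 1# → J 0 ≈ 1# →
    HasValues c (λ k → nat (s k)) → HasValuesH L (λ k → G HK.^⋆ s k HK.⋆ J) →
    L HS.≋ expH (HS.const c HS.⋆ logH (lift G)) HS.⋆ lift J
  power-formula L G J c s G₀ J₀ vc vL = HS.linear-ode-unique A B L (E HS.⋆ lift J) A₀ L₀ L-ode
    (LinearOde.product-ode Rr Ĝ E Ĵ C E-ode)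
    where
    Ĝ Ĵ ℓ C E A B : HS.H
    Ĝ = lift G
    Ĵ = lift J
    ℓ = logH Ĝ
    C = HS.const c
    E = expH (C HS.⋆ ℓ)
    A = Ĝ HS.⋆ Ĵ
    B = C HS.⋆ (HS.D Ĝ HS.⋆ Ĵ) HS.⊕ Ĝ HS.⋆ HS.D Ĵ
    1R = HK.const 1#
    Ĝ₀ : Ĝ 0 HK.≋ 1R
    Ĝ₀ = HK.const-cong G₀
    Ĵ₀ : Ĵ 0 HK.≋ 1R
    Ĵ₀ = HK.const-cong J₀
    A₀ : A 0 HK.≋ 1R
    A₀ = HK.HR.trans (HK.HR.*-cong Ĝ₀ Ĵ₀) (HK.HR.*-identityˡ 1R)
    ^-zero : ∀ s → (G HK.^⋆ s) 0 ≈ 1#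
    ^-zero zero    = refl
    ^-zero (suc s) = trans (*-cong G₀ (^-zero s)) (*-identityˡ 1#)
    L₀ : L 0 HK.≋ (E HS.⋆ Ĵ) 0
    L₀ = HK.HR.trans
      (values-determine (values-cong HK.HR.refl (λ k → trans (*-cong (^-zero (s k)) J₀) (*-identityˡ 1#)) (vL 0)) (values-const 1#))
      (HK.HR.sym (HK.HR.trans (HK.HR.*-cong (expH-zero (C HS.⋆ ℓ)) Ĵ₀) (HK.HR.*-identityˡ 1R)))
    L-ode : A HS.⋆ HS.D L HS.≋ B HS.⋆ L
    L-ode = valuesH-determine
      -- At the k-th point c takes the value s k, and L becomes Gˢ J with s = s k, which solves the
      -- equation with this number in place of c.
      (λ k → LinearOde.product-ode Kr G (G HK.^⋆ s k) J (HK.const (nat (s k))) (LinearOde.power-ode Kr G (s k)))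
      (valuesH-⋆ (valuesH-⋆ (valuesH-lift G) (valuesH-lift J)) (λ n → vL (suc n)))
      (valuesH-⋆ (valuesH-⊕ (valuesH-⋆ (valuesH-const vc) (valuesH-⋆ (valuesH-lift (HK.D G)) (valuesH-lift J)))
                            (valuesH-⋆ (valuesH-lift G) (valuesH-lift (HK.D J)))) vL)
    g : HS.H
    g = C HS.⋆ ℓ
    g₀ : g 0 HK.≋ HK.𝟘
    g₀ = HK.HR.trans (HK.HR.*-congˡ {c} (logH-zero Ĝ)) (HK.HR.zeroʳ c)
    Dg : HS.D g HS.≋ C HS.⋆ HS.D ℓ
    Dg = HS.HR.trans (HS.HR.+-congʳ {C HS.⋆ HS.D ℓ} (HS.⋆-zeroˡ ℓ)) (HS.HR.+-identityˡ (C HS.⋆ HS.D ℓ))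
    E-ode : Ĝ HS.⋆ HS.D E HS.≋ C HS.⋆ (HS.D Ĝ HS.⋆ E)
    E-ode = HS.HR.trans (HS.HR.*-congˡ {Ĝ} (HS.HR.trans (D-expH g g₀) (HS.HR.*-congʳ {E} Dg)))
      (HS.HR.trans (solve 4 (λ g c l e → g :* ((c :* l) :* e) := c :* ((g :* l) :* e)) HS.HR.refl Ĝ C (HS.D ℓ) E)
        (HS.HR.*-congˡ {C} (HS.HR.*-congʳ {E} (D-logH Ĝ Ĝ₀))))
      where open SemiringSolver HS.HR.commutativeSemiring

-- Linear combinations of integer vectors

-- Deletion of one occurrence at a remembered position. Lists of vectors may have repetitions, and
-- the subsets of a list are its sublists, so neither multiplicity nor order may be lost.
data Insertion {A : Set} (x : A) : List A → List A → Set where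
  here  : ∀ {xs} → Insertion x xs (x ∷ xs)
  there : ∀ {y xs ys} → Insertion x xs ys → Insertion x (y ∷ xs) (y ∷ ys)

module _ {A : Set} where
  ∈⇒insertion : ∀ {x : A} {ys} → x ∈ ys → ∃ λ xs → Insertion x xs ys
  ∈⇒insertion (here ≡.refl) = _ , here
  ∈⇒insertion (there x∈ys)  = let xs , i = ∈⇒insertion x∈ys in _ , there i

  insertion-length : ∀ {x : A} {xs ys} → Insertion x xs ys → length ys ≡ suc (length xs)
  insertion-length here      = ≡.refl
  insertion-length (there i) = ≡.cong suc (insertion-length i)

  insertion-∈ : ∀ {x y : A} {xs ys} → Insertion x xs ys → y ∈ xs → y ∈ ys
  insertion-∈ here      p           = there p
  insertion-∈ (there i) (here eq)   = here eq
  insertion-∈ (there i) (there p)   = there (insertion-∈ i p)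

  insertion-All : ∀ {P : A → Set} {x xs ys} → Insertion x xs ys → P x → All P xs → All P ys
  insertion-All here      p ps       = p ∷ ps
  insertion-All (there i) p (q ∷ qs) = q ∷ insertion-All i p qs

  insertion-All⁻ : ∀ {P : A → Set} {x xs ys} → Insertion x xs ys → All P ys → P x × All P xs
  insertion-All⁻ here      (p ∷ ps) = p , ps
  insertion-All⁻ (there i) (q ∷ qs) = let p , ps = insertion-All⁻ i qs in p , q ∷ ps

  insertion-map : ∀ {B : Set} (f : A → B) {x xs ys} → Insertion x xs ys → Insertion (f x) (map f xs) (map f ys)
  insertion-map f here      = here
  insertion-map f (there i) = there (insertion-map f i)

  -- Follow the given occurrence of x: the sublist either took it or skipped it, and in the second
  -- case x can be put in at that place. This adds the pivot to a basis lifted from the reduced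
  -- list.
  sublist-insertion : ∀ {x : A} {S B} → S ⊆ B → x ∈ B → x ∈ S ⊎ ∃ λ S⁺ → Insertion x S S⁺ × S⁺ ⊆ B
  sublist-insertion (y ∷ʳ s)      (here ≡.refl) = inj₂ (_ , here , ≡.refl ∷ s)
  sublist-insertion (≡.refl ∷ s)  (here ≡.refl) = inj₁ (here ≡.refl)
  sublist-insertion (y ∷ʳ s)      (there p) with sublist-insertion s p
  ... | inj₁ x∈S              = inj₁ x∈S
  ... | inj₂ (S⁺ , i , S⁺⊆B)  = inj₂ (S⁺ , i , y ∷ʳ S⁺⊆B)
  sublist-insertion (≡.refl ∷ s)  (there p) with sublist-insertion s p
  ... | inj₁ x∈S              = inj₁ (there x∈S)
  ... | inj₂ (S⁺ , i , S⁺⊆B)  = inj₂ (_ , there i , ≡.refl ∷ S⁺⊆B)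

  ∈-sublists⇒⊆ : ∀ {S} (B : List A) → S ∈ sublists B → S ⊆ B
  ∈-sublists⇒⊆ []      (here ≡.refl) = []
  ∈-sublists⇒⊆ (b ∷ B) S∈ with ∈-++⁻ (sublists B) S∈
  ... | inj₁ p = b ∷ʳ ∈-sublists⇒⊆ B p
  ... | inj₂ p with S′ , p′ , ≡.refl ← ∈-map⁻ (b ∷_) p = ≡.refl ∷ ∈-sublists⇒⊆ B p′

  ⊆⇒∈-sublists : ∀ {S B : List A} → S ⊆ B → S ∈ sublists B
  ⊆⇒∈-sublists []                          = here ≡.refl
  ⊆⇒∈-sublists (b ∷ʳ s)                    = ∈-++⁺ˡ (⊆⇒∈-sublists s)
  ⊆⇒∈-sublists {B = b ∷ B} (≡.refl ∷ s)    = ∈-++⁺ʳ (sublists B) (∈-map⁺ (b ∷_) (⊆⇒∈-sublists s))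

  ⊆-map⁻ : ∀ {B : Set} (f : A → B) {S} xs → S ⊆ map f xs → ∃ λ T → T ⊆ xs × S ≡ map f T
  ⊆-map⁻ f []       []           = [] , [] , ≡.refl
  ⊆-map⁻ f (x ∷ xs) (y ∷ʳ s)     = let T , p , q = ⊆-map⁻ f xs s in T , x ∷ʳ p , q
  ⊆-map⁻ f (x ∷ xs) (≡.refl ∷ s) = let T , p , q = ⊆-map⁻ f xs s in x ∷ T , ≡.refl ∷ p , ≡.cong (f x ∷_) q

-- The projection of ℤ × ℤⁿ onto ℤⁿ along the vector (a , v), when a² v = v.
reduce : ∀ {n} → Vecℤ (suc n) → Vecℤ (suc n) → Vecℤ n
reduce (a ∷ v) (x ∷ w) = Vec.zipWith (λ wᵢ vᵢ → wᵢ ℤ.- (a ℤ.* x) ℤ.* vᵢ) w v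

coord : ∀ {n} → Fin n → Vecℤ n → ℤ
coord i b = lookup b i

coord-reduce : ∀ {n} (a : ℤ) (v : Vecℤ n) i b →
  coord i (reduce (a ∷ v) b) ≡ coord (Fin.suc i) b ℤ.- (a ℤ.* coord Fin.zero b) ℤ.* coord i v
coord-reduce a v i (x ∷ w) = Vec.lookup-zipWith _ i w v

coord-tail : ∀ {n} i (b : Vecℤ (suc n)) → coord i (Vec.tail b) ≡ coord (Fin.suc i) b
coord-tail i (x ∷ b) = ≡.refl

module Combinations (R : CommutativeRing 0ℓ 0ℓ) (hom : RingHom ℤ.+-*-commutativeRing R) where
  open CommutativeRing R
  open RingHom hom
  open SetoidReasoning setoid
  open RingProperties ring
  open CommutativeSemigroupProperties +-commutativeSemigroup using (interchange)

  -- Weights travel with their vectors, in place of coefficient functions on `Fin (length B)`: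
  -- applying a map, adding a vector or deleting one then needs no change of indices.
  Weighted : ℕ → Set
  Weighted n = List (Carrier × Vecℤ n)

  vectors : ∀ {n} → Weighted n → List (Vecℤ n)
  vectors = map proj₂

  comb : ∀ {n} → Weighted n → (Vecℤ n → ℤ) → Carrier
  comb []             g = 0#
  comb ((c , b) ∷ ws) g = c * ⟦ g b ⟧ + comb ws g

  neg-hom : ∀ x → ⟦ ℤ.- x ⟧ ≈ - ⟦ x ⟧
  neg-hom x = +-cancelˡ ⟦ x ⟧ _ _ (trans (sym (+-hom x (ℤ.- x)))
    (trans (⟦⟧-cong (ℤ.+-inverseʳ x)) (trans 0-hom (sym (-‿inverseʳ _)))))

  comb-cong : ∀ {n} (ws : Weighted n) {g h} → (∀ b → g b ≡ h b) → comb ws g ≈ comb ws h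
  comb-cong []             p = refl
  comb-cong ((c , b) ∷ ws) p = +-cong (*-congˡ (⟦⟧-cong (p b))) (comb-cong ws p)

  comb-zero : ∀ {n} (ws : Weighted n) {g} → All (λ w → g (proj₂ w) ≡ ℤ.0ℤ) ws → comb ws g ≈ 0#
  comb-zero []             []       = refl
  comb-zero ((c , b) ∷ ws) (p ∷ ps) = trans (+-cong (trans (*-congˡ (trans (⟦⟧-cong p) 0-hom)) (zeroʳ c)) (comb-zero ws ps)) (+-identityˡ 0#)

  comb-insertion : ∀ {n y} {b : Vecℤ n} {ws ws⁺} → Insertion (y , b) ws ws⁺ → ∀ g → comb ws⁺ g ≈ y * ⟦ g b ⟧ + comb ws g
  comb-insertion here g = refl
  comb-insertion {y = y} {b} (there {y = (c , d)} {ws} i) g = trans (+-congˡ (comb-insertion i g)) (x∙yz≈y∙xz _ _ _)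
    where open CommutativeSemigroupProperties +-commutativeSemigroup using (x∙yz≈y∙xz)

  onVectors : ∀ {m n} → (Vecℤ m → Vecℤ n) → Weighted m → Weighted n
  onVectors φ = map λ (c , b) → c , φ b

  comb-onVectors : ∀ {m n} (φ : Vecℤ m → Vecℤ n) ws g → comb (onVectors φ ws) g ≡ comb ws (g ∘ φ)
  comb-onVectors φ []             g = ≡.refl
  comb-onVectors φ ((c , b) ∷ ws) g = ≡.cong (_ +_) (comb-onVectors φ ws g)

  comb-reduce : ∀ {n} (a : ℤ) (v : Vecℤ n) ws i → comb ws (coord i ∘ reduce (a ∷ v)) ≈
                comb ws (coord (Fin.suc i)) + - (⟦ a ⟧ * comb ws (coord Fin.zero) * ⟦ coord i v ⟧)
  comb-reduce a v [] i = sym (begin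
    0# + - (⟦ a ⟧ * 0# * _) ≈⟨ +-identityˡ _ ⟩
    - (⟦ a ⟧ * 0# * _) ≈⟨ -‿cong (trans (*-congʳ (zeroʳ _)) (zeroˡ _)) ⟩
    - 0# ≈⟨ -0#≈0# ⟩
    0# ∎)
  comb-reduce a v ((c , b) ∷ ws) i = begin
    c * ⟦ coord i (reduce (a ∷ v) b) ⟧ + comb ws (coord i ∘ reduce (a ∷ v))
      ≈⟨ +-cong (*-congˡ (trans (⟦⟧-cong (coord-reduce a v i b)) hom-diff)) (comb-reduce a v ws i) ⟩
    c * (⟦ p ⟧ + - (A * ⟦ x ⟧ * V)) + (S + - (A * T * V))
      ≈⟨ +-congʳ (trans (distribˡ _ _ _) (+-congˡ (sym (-‿distribʳ-* _ _)))) ⟩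
    (c * ⟦ p ⟧ + - (c * (A * ⟦ x ⟧ * V))) + (S + - (A * T * V))
      ≈⟨ interchange _ _ _ _ ⟩
    (c * ⟦ p ⟧ + S) + (- (c * (A * ⟦ x ⟧ * V)) + - (A * T * V))
      ≈⟨ +-congˡ (-‿+-comm _ _) ⟩
    (c * ⟦ p ⟧ + S) + - (c * (A * ⟦ x ⟧ * V) + A * T * V)
      ≈⟨ +-congˡ (-‿cong (solve 5 (λ c a x v t → c :* (a :* x :* v) :+ a :* t :* v := a :* (c :* x :+ t) :* v) refl _ _ _ _ _)) ⟩
    (c * ⟦ p ⟧ + S) + - (A * (c * ⟦ x ⟧ + T) * V) ∎
    where
    open SemiringSolver commutativeSemiring using (solve; _:=_; _:+_; _:*_; con)
    p x : ℤ
    p = coord (Fin.suc i) b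
    x = coord Fin.zero b
    A V S T : Carrier
    A = ⟦ a ⟧
    V = ⟦ coord i v ⟧
    S = comb ws (coord (Fin.suc i))
    T = comb ws (coord Fin.zero)
    hom-diff : ⟦ p ℤ.- (a ℤ.* x) ℤ.* coord i v ⟧ ≈ ⟦ p ⟧ + - (A * ⟦ x ⟧ * V)
    hom-diff = trans (+-hom _ _) (+-congˡ (trans (neg-hom _) (-‿cong (trans (*-hom _ _) (*-congʳ (*-hom _ _))))))

  -- The combination may repeat or omit members of B. The target is a tuple of ring elements and not
  -- an integer vector, so the same notion serves rational spans and differences of coset
  -- representatives.
  Spans : ∀ {n} → List (Vecℤ n) → (Fin n → Carrier) → Set
  Spans B u = Σ (Weighted _) λ ws → All (λ w → proj₂ w ∈ B) ws × (∀ i → comb ws (coord i) ≈ u i)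

  Independent : ∀ {n} → List (Vecℤ n) → Set
  Independent B = ∀ ws → vectors ws ≡ B → (∀ i → comb ws (coord i) ≈ 0#) → All (λ w → proj₁ w ≈ 0#) ws

  weights : ∀ {n} (B : List (Vecℤ n)) → (Fin (length B) → Carrier) → Weighted n
  weights []      c = []
  weights (b ∷ B) c = (c Fin.zero , b) ∷ weights B (c ∘ Fin.suc)

  weights-∈ : ∀ {n} (B : List (Vecℤ n)) c → All (λ w → proj₂ w ∈ B) (weights B c)
  weights-∈ []      c = []
  weights-∈ (b ∷ B) c = here ≡.refl ∷ All.map there (weights-∈ B (c ∘ Fin.suc))

  weights-vectors : ∀ {n} (B : List (Vecℤ n)) c → vectors (weights B c) ≡ B
  weights-vectors []      c = ≡.refl
  weights-vectors (b ∷ B) c = ≡.cong (b ∷_) (weights-vectors B (c ∘ Fin.suc))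

  weights-zero : ∀ {n} (B : List (Vecℤ n)) c → All (λ w → proj₁ w ≈ 0#) (weights B c) → ∀ i → c i ≈ 0#
  weights-zero (b ∷ B) c (p ∷ ps) Fin.zero    = p
  weights-zero (b ∷ B) c (p ∷ ps) (Fin.suc i) = weights-zero B (c ∘ Fin.suc) ps i

  weights-all : ∀ {n} (ws : Weighted n) → ∃ λ c → weights (vectors ws) c ≡ ws ×
                ((∀ i → c i ≈ 0#) → All (λ w → proj₁ w ≈ 0#) ws)
  weights-all []             = (λ ()) , ≡.refl , λ _ → []
  weights-all ((c , b) ∷ ws) = let cs , p , q = weights-all ws in
    (λ { Fin.zero → c ; (Fin.suc i) → cs i }) , ≡.cong ((c , b) ∷_) p , λ h → h Fin.zero ∷ q (h ∘ Fin.suc)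

  private
    weights-0 : ∀ {n} (B : List (Vecℤ n)) g → comb (weights B (λ _ → 0#)) g ≈ 0#
    weights-0 []      g = refl
    weights-0 (b ∷ B) g = trans (+-cong (zeroˡ _) (weights-0 B g)) (+-identityˡ 0#)

    weights-+ : ∀ {n} (B : List (Vecℤ n)) c d g →
                comb (weights B (λ i → c i + d i)) g ≈ comb (weights B c) g + comb (weights B d) g
    weights-+ []      c d g = sym (+-identityˡ 0#)
    weights-+ (b ∷ B) c d g = trans (+-cong (distribʳ _ _ _) (weights-+ B (c ∘ Fin.suc) (d ∘ Fin.suc) g)) (interchange _ _ _ _)

    weights-single : ∀ {n b} {B : List (Vecℤ n)} → b ∈ B → ∀ y → ∃ λ c → ∀ g → comb (weights B c) g ≈ y * ⟦ g b ⟧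
    weights-single {B = b ∷ B} (here ≡.refl) y = (λ { Fin.zero → y ; (Fin.suc i) → 0# }) ,
      λ g → trans (+-congˡ (weights-0 B g)) (+-identityʳ _)
    weights-single {B = b ∷ B} (there p) y = let c , h = weights-single p y in
      (λ { Fin.zero → 0# ; (Fin.suc i) → c i }) , λ g → trans (+-cong (zeroˡ _) (h g)) (+-identityˡ _)

  -- Adds up the weights of repeated vectors, which leads back to one coefficient for each entry of
  -- B.
  collect : ∀ {n} (B : List (Vecℤ n)) ws → All (λ w → proj₂ w ∈ B) ws → ∃ λ c → ∀ g → comb (weights B c) g ≈ comb ws g
  collect B []             []       = (λ _ → 0#) , weights-0 B
  collect B ((y , b) ∷ ws) (p ∷ ps) =
    let c , h  = weights-single p y
        d , h′ = collect B ws ps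
    in (λ i → c i + d i) , λ g → trans (weights-+ B c d g) (+-cong (h g) (h′ g))

  onVectors-vectors : ∀ {m n} (φ : Vecℤ m → Vecℤ n) (ws : Weighted m) → vectors (onVectors φ ws) ≡ map φ (vectors ws)
  onVectors-vectors φ []       = ≡.refl
  onVectors-vectors φ (w ∷ ws) = ≡.cong (_ ∷_) (onVectors-vectors φ ws)

  onVectors⁻ : ∀ {m n} (φ : Vecℤ m → Vecℤ n) B ws → vectors ws ≡ map φ B →
               ∃ λ ws′ → vectors ws′ ≡ B × onVectors φ ws′ ≡ ws
  onVectors⁻ φ []      []             eq = [] , ≡.refl , ≡.refl
  onVectors⁻ φ (b ∷ B) ((c , d) ∷ ws) eq
    with ≡.refl , eq′ ← List.∷-injective eq = let ws′ , p , q = onVectors⁻ φ B ws eq′ in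
      (c , b) ∷ ws′ , ≡.cong (b ∷_) p , ≡.cong ((c , φ b) ∷_) q

  onVectors-∈ : ∀ {m n} (φ : Vecℤ m → Vecℤ n) {B} ws → All (λ w → proj₂ w ∈ B) ws →
                All (λ w → proj₂ w ∈ map φ B) (onVectors φ ws)
  onVectors-∈ φ []       []       = []
  onVectors-∈ φ (w ∷ ws) (p ∷ ps) = ∈-map⁺ φ p ∷ onVectors-∈ φ ws ps

  onVectors-∈⁻ : ∀ {m n} (φ : Vecℤ m → Vecℤ n) {B} ws → All (λ w → proj₂ w ∈ map φ B) ws →
                 ∃ λ ws′ → All (λ w → proj₂ w ∈ B) ws′ × onVectors φ ws′ ≡ ws
  onVectors-∈⁻ φ []             []       = [] , [] , ≡.refl
  onVectors-∈⁻ φ ((c , d) ∷ ws) (p ∷ ps)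
    with b , b∈B , ≡.refl ← ∈-map⁻ φ p = let ws′ , q , r = onVectors-∈⁻ φ ws ps in
      (c , b) ∷ ws′ , b∈B ∷ q , ≡.cong ((c , φ b) ∷_) r

  onVectors-zero : ∀ {m n} (φ : Vecℤ m → Vecℤ n) (ws : Weighted m) →
                   All (λ w → proj₁ w ≈ 0#) ws → All (λ w → proj₁ w ≈ 0#) (onVectors φ ws)
  onVectors-zero φ []       []       = []
  onVectors-zero φ (w ∷ ws) (p ∷ ps) = p ∷ onVectors-zero φ ws ps

  onVectors-zero⁻ : ∀ {m n} (φ : Vecℤ m → Vecℤ n) (ws : Weighted m) →
                    All (λ w → proj₁ w ≈ 0#) (onVectors φ ws) → All (λ w → proj₁ w ≈ 0#) ws
  onVectors-zero⁻ φ []       []       = []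
  onVectors-zero⁻ φ (w ∷ ws) (p ∷ ps) = p ∷ onVectors-zero⁻ φ ws ps

  split-insertion : ∀ {n b} {S⁻ S : List (Vecℤ n)} → Insertion b S⁻ S → ∀ ws → vectors ws ≡ S →
                    ∃ λ y → ∃ λ ws⁻ → vectors ws⁻ ≡ S⁻ × Insertion (y , b) ws⁻ ws
  split-insertion here      ((c , d) ∷ ws) eq with ≡.refl , eq′ ← List.∷-injective eq = c , ws , eq′ , here
  split-insertion (there i) ((c , d) ∷ ws) eq with ≡.refl , eq′ ← List.∷-injective eq =
    let y , ws⁻ , p , j = split-insertion i ws eq′ in y , (c , d) ∷ ws⁻ , ≡.cong (d ∷_) p , there j

  join-insertion : ∀ {n b} {S⁻ S : List (Vecℤ n)} → Insertion b S⁻ S → ∀ y ws⁻ → vectors ws⁻ ≡ S⁻ →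
                   ∃ λ ws → vectors ws ≡ S × Insertion (y , b) ws⁻ ws
  join-insertion here      y ws⁻ eq = (y , _) ∷ ws⁻ , ≡.cong (_ ∷_) eq , here
  join-insertion (there i) y ((c , d) ∷ ws⁻) eq with ≡.refl , eq′ ← List.∷-injective eq =
    let ws , p , j = join-insertion i y ws⁻ eq′ in (c , d) ∷ ws , ≡.cong (d ∷_) p , there j

  spans-reduce : ∀ {n} (a : ℤ) (v : Vecℤ n) {B u} → Spans B u →
                 Spans (map (reduce (a ∷ v)) B) (λ i → u (Fin.suc i) + - (⟦ a ⟧ * u Fin.zero * ⟦ coord i v ⟧))
  spans-reduce a v {B} (ws , p , q) = onVectors _ ws , onVectors-∈ _ ws p , λ i → begin
    comb (onVectors (reduce (a ∷ v)) ws) (coord i) ≡⟨ comb-onVectors _ ws (coord i) ⟩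
    comb ws (coord i ∘ reduce (a ∷ v)) ≈⟨ comb-reduce a v ws i ⟩
    _ ≈⟨ +-cong (q (Fin.suc i)) (-‿cong (*-congʳ (*-congˡ (q Fin.zero)))) ⟩
    _ ∎

  -- along a pivot (a , v) with a² v = v, the correction y (a , v) only changes the first coordinate of the reduction
  pivot-correction : ∀ {n} (a : ℤ) (v : Vecℤ n) → (∀ i → a ℤ.* a ℤ.* coord i v ≡ coord i v) →
    ∀ i y t u s → t + y * ⟦ a ⟧ ≈ u → y * ⟦ coord i v ⟧ + s ≈ (s + - (⟦ a ⟧ * t * ⟦ coord i v ⟧)) + ⟦ a ⟧ * u * ⟦ coord i v ⟧
  pivot-correction a v a²v i y t u s h = sym (begin
    (s + - (A * t * V)) + A * u * V ≈⟨ +-congˡ (*-congʳ (*-congˡ h)) ⟨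
    (s + - (A * t * V)) + A * (t + y * A) * V
      ≈⟨ +-congˡ (solve 4 (λ a t y v → a :* (t :+ y :* a) :* v := a :* t :* v :+ y :* (a :* a :* v)) refl _ _ _ _) ⟩
    (s + - (A * t * V)) + (A * t * V + y * (A * A * V)) ≈⟨ +-congˡ (+-congˡ (*-congˡ a²V)) ⟩
    (s + - (A * t * V)) + (A * t * V + y * V) ≈⟨ +-assoc _ _ _ ⟨
    ((s + - (A * t * V)) + A * t * V) + y * V ≈⟨ +-congʳ (+-assoc _ _ _) ⟩
    (s + (- (A * t * V) + A * t * V)) + y * V ≈⟨ +-congʳ (+-congˡ (-‿inverseˡ _)) ⟩
    (s + 0#) + y * V ≈⟨ +-congʳ (+-identityʳ s) ⟩
    s + y * V ≈⟨ +-comm _ _ ⟩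
    y * V + s ∎)
    where
    open SemiringSolver commutativeSemiring using (solve; _:=_; _:+_; _:*_; con)
    A V : Carrier
    A = ⟦ a ⟧
    V = ⟦ coord i v ⟧
    a²V : A * A * V ≈ V
    a²V = trans (*-congʳ (sym (*-hom a a))) (trans (sym (*-hom _ _)) (⟦⟧-cong (a²v i)))

  -- Lifting a combination of reduced vectors to B gives the target up to a multiple of the pivot.
  -- `correct` finds this multiple y from the first coordinate, by division over ℚ and by
  -- divisibility over ℤ; `pivot-correction` then settles the other coordinates.
  spans-reduce⁻ : ∀ {n} (a : ℤ) (v : Vecℤ n) → (∀ i → a ℤ.* a ℤ.* coord i v ≡ coord i v) →
    ∀ {B u} → (a ∷ v) ∈ B →
    (∀ ws → All (λ w → proj₂ w ∈ B) ws → ∃ λ y → comb ws (coord Fin.zero) + y * ⟦ a ⟧ ≈ u Fin.zero) →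
    Spans (map (reduce (a ∷ v)) B) (λ i → u (Fin.suc i) + - (⟦ a ⟧ * u Fin.zero * ⟦ coord i v ⟧)) → Spans B u
  spans-reduce⁻ a v a²v {B} {u} b∈B correct (ws′ , p′ , q) with onVectors-∈⁻ (reduce (a ∷ v)) ws′ p′
  ... | ws , p , ≡.refl with correct ws p
  ... | y , h = (y , a ∷ v) ∷ ws , b∈B ∷ p , eq
    where
    eq : ∀ i → comb ((y , a ∷ v) ∷ ws) (coord i) ≈ u i
    eq Fin.zero    = trans (+-comm _ _) h
    eq (Fin.suc i) = begin
      y * ⟦ coord i v ⟧ + comb ws (coord (Fin.suc i))
        ≈⟨ pivot-correction a v a²v i y _ _ _ h ⟩
      (comb ws (coord (Fin.suc i)) + - (⟦ a ⟧ * comb ws (coord Fin.zero) * ⟦ coord i v ⟧)) + ⟦ a ⟧ * u Fin.zero * ⟦ coord i v ⟧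
        ≈⟨ +-congʳ (trans (sym (comb-reduce a v ws i)) (trans (reflexive (≡.sym (comb-onVectors _ ws (coord i)))) (q i))) ⟩
      (u (Fin.suc i) + - (⟦ a ⟧ * u Fin.zero * ⟦ coord i v ⟧)) + ⟦ a ⟧ * u Fin.zero * ⟦ coord i v ⟧
        ≈⟨ trans (+-assoc _ _ _) (trans (+-congˡ (-‿inverseˡ _)) (+-identityʳ _)) ⟩
      u (Fin.suc i) ∎

  spans-cong : ∀ {n} {B : List (Vecℤ n)} {u u′} → (∀ i → u i ≈ u′ i) → Spans B u → Spans B u′
  spans-cong h (ws , p , q) = ws , p , λ i → trans (q i) (h i)

  spans-tail : ∀ {n} {B : List (Vecℤ (suc n))} {u} → Spans B u → Spans (map Vec.tail B) (u ∘ Fin.suc)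
  spans-tail (ws , p , q) = onVectors Vec.tail ws , onVectors-∈ Vec.tail ws p ,
    λ i → trans (reflexive (comb-onVectors Vec.tail ws (coord i))) (trans (comb-cong ws (coord-tail i)) (q (Fin.suc i)))

  spans-zero-column : ∀ {n} {B : List (Vecℤ (suc n))} {u} → (∀ b → b ∈ B → Vec.head b ≡ ℤ.0ℤ) → Spans B u → u Fin.zero ≈ 0#
  spans-zero-column h (ws , p , q) = trans (sym (q Fin.zero)) (comb-zero ws (All.map (λ { {_ , _ ∷ _} b∈B → h _ b∈B }) p))

  spans-tail⁻ : ∀ {n} {B : List (Vecℤ (suc n))} {u} → (∀ b → b ∈ B → Vec.head b ≡ ℤ.0ℤ) → u Fin.zero ≈ 0# →
                Spans (map Vec.tail B) (u ∘ Fin.suc) → Spans B u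
  spans-tail⁻ h u₀ (ws′ , p′ , q) with onVectors-∈⁻ Vec.tail ws′ p′
  ... | ws , p , ≡.refl = ws , p , λ
    { Fin.zero    → trans (comb-zero ws (All.map (λ { {_ , _ ∷ _} b∈B → h _ b∈B }) p)) (sym u₀)
    ; (Fin.suc i) → trans (sym (comb-cong ws (coord-tail i))) (trans (sym (reflexive (comb-onVectors Vec.tail ws (coord i)))) (q i)) }

-- Counting solutions modulo q

module Cube (R : CommutativeSemiring 0ℓ 0ℓ) where
  open CommutativeSemiring R
  open CommutativeSemigroupProperties +-commutativeSemigroup using (interchange)
  open SetoidReasoning setoid

  range : ℕ → (ℕ → Carrier) → Carrier
  range zero    f = 0#
  range (suc q) f = f 0 + range q (f ∘ suc)

  -- Residues modulo q are represented by 0, ..., q - 1, without a quotient. The values lie in an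
  -- arbitrary semiring because points are counted in ℕ and summed with weights in a ring of series.
  cube : ℕ → ∀ n → (Vecℤ n → Carrier) → Carrier
  cube q zero    f = f []
  cube q (suc n) f = range q λ c → cube q n λ p → f (ℤ.+ c ∷ p)

  ∏ : ∀ {A : Set} → List A → (A → Carrier) → Carrier
  ∏ []       f = 1#
  ∏ (x ∷ xs) f = f x * ∏ xs f

  range-cong : ∀ q {f g} → (∀ k → k ℕ.< q → f k ≈ g k) → range q f ≈ range q g
  range-cong zero    h = refl
  range-cong (suc q) h = +-cong (h 0 (s≤s z≤n)) (range-cong q λ k k<q → h (suc k) (s≤s k<q))

  range-zero : ∀ q {f} → (∀ k → k ℕ.< q → f k ≈ 0#) → range q f ≈ 0#
  range-zero zero    h = refl
  range-zero (suc q) h = trans (+-cong (h 0 (s≤s z≤n)) (range-zero q λ k k<q → h (suc k) (s≤s k<q))) (+-identityˡ 0#)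

  range-+ : ∀ q f g → range q (λ k → f k + g k) ≈ range q f + range q g
  range-+ zero    f g = sym (+-identityˡ 0#)
  range-+ (suc q) f g = trans (+-congˡ (range-+ q (f ∘ suc) (g ∘ suc))) (interchange _ _ _ _)

  range-*ˡ : ∀ q c f → range q (λ k → c * f k) ≈ c * range q f
  range-*ˡ zero    c f = sym (zeroʳ c)
  range-*ˡ (suc q) c f = trans (+-congˡ (range-*ˡ q c (f ∘ suc))) (sym (distribˡ c _ _))

  range-split : ∀ m n f → range (m ℕ.+ n) f ≈ range m f + range n (λ k → f (m ℕ.+ k))
  range-split zero    n f = sym (+-identityˡ _)
  range-split (suc m) n f = trans (+-congˡ (range-split m n (f ∘ suc))) (sym (+-assoc _ _ _))

  range-snoc : ∀ q f → range (suc q) f ≈ range q f + f q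
  range-snoc zero    f = +-comm _ _
  range-snoc (suc q) f = trans (+-congˡ (range-snoc q (f ∘ suc))) (sym (+-assoc _ _ _))

  range-swap : ∀ p q (f : ℕ → ℕ → Carrier) → range p (λ i → range q (f i)) ≈ range q (λ j → range p (λ i → f i j))
  range-swap zero    q f = sym (range-zero q λ _ _ → refl)
  range-swap (suc p) q f = trans (+-congˡ (range-swap p q (f ∘ suc))) (sym (range-+ q (f 0) _))

  cube-cong : ∀ q n {f g} → (∀ p → f p ≈ g p) → cube q n f ≈ cube q n g
  cube-cong q zero    h = h []
  cube-cong q (suc n) h = range-cong q λ c _ → cube-cong q n λ p → h _

  cube-*ˡ : ∀ q n c f → cube q n (λ p → c * f p) ≈ c * cube q n f
  cube-*ˡ q zero    c f = refl
  cube-*ˡ q (suc n) c f = trans (range-cong q λ k _ → cube-*ˡ q n c _) (range-*ˡ q c _)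

  cube-+ : ∀ q n f g → cube q n (λ p → f p + g p) ≈ cube q n f + cube q n g
  cube-+ q zero    f g = refl
  cube-+ q (suc n) f g = trans (range-cong q λ k _ → cube-+ q n _ _) (range-+ q _ _)

  cube-zero : ∀ q n → cube q n (λ _ → 0#) ≈ 0#
  cube-zero q zero    = refl
  cube-zero q (suc n) = range-zero q λ _ _ → cube-zero q n

  range-cube : ∀ m q n (f : ℕ → Vecℤ n → Carrier) → range m (λ c → cube q n (f c)) ≈ cube q n (λ p → range m (λ c → f c p))
  range-cube m q zero    f = refl
  range-cube m q (suc n) f = trans (range-swap m q _) (range-cong q λ c _ → range-cube m q n _)

  ∏-cong : ∀ {A : Set} (xs : List A) {f g} → (∀ x → x ∈ xs → f x ≈ g x) → ∏ xs f ≈ ∏ xs g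
  ∏-cong []       h = refl
  ∏-cong (x ∷ xs) h = *-cong (h x (here ≡.refl)) (∏-cong xs λ y y∈xs → h y (there y∈xs))

  ∏-map : ∀ {A B : Set} (g : A → B) xs f → ∏ (map g xs) f ≡ ∏ xs (f ∘ g)
  ∏-map g []       f = ≡.refl
  ∏-map g (x ∷ xs) f = ≡.cong (_ *_) (∏-map g xs f)

  ∏-++ : ∀ {A : Set} (xs ys : List A) f → ∏ (xs ++ ys) f ≈ ∏ xs f * ∏ ys f
  ∏-++ []       ys f = sym (*-identityˡ _)
  ∏-++ (x ∷ xs) ys f = trans (*-congˡ (∏-++ xs ys f)) (sym (*-assoc _ _ _))

  Periodic : ℕ → (ℤ → Carrier) → Set
  Periodic q f = ∀ z → f (z ℤ.+ ℤ.+ q) ≈ f z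

  periodic-shift : ∀ {q f} t → Periodic q f → Periodic q (λ z → f (z ℤ.+ t))
  periodic-shift {q} {f} t per z = trans (reflexive (≡.cong f (swap z (ℤ.+ q) t))) (per (z ℤ.+ t))
    where
    swap : ∀ a b c → a ℤ.+ b ℤ.+ c ≡ a ℤ.+ c ℤ.+ b
    swap = solveℤ

  -- A shift by one permutes the residues cyclically, and iteration gives all t ≥ 0. For negative t,
  -- the function already shifted by t is shifted back by -t.
  range-translate : ∀ q f → Periodic q f → ∀ t → range q (λ c → f (ℤ.+ c ℤ.+ t)) ≈ range q (λ c → f (ℤ.+ c))
  range-translate q f per (ℤ.+ n)     = forward n f per
    where
    step : ∀ f → Periodic q f → range q (λ c → f (ℤ.+ c ℤ.+ ℤ.+ 1)) ≈ range q (λ c → f (ℤ.+ c))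
    step f per = trans (range-cong q λ k _ → reflexive (≡.cong (f ∘ ℤ.+_) (ℕ.+-comm k 1))) (begin
      range q (λ c → f (ℤ.+ suc c)) ≈⟨ cycle q (λ c → f (ℤ.+ c)) (per ℤ.0ℤ) ⟩
      range q (λ c → f (ℤ.+ c)) ∎)
      where
      cycle : ∀ q (g : ℕ → Carrier) → g q ≈ g 0 → range q (g ∘ suc) ≈ range q g
      cycle zero    g eq = refl
      cycle (suc q) g eq = trans (range-snoc q (g ∘ suc)) (trans (+-comm _ _) (+-congʳ eq))
    forward : ∀ n f → Periodic q f → range q (λ c → f (ℤ.+ c ℤ.+ ℤ.+ n)) ≈ range q (λ c → f (ℤ.+ c))
    forward zero    f per = range-cong q λ k _ → reflexive (≡.cong f (ℤ.+-identityʳ _))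
    forward (suc n) f per = begin
      range q (λ c → f (ℤ.+ c ℤ.+ ℤ.+ suc n))
        ≈⟨ range-cong q (λ k _ → reflexive (≡.cong f (≡.trans (≡.cong (λ m → ℤ.+ k ℤ.+ ℤ.+ m) (ℕ.+-comm 1 n)) (≡.sym (ℤ.+-assoc (ℤ.+ k) (ℤ.+ n) (ℤ.+ 1)))))) ⟩
      range q (λ c → f (ℤ.+ c ℤ.+ ℤ.+ n ℤ.+ ℤ.+ 1))
        ≈⟨ forward n (λ z → f (z ℤ.+ ℤ.+ 1)) (periodic-shift (ℤ.+ 1) per) ⟩
      range q (λ c → f (ℤ.+ c ℤ.+ ℤ.+ 1)) ≈⟨ step f per ⟩
      range q (λ c → f (ℤ.+ c)) ∎
  range-translate q f per t@(ℤ.-[1+ n ]) = begin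
    range q (λ c → f (ℤ.+ c ℤ.+ t)) ≈⟨ range-translate q (λ z → f (z ℤ.+ t)) (periodic-shift t per) (ℤ.+ suc n) ⟨
    range q (λ c → f (ℤ.+ c ℤ.+ ℤ.+ suc n ℤ.+ t)) ≈⟨ range-cong q (λ k _ → reflexive (≡.cong f (cancel (ℤ.+ k) (ℤ.+ suc n)))) ⟩
    range q (λ c → f (ℤ.+ c)) ∎
    where
    cancel : ∀ x y → x ℤ.+ y ℤ.+ (ℤ.- y) ≡ x
    cancel = solveℤ

dot : ∀ {n} → Vecℤ n → Vecℤ n → ℤ
dot []      []      = ℤ.0ℤ
dot (x ∷ u) (y ∷ v) = x ℤ.* y ℤ.+ dot u v

-- If x = y a and a² v = v, the bracket is y times the value a c + v·p of the pivot. So at points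
-- orthogonal to the pivot modulo q, a vector and its reduction have congruent values.
dot-reduce : ∀ {n} (a x c : ℤ) (v w p : Vecℤ n) →
  dot (x ∷ w) (c ∷ p) ≡ dot (reduce (a ∷ v) (x ∷ w)) p ℤ.+ (x ℤ.* c ℤ.+ (a ℤ.* x) ℤ.* dot v p)
dot-reduce a x c v w p = ≡.trans (≡.cong (ℤ._+_ (x ℤ.* c)) (go v w p)) (rearrange (x ℤ.* c) (dot (reduce (a ∷ v) (x ∷ w)) p) (k ℤ.* dot v p))
  where
  k : ℤ
  k = a ℤ.* x
  rearrange : ∀ s t u → s ℤ.+ (t ℤ.+ u) ≡ t ℤ.+ (s ℤ.+ u)
  rearrange = solveℤ
  expand : ∀ w v p s t k → w ℤ.* p ℤ.+ (s ℤ.+ k ℤ.* t) ≡ (w ℤ.- k ℤ.* v) ℤ.* p ℤ.+ s ℤ.+ k ℤ.* (v ℤ.* p ℤ.+ t)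
  expand = solveℤ
  go : ∀ {n} (v w p : Vecℤ n) → dot w p ≡ dot (Vec.zipWith (λ wᵢ vᵢ → wᵢ ℤ.- k ℤ.* vᵢ) w v) p ℤ.+ k ℤ.* dot v p
  go []      []      []      = ≡.sym (≡.trans (ℤ.+-identityˡ _) (ℤ.*-zeroʳ k))
  go (y ∷ v) (z ∷ w) (r ∷ p) = ≡.trans (≡.cong (ℤ._+_ (z ℤ.* r)) (go v w p)) (expand z y r _ _ k)

dot-zeroˡ : ∀ {n} (v p : Vecℤ n) → (∀ i → coord i v ≡ ℤ.0ℤ) → dot v p ≡ ℤ.0ℤ
dot-zeroˡ []      []      h = ≡.refl
dot-zeroˡ (x ∷ v) (y ∷ p) h = ≡.cong₂ (λ s t → s ℤ.* y ℤ.+ t) (h Fin.zero) (dot-zeroˡ v p (h ∘ Fin.suc))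

dot-scaleˡ : ∀ {n} k (v p : Vecℤ n) → (∀ i → k ℤ.* coord i v ≡ coord i v) → k ℤ.* dot v p ≡ dot v p
dot-scaleˡ k []      []      h = ℤ.*-zeroʳ k
dot-scaleˡ k (x ∷ v) (y ∷ p) h = ≡.trans (distr k x y (dot v p))
  (≡.cong₂ (λ s t → s ℤ.* y ℤ.+ t) (h Fin.zero) (dot-scaleˡ k v p (h ∘ Fin.suc)))
  where
  distr : ∀ k x y s → k ℤ.* (x ℤ.* y ℤ.+ s) ≡ (k ℤ.* x) ℤ.* y ℤ.+ k ℤ.* s
  distr = solveℤ

opaque
  δ : ℕ → ℤ → ℕ
  δ q z with ℤ.+ q ℤ∣.∣? z
  ... | yes _ = 1
  ... | no  _ = 0

  δ-yes : ∀ {q z} → ℤ.+ q ∣ℤ z → δ q z ≡ 1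
  δ-yes {q} {z} q∣z with ℤ.+ q ℤ∣.∣? z
  ... | yes _  = ≡.refl
  ... | no q∤z = contradiction q∣z q∤z

  δ-no : ∀ {q z} → ¬ (ℤ.+ q ∣ℤ z) → δ q z ≡ 0
  δ-no {q} {z} q∤z with ℤ.+ q ℤ∣.∣? z
  ... | yes q∣z = contradiction q∣z q∤z
  ... | no _    = ≡.refl

  δ-cong : ∀ {q q′ z z′} → (ℤ.+ q ∣ℤ z → ℤ.+ q′ ∣ℤ z′) → (ℤ.+ q′ ∣ℤ z′ → ℤ.+ q ∣ℤ z) → δ q z ≡ δ q′ z′
  δ-cong {q} {q′} {z} {z′} f g with ℤ.+ q ℤ∣.∣? z
  ... | yes q∣z = ≡.sym (δ-yes (f q∣z))
  ... | no q∤z  = ≡.sym (δ-no (q∤z ∘ g))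

  δ-idem : ∀ q z → δ q z ℕ.* δ q z ≡ δ q z
  δ-idem q z with ℤ.+ q ℤ∣.∣? z
  ... | yes _ = ≡.refl
  ... | no  _ = ≡.refl

  δ≤1 : ∀ q z → δ q z ℕ.≤ 1
  δ≤1 q z with ℤ.+ q ℤ∣.∣? z
  ... | yes _ = ℕ.≤-refl
  ... | no  _ = z≤n

δ-+-multiple : ∀ {q m} z → ℤ.+ q ∣ℤ m → δ q (z ℤ.+ m) ≡ δ q z
δ-+-multiple z q∣m = δ-cong (λ d → ℤ∣.∣m+n∣n⇒∣m d q∣m) (λ d → ℤ∣.∣m∣n⇒∣m+n d q∣m)

δ-neg : ∀ q z → δ q (ℤ.- z) ≡ δ q z
δ-neg q z = δ-cong (λ d → ≡.subst (ℤ.+ q ∣ℤ_) (ℤ.neg-involutive z) (ℤ∣.∣m⇒∣-m d)) ℤ∣.∣m⇒∣-m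

module ℕCube = Cube ℕ.+-*-commutativeSemiring
open ℕCube using (range; cube; ∏; Periodic; range-cong; cube-cong; range-translate)

δ-periodic : ∀ q → Periodic q (δ q)
δ-periodic q z = δ-+-multiple z (ℤ∣.∣-refl)

δ-small : ∀ {q c} → suc c ℕ.< q → δ q (ℤ.+ suc c) ≡ 0
δ-small {q} {c} c<q = δ-no λ d → ℕ.<⇒≱ c<q (ℕ∣.∣⇒≤ (ℤ∣.∣⇒∣ᵤ d))

range-δ : ∀ q .{{_ : ℕ.NonZero q}} → range q (λ c → δ q (ℤ.+ c)) ≡ 1
range-δ (suc q) = ≡.cong₂ ℕ._+_ (δ-yes {suc q} {ℤ.0ℤ} (ℤ∣.divides ℤ.0ℤ ≡.refl)) (ℕCube.range-zero q λ k k<q → δ-small (s≤s k<q))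

-- Since a is its own inverse, q divides a c + t exactly when it divides c + a t, and translation
-- permutes the residues.
range-δ-unit : ∀ q .{{_ : ℕ.NonZero q}} a t → a ℤ.* a ≡ ℤ.1ℤ → range q (λ c → δ q (a ℤ.* ℤ.+ c ℤ.+ t)) ≡ 1
range-δ-unit q a t a² = ≡.trans (range-cong q λ c _ → step (ℤ.+ c))
  (≡.trans (range-translate q (δ q) (δ-periodic q) (a ℤ.* t)) (range-δ q))
  where
  expand : ∀ a c t → a ℤ.* (a ℤ.* c ℤ.+ t) ≡ (a ℤ.* a) ℤ.* c ℤ.+ a ℤ.* t
  expand = solveℤ
  expand′ : ∀ a c t → a ℤ.* (c ℤ.+ a ℤ.* t) ≡ a ℤ.* c ℤ.+ (a ℤ.* a) ℤ.* t
  expand′ = solveℤ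
  times-a : ∀ c → a ℤ.* (a ℤ.* c ℤ.+ t) ≡ c ℤ.+ a ℤ.* t
  times-a c = ≡.trans (expand a c t) (≡.cong (ℤ._+ a ℤ.* t) (≡.trans (≡.cong (ℤ._* c) a²) (ℤ.*-identityˡ c)))
  times-a′ : ∀ c → a ℤ.* (c ℤ.+ a ℤ.* t) ≡ a ℤ.* c ℤ.+ t
  times-a′ c = ≡.trans (expand′ a c t) (≡.cong (ℤ._+_ (a ℤ.* c)) (≡.trans (≡.cong (ℤ._* t) a²) (ℤ.*-identityˡ t)))
  step : ∀ c → δ q (a ℤ.* c ℤ.+ t) ≡ δ q (c ℤ.+ a ℤ.* t)
  step c = δ-cong (λ d → ≡.subst (ℤ.+ q ∣ℤ_) (times-a c) (ℤ∣.∣n⇒∣m*n a d))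
                  (λ d → ≡.subst (ℤ.+ q ∣ℤ_) (times-a′ c) (ℤ∣.∣n⇒∣m*n a d))

-- Here the parity of the modulus enters: 2s divides ±2c exactly when s divides c, which happens
-- twice in 0, ..., 2s - 1.
range-δ-double : ∀ s .{{_ : ℕ.NonZero s}} a → ℤ.∣ a ∣ ≡ 2 → range (2 ℕ.* s) (λ c → δ (2 ℕ.* s) (a ℤ.* ℤ.+ c)) ≡ 2
range-δ-double s a ∣a∣ = begin
  range (2 ℕ.* s) (λ c → δ (2 ℕ.* s) (a ℤ.* ℤ.+ c)) ≡⟨ range-cong (2 ℕ.* s) (λ c _ → step c) ⟩
  range (2 ℕ.* s) f ≡⟨ ≡.cong (λ n → range (s ℕ.+ n) f) (ℕ.+-identityʳ s) ⟩
  range (s ℕ.+ s) f ≡⟨ ℕCube.range-split s s f ⟩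
  range s f ℕ.+ range s (λ c → f (s ℕ.+ c))
    ≡⟨ ≡.cong₂ ℕ._+_ (range-δ s) (≡.trans (range-cong s λ c _ → ≡.trans (≡.cong f (ℕ.+-comm s c)) (δ-periodic s (ℤ.+ c))) (range-δ s)) ⟩
  2 ∎
  where
  open ≡.≡-Reasoning
  f : ℕ → ℕ
  f c = δ s (ℤ.+ c)
  abs : ∀ c → ℤ.∣ a ℤ.* ℤ.+ c ∣ ≡ 2 ℕ.* c
  abs c = ≡.trans (ℤ.abs-* a (ℤ.+ c)) (≡.cong (ℕ._* c) ∣a∣)
  step : ∀ c → δ (2 ℕ.* s) (a ℤ.* ℤ.+ c) ≡ f c
  step c = δ-cong
    (λ d → ℤ∣.∣ᵤ⇒∣ (ℕ∣.*-cancelˡ-∣ 2 (≡.subst (2 ℕ.* s ℕ∣.∣_) (abs c) (ℤ∣.∣⇒∣ᵤ d))))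
    (λ d → ℤ∣.∣ᵤ⇒∣ (≡.subst (2 ℕ.* s ℕ∣.∣_) (≡.sym (abs c)) (ℕ∣.*-monoʳ-∣ 2 (ℤ∣.∣⇒∣ᵤ d))))

-- the number of points p of (ℤ/q)ⁿ orthogonal to all of B
solutions : ∀ {n} → ℕ → List (Vecℤ n) → ℕ
solutions {n} q B = cube q n λ p → ∏ B λ b → δ q (dot b p)

∏-insertion : ∀ {A : Set} {x : A} {xs ys} → Insertion x xs ys → ∀ f → ∏ ys f ≡ f x ℕ.* ∏ xs f
∏-insertion here f = ≡.refl
∏-insertion {x = x} (there {y = y} {xs} i) f = ≡.trans (≡.cong (f y ℕ.*_) (∏-insertion i f)) (x∙yz≈y∙xz (f y) (f x) (∏ xs f))
  where open CommutativeSemigroupProperties ℕ.*-commutativeSemigroup using (x∙yz≈y∙xz)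

∏-⊆ : ∀ {A : Set} {S B : List A} {f} → (∀ x → f x ℕ.≤ 1) → S ⊆ B → ∏ B f ℕ.≤ ∏ S f
∏-⊆ h []           = ℕ.≤-refl
∏-⊆ {S = S} {f = f} h (y ∷ʳ s) = ℕ.≤-trans (ℕ.*-mono-≤ (h y) (∏-⊆ h s)) (ℕ.≤-reflexive (ℕ.*-identityˡ _))
∏-⊆ {f = f} h (_∷_ {x} ≡.refl s) = ℕ.*-monoʳ-≤ (f x) (∏-⊆ h s)

range-mono : ∀ q {f g} → (∀ c → c ℕ.< q → f c ℕ.≤ g c) → range q f ℕ.≤ range q g
range-mono zero    h = z≤n
range-mono (suc q) h = ℕ.+-mono-≤ (h 0 (s≤s z≤n)) (range-mono q λ c c<q → h (suc c) (s≤s c<q))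

cube-mono : ∀ q n {f g} → (∀ p → f p ℕ.≤ g p) → cube q n f ℕ.≤ cube q n g
cube-mono q zero    h = h []
cube-mono q (suc n) h = range-mono q λ c _ → cube-mono q n λ p → h _

range-const : ∀ q x → range q (λ _ → x) ≡ q ℕ.* x
range-const zero    x = ≡.refl
range-const (suc q) x = ≡.cong (x ℕ.+_) (range-const q x)

solutions-⊆ : ∀ {n q} {S B : List (Vecℤ n)} → S ⊆ B → solutions q B ℕ.≤ solutions q S
solutions-⊆ {n} {q} S⊆B = cube-mono q n λ p → ∏-⊆ (λ b → δ≤1 q (dot b p)) S⊆B

solutions-zero-row : ∀ {n q} {b : Vecℤ n} {S S⁺} → (∀ i → coord i b ≡ ℤ.0ℤ) → Insertion b S S⁺ → solutions q S⁺ ≡ solutions q S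
solutions-zero-row {n} {q} {b} b≡0 i = cube-cong q n λ p → ≡.trans (∏-insertion i _)
  (≡.trans (≡.cong (ℕ._* _) (δ-yes (≡.subst (ℤ.+ q ∣ℤ_) (≡.sym (dot-zeroˡ b p b≡0)) (ℤ∣.divides ℤ.0ℤ ≡.refl)))) (ℕ.*-identityˡ _))

solutions-zero-column : ∀ {n} q (B : List (Vecℤ (suc n))) → (∀ b → b ∈ B → Vec.head b ≡ ℤ.0ℤ) →
                        solutions q B ≡ q ℕ.* solutions q (map Vec.tail B)
solutions-zero-column {n} q B h = ≡.trans
  (range-cong q λ c _ → cube-cong q n λ p → ≡.trans (ℕCube.∏-cong B λ b b∈B → ≡.cong (δ q) (eq b (h b b∈B) c p)) (≡.sym (ℕCube.∏-map Vec.tail B _)))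
  (range-const q _)
  where
  eq : ∀ (b : Vecℤ (suc n)) → Vec.head b ≡ ℤ.0ℤ → ∀ c p → dot b (ℤ.+ c ∷ p) ≡ dot (Vec.tail b) p
  eq (x ∷ w) ≡.refl c p = ℤ.+-identityˡ _

-- For fixed p the equation of the pivot has r solutions c, and at these every vector of B may be
-- replaced by its reduction. The pivot stays in the list and becomes a zero vector: as δ is
-- idempotent, its factor can be taken out once more while the product over B stays complete.
solutions-pivot : ∀ {n} q (a : ℤ) (v : Vecℤ n) {B} (r : ℕ) → (a ∷ v) ∈ B →
  (∀ i → a ℤ.* a ℤ.* coord i v ≡ coord i v) → (∀ b → b ∈ B → a ∣ℤ Vec.head b) →
  (∀ p → range q (λ c → δ q (a ℤ.* ℤ.+ c ℤ.+ dot v p)) ≡ r) →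
  solutions q B ≡ r ℕ.* solutions q (map (reduce (a ∷ v)) B)
solutions-pivot {n} q a v {B} r b∈B a²v a∣ count = begin
  range q (λ c → cube q n (λ p → ∏ B (λ b → δ q (dot b (ℤ.+ c ∷ p)))))
    ≡⟨ ℕCube.range-cube q q n _ ⟩
  cube q n (λ p → range q (λ c → ∏ B (λ b → δ q (dot b (ℤ.+ c ∷ p)))))
    ≡⟨ cube-cong q n (λ p → ≡.trans (range-cong q λ c _ → factor c p) (≡.trans (ℕCube.range-*ˡ q (rest p) _)
         (≡.trans (≡.cong (rest p ℕ.*_) (count p)) (ℕ.*-comm (rest p) r)))) ⟩
  cube q n (λ p → r ℕ.* rest p)
    ≡⟨ ℕCube.cube-*ˡ q n r rest ⟩
  r ℕ.* solutions q (map (reduce (a ∷ v)) B) ∎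
  where
  open ≡.≡-Reasoning
  rest : Vecℤ n → ℕ
  rest p = ∏ (map (reduce (a ∷ v)) B) λ b → δ q (dot b p)
  multiple : ∀ c p b → a ∣ℤ Vec.head b → ℤ.+ q ∣ℤ (a ℤ.* c ℤ.+ dot v p) →
             δ q (dot b (c ∷ p)) ≡ δ q (dot (reduce (a ∷ v) b) p)
  multiple c p (x ∷ w) (ℤ∣.divides y x≡ya) d = ≡.trans (≡.cong (δ q) (dot-reduce a x c v w p))
    (δ-+-multiple _ (≡.subst (ℤ.+ q ∣ℤ_) (≡.sym eq) (ℤ∣.∣n⇒∣m*n y d)))
    where
    expand : ∀ a y c t → (y ℤ.* a) ℤ.* c ℤ.+ (a ℤ.* (y ℤ.* a)) ℤ.* t ≡ y ℤ.* (a ℤ.* c ℤ.+ (a ℤ.* a) ℤ.* t)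
    expand = solveℤ
    eq : x ℤ.* c ℤ.+ (a ℤ.* x) ℤ.* dot v p ≡ y ℤ.* (a ℤ.* c ℤ.+ dot v p)
    eq = ≡.trans (≡.cong (λ x → x ℤ.* c ℤ.+ (a ℤ.* x) ℤ.* dot v p) x≡ya)
           (≡.trans (expand a y c (dot v p)) (≡.cong (λ t → y ℤ.* (a ℤ.* c ℤ.+ t)) (dot-scaleˡ (a ℤ.* a) v p a²v)))
  absorb : ∀ {A : Set} {x : A} {xs} (f : A → ℕ) → (∀ x → f x ℕ.* f x ≡ f x) → x ∈ xs → ∏ xs f ≡ f x ℕ.* ∏ xs f
  absorb {x = x} f idem x∈xs with ys , i ← ∈⇒insertion x∈xs = ≡.trans (∏-insertion i f)
    (≡.trans (≡.cong (ℕ._* ∏ ys f) (≡.sym (idem x))) (≡.trans (ℕ.*-assoc (f x) (f x) _) (≡.cong (f x ℕ.*_) (≡.sym (∏-insertion i f)))))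
  factor : ∀ c p → ∏ B (λ b → δ q (dot b (ℤ.+ c ∷ p))) ≡ rest p ℕ.* δ q (a ℤ.* ℤ.+ c ℤ.+ dot v p)
  factor c p = ≡.trans (absorb _ (λ b → δ-idem q _) b∈B) (≡.trans replace (ℕ.*-comm _ (rest p)))
    where
    replace : δ q (a ℤ.* ℤ.+ c ℤ.+ dot v p) ℕ.* ∏ B (λ b → δ q (dot b (ℤ.+ c ∷ p))) ≡ δ q (a ℤ.* ℤ.+ c ℤ.+ dot v p) ℕ.* rest p
    replace with ℤ.+ q ℤ∣.∣? (a ℤ.* ℤ.+ c ℤ.+ dot v p)
    ... | no  ∤ = ≡.trans (≡.cong (ℕ._* ∏ B _) (δ-no ∤)) (≡.sym (≡.cong (ℕ._* rest p) (δ-no ∤)))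
    ... | yes d = ≡.cong (δ q (a ℤ.* ℤ.+ c ℤ.+ dot v p) ℕ.*_) (≡.trans (ℕCube.∏-cong B λ b b∈B → multiple (ℤ.+ c) p b (a∣ b b∈B) d) (≡.sym (ℕCube.∏-map (reduce (a ∷ v)) B _)))

-- Short vectors and pivots

norm : ∀ {n} → Vecℤ n → ℕ
norm []      = 0
norm (x ∷ v) = ℤ.∣ x ∣ ℕ.+ norm v

norm≡0⇒zero : ∀ {n} (v : Vecℤ n) → norm v ≡ 0 → ∀ i → coord i v ≡ ℤ.0ℤ
norm≡0⇒zero (x ∷ v) h Fin.zero    = ℤ.∣i∣≡0⇒i≡0 (ℕ.m+n≡0⇒m≡0 ℤ.∣ x ∣ h)
norm≡0⇒zero (x ∷ v) h (Fin.suc i) = norm≡0⇒zero v (ℕ.m+n≡0⇒n≡0 ℤ.∣ x ∣ h) i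

-- All classical roots are short, and shortness is inherited by reduction along a pivot.
Short : ∀ {n} → List (Vecℤ n) → Set
Short B = ∀ b → b ∈ B → norm b ℕ.≤ 2

-- The two kinds of pivot that occur among short vectors. In both, a² v = v, because a² = 1 or v =
-- 0.
data Shape {n} (a : ℤ) (v : Vecℤ n) : Set where
  unit   : ℤ.∣ a ∣ ≡ 1 → Shape a v
  double : ℤ.∣ a ∣ ≡ 2 → (∀ i → coord i v ≡ ℤ.0ℤ) → Shape a v

data Column {n} (B : List (Vecℤ (suc n))) : Set where
  zeros : (∀ b → b ∈ B → Vec.head b ≡ ℤ.0ℤ) → Column B
  pivot : ∀ a v → (a ∷ v) ∈ B → (∀ b → b ∈ B → a ∣ℤ Vec.head b) → Shape a v → Column B

∣_∣-unit : ∀ a → ℤ.∣ a ∣ ≡ 1 → a ℤ.* a ≡ ℤ.1ℤ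
∣ ℤ.+ 1 ∣-unit    ≡.refl = ≡.refl
∣ ℤ.-[1+ 0 ] ∣-unit ≡.refl = ≡.refl

-- The first coordinates lie between -2 and 2. An entry ±1 divides all others; if there is none, all
-- entries are even and an entry ±2 divides them, and shortness leaves it no other nonzero
-- coordinate.
column : ∀ {n} (B : List (Vecℤ (suc n))) → Short B → Column B
column B short with Any.any? (λ b → ℤ.∣ Vec.head b ∣ ℕ.≟ 1) B
... | yes p with (a ∷ v) , b∈B , ∣a∣≡1 ← find p = pivot a v b∈B
  (λ b _ → ℤ∣.divides (Vec.head b ℤ.* a) (≡.sym (≡.trans (ℤ.*-assoc (Vec.head b) a a)
    (≡.trans (≡.cong (Vec.head b ℤ.*_) (∣ a ∣-unit ∣a∣≡1)) (ℤ.*-identityʳ _))))) (unit ∣a∣≡1)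
... | no ¬1 with Any.any? (λ b → ℤ.∣ Vec.head b ∣ ℕ.≟ 2) B
... | yes p with (a ∷ v) , b∈B , ∣a∣≡2 ← find p = pivot a v b∈B
  (λ b b∈B → ℤ∣.∣ᵤ⇒∣ (≡.subst (ℕ∣._∣ ℤ.∣ Vec.head b ∣) (≡.sym ∣a∣≡2) (even b b∈B)))
  (double ∣a∣≡2 (norm≡0⇒zero v (ℕ.n≤0⇒n≡0 (ℕ.+-cancelˡ-≤ 2 _ _ (≡.subst (λ m → m ℕ.+ norm v ℕ.≤ 2) ∣a∣≡2 (short _ b∈B))))))
  where
  even : ∀ b → b ∈ B → 2 ℕ∣.∣ ℤ.∣ Vec.head b ∣
  even (x ∷ w) b∈B with ℤ.∣ x ∣ in eq | ℕ.≤-trans (ℕ.m≤m+n ℤ.∣ x ∣ (norm w)) (short _ b∈B)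
  ... | 0 | _ = 2 ℕ∣.∣0
  ... | 1 | _ = contradiction (lose b∈B eq) ¬1
  ... | 2 | _ = ℕ∣.∣-refl
  ... | suc (suc (suc _)) | s≤s (s≤s ())
... | no ¬2 = zeros allZero
  where
  allZero : ∀ b → b ∈ B → Vec.head b ≡ ℤ.0ℤ
  allZero (x ∷ w) b∈B with ℤ.∣ x ∣ in eq | ℕ.≤-trans (ℕ.m≤m+n ℤ.∣ x ∣ (norm w)) (short _ b∈B)
  ... | 0 | _ = ℤ.∣i∣≡0⇒i≡0 eq
  ... | 1 | _ = contradiction (lose b∈B eq) ¬1
  ... | 2 | _ = contradiction (lose b∈B eq) ¬2
  ... | suc (suc (suc _)) | s≤s (s≤s ())

module _ {n} {a : ℤ} {v : Vecℤ n} where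
  shape-nonZero : Shape a v → ℕ.NonZero ℤ.∣ a ∣
  shape-nonZero (unit p)     = ≡.subst ℕ.NonZero (≡.sym p) _
  shape-nonZero (double p _) = ≡.subst ℕ.NonZero (≡.sym p) _

  shape-a²v : Shape a v → ∀ i → a ℤ.* a ℤ.* coord i v ≡ coord i v
  shape-a²v (unit p)     i = ≡.trans (≡.cong (ℤ._* coord i v) (∣ a ∣-unit p)) (ℤ.*-identityˡ _)
  shape-a²v (double _ z) i = ≡.trans (≡.cong (a ℤ.* a ℤ.*_) (z i)) (≡.trans (ℤ.*-zeroʳ (a ℤ.* a)) (≡.sym (z i)))

  -- Consequently (ε, f) has the reduction f for each residue ε below |a|: either ε = 0, or v = 0.
  shape-residue : Shape a v → ∀ ε → ε ℕ.< ℤ.∣ a ∣ → ∀ i → a ℤ.* ℤ.+ ε ℤ.* coord i v ≡ ℤ.0ℤ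
  shape-residue (unit p) ε ε<a i with ℕ.n<1⇒n≡0 (≡.subst (ε ℕ.<_) p ε<a)
  ... | ≡.refl = ≡.cong (ℤ._* coord i v) (ℤ.*-zeroʳ a)
  shape-residue (double _ z) ε _ i = ≡.trans (≡.cong (a ℤ.* ℤ.+ ε ℤ.*_) (z i)) (ℤ.*-zeroʳ (a ℤ.* ℤ.+ ε))

  shape-count : Shape a v → ∀ s .{{_ : ℕ.NonZero s}} p → range (2 ℕ.* s) (λ c → δ (2 ℕ.* s) (a ℤ.* ℤ.+ c ℤ.+ dot v p)) ≡ ℤ.∣ a ∣
  shape-count (unit h)     s p = ≡.trans (range-δ-unit (2 ℕ.* s) {{ℕ.m*n≢0 2 s}} a (dot v p) (∣ a ∣-unit h)) (≡.sym h)
  shape-count (double h z) s p = ≡.trans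
    (range-cong (2 ℕ.* s) λ c _ → ≡.cong (δ (2 ℕ.* s)) (≡.trans (≡.cong (ℤ._+_ (a ℤ.* ℤ.+ c)) (dot-zeroˡ v p z)) (ℤ.+-identityʳ _)))
    (≡.trans (range-δ-double s a h) (≡.sym h))

  -- The norm of w - a x v is at most |w| + |x| |a| |v|, and |a| |v| ≤ 1: a pivot ±1 leaves norm at
  -- most 1 for v, a pivot ±2 leaves 0. So the bound is the norm of (x, w).
  reduce-short : ∀ {B} → (a ∷ v) ∈ B → Shape a v → Short B → Short (map (reduce (a ∷ v)) B)
  reduce-short {B} b₀∈B shape short _ c∈ with (x ∷ w) , b∈B , ≡.refl ← ∈-map⁻ (reduce (a ∷ v)) c∈ = begin
    norm (reduce (a ∷ v) (x ∷ w)) ≤⟨ triangle (a ℤ.* x) w v ⟩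
    norm w ℕ.+ ℤ.∣ a ℤ.* x ∣ ℕ.* norm v ≡⟨ ≡.cong (norm w ℕ.+_) (rearrange) ⟩
    norm w ℕ.+ ℤ.∣ x ∣ ℕ.* (ℤ.∣ a ∣ ℕ.* norm v) ≤⟨ ℕ.+-monoʳ-≤ (norm w) (ℕ.*-monoʳ-≤ ℤ.∣ x ∣ (small shape)) ⟩
    norm w ℕ.+ ℤ.∣ x ∣ ℕ.* 1 ≡⟨ ≡.trans (≡.cong (norm w ℕ.+_) (ℕ.*-identityʳ _)) (ℕ.+-comm (norm w) _) ⟩
    norm (x ∷ w) ≤⟨ short _ b∈B ⟩
    2 ∎
    where
    open ℕ.≤-Reasoning
    triangle : ∀ {k} (c : ℤ) (w v : Vecℤ k) → norm (Vec.zipWith (λ wᵢ vᵢ → wᵢ ℤ.- c ℤ.* vᵢ) w v) ℕ.≤ norm w ℕ.+ ℤ.∣ c ∣ ℕ.* norm v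
    triangle c []      []      = z≤n
    triangle c (y ∷ w) (z ∷ v) = begin
      ℤ.∣ y ℤ.- c ℤ.* z ∣ ℕ.+ norm (Vec.zipWith _ w v) ≤⟨ ℕ.+-mono-≤ (ℤ.∣i-j∣≤∣i∣+∣j∣ y (c ℤ.* z)) (triangle c w v) ⟩
      (ℤ.∣ y ∣ ℕ.+ ℤ.∣ c ℤ.* z ∣) ℕ.+ (norm w ℕ.+ ℤ.∣ c ∣ ℕ.* norm v) ≡⟨ ≡.cong (λ t → (ℤ.∣ y ∣ ℕ.+ t) ℕ.+ _) (ℤ.abs-* c z) ⟩
      (ℤ.∣ y ∣ ℕ.+ ℤ.∣ c ∣ ℕ.* ℤ.∣ z ∣) ℕ.+ (norm w ℕ.+ ℤ.∣ c ∣ ℕ.* norm v) ≡⟨ interchange ℤ.∣ y ∣ _ (norm w) _ ⟩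
      (ℤ.∣ y ∣ ℕ.+ norm w) ℕ.+ (ℤ.∣ c ∣ ℕ.* ℤ.∣ z ∣ ℕ.+ ℤ.∣ c ∣ ℕ.* norm v) ≡⟨ ≡.cong (norm (y ∷ w) ℕ.+_) (ℕ.*-distribˡ-+ ℤ.∣ c ∣ _ _) ⟨
      norm (y ∷ w) ℕ.+ ℤ.∣ c ∣ ℕ.* norm (z ∷ v) ∎
      where open CommutativeSemigroupProperties ℕ.+-commutativeSemigroup using (interchange)
    rearrange : ℤ.∣ a ℤ.* x ∣ ℕ.* norm v ≡ ℤ.∣ x ∣ ℕ.* (ℤ.∣ a ∣ ℕ.* norm v)
    rearrange = ≡.trans (≡.cong (ℕ._* norm v) (≡.trans (ℤ.abs-* a x) (ℕ.*-comm ℤ.∣ a ∣ _))) (ℕ.*-assoc ℤ.∣ x ∣ _ _)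
    small : Shape a v → ℤ.∣ a ∣ ℕ.* norm v ℕ.≤ 1
    small (unit p)     rewrite p | ℕ.*-identityˡ (norm v) = ℕ.s≤s⁻¹ (≡.subst (λ m → m ℕ.+ norm v ℕ.≤ 2) p (short _ b₀∈B))
    small (double p z) rewrite ℕ.n≤0⇒n≡0 (ℕ.+-cancelˡ-≤ 2 _ 0 (≡.subst (λ m → m ℕ.+ norm v ℕ.≤ 2) p (short _ b₀∈B)))
      | ℕ.*-zeroʳ ℤ.∣ a ∣ = z≤n

tail-short : ∀ {n} {B : List (Vecℤ (suc n))} → Short B → Short (map Vec.tail B)
tail-short short _ c∈ with (x ∷ w) , b∈B , ≡.refl ← ∈-map⁻ Vec.tail c∈ = ℕ.≤-trans (ℕ.m≤n+m (norm w) ℤ.∣ x ∣) (short _ b∈B)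

⊆-short : ∀ {n} {S B : List (Vecℤ n)} → S ⊆ B → Short B → Short S
⊆-short S⊆B short b b∈S = short b (lookup-⊆ S⊆B b∈S)

reduce-pivot : ∀ {n} {a} {v : Vecℤ n} → Shape a v → ∀ i → coord i (reduce (a ∷ v) (a ∷ v)) ≡ ℤ.0ℤ
reduce-pivot {a = a} {v} shape i = ≡.trans (coord-reduce a v i (a ∷ v))
  (≡.trans (≡.cong (λ t → coord i v ℤ.- t) (shape-a²v shape i)) (ℤ.+-inverseʳ (coord i v)))

-- Linear independence under reduction

ℤ→ℚ : RingHom ℤ.+-*-commutativeRing ℚ.+-*-commutativeRing
ℤ→ℚ = record { ⟦_⟧ = toℚ ; ⟦⟧-cong = ≡.cong toℚ ; +-hom = toℚ-+ ; *-hom = toℚ-* ; 0-hom = ≡.refl ; 1-hom = ≡.refl }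

module Qc = Combinations ℚ.+-*-commutativeRing ℤ→ℚ
module Zc = Combinations ℤ.+-*-commutativeRing (idHom ℤ.+-*-commutativeRing)

divide : ∀ a .{{_ : ℕ.NonZero ℤ.∣ a ∣}} t u → ∃ λ y → t ℚ.+ y ℚ.* toℚ a ≡ u
divide a t u = (u ℚ.- t) ℚ.* (ℚ.1/ A) , (begin
  t ℚ.+ (u ℚ.- t) ℚ.* ℚ.1/ A ℚ.* A ≡⟨ ≡.cong (t ℚ.+_) (ℚ.*-assoc (u ℚ.- t) (ℚ.1/ A) A) ⟩
  t ℚ.+ (u ℚ.- t) ℚ.* (ℚ.1/ A ℚ.* A) ≡⟨ ≡.cong (λ x → t ℚ.+ (u ℚ.- t) ℚ.* x) (ℚ.*-inverseˡ A) ⟩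
  t ℚ.+ (u ℚ.- t) ℚ.* 1ℚ ≡⟨ ≡.cong (t ℚ.+_) (ℚ.*-identityʳ _) ⟩
  t ℚ.+ (u ℚ.- t) ≡⟨ ℚ.+-comm t _ ⟩
  (u ℚ.- t) ℚ.+ t ≡⟨ ℚ.+-assoc u _ t ⟩
  u ℚ.+ (ℚ.- t ℚ.+ t) ≡⟨ ≡.cong (u ℚ.+_) (ℚ.+-inverseˡ t) ⟩
  u ℚ.+ 0ℚ ≡⟨ ℚ.+-identityʳ u ⟩
  u ∎)
  where
  open ≡.≡-Reasoning
  A : ℚ
  A = toℚ a
  A≢0 : A ≢ 0ℚ
  A≢0 eq = ℕ.≢-nonZero⁻¹ ℤ.∣ a ∣ (≡.cong ℤ.∣_∣ (toℚ-injective {a} {ℤ.0ℤ} eq))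
  instance
    A-nonZero : ℚ.NonZero A
    A-nonZero = ℚ.≢-nonZero A≢0

divide-zero : ∀ a .{{_ : ℕ.NonZero ℤ.∣ a ∣}} y → y ℚ.* toℚ a ≡ 0ℚ → y ≡ 0ℚ
divide-zero a y eq = begin
  y ≡⟨ ℚ.*-identityʳ y ⟨
  y ℚ.* 1ℚ ≡⟨ ≡.cong (y ℚ.*_) h ⟨
  y ℚ.* (0ℚ ℚ.+ z ℚ.* toℚ a) ≡⟨ ≡.cong (y ℚ.*_) (≡.trans (ℚ.+-identityˡ _) (ℚ.*-comm z (toℚ a))) ⟩
  y ℚ.* (toℚ a ℚ.* z) ≡⟨ ℚ.*-assoc y (toℚ a) z ⟨
  y ℚ.* toℚ a ℚ.* z ≡⟨ ≡.cong (ℚ._* z) eq ⟩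
  0ℚ ℚ.* z ≡⟨ ℚ.*-zeroˡ z ⟩
  0ℚ ∎
  where
  open ≡.≡-Reasoning
  z = proj₁ (divide a 0ℚ 1ℚ)
  h = proj₂ (divide a 0ℚ 1ℚ)

open Qc using (Independent)

independent-tail : ∀ {n} (S : List (Vecℤ (suc n))) → (∀ b → b ∈ S → Vec.head b ≡ ℤ.0ℤ) → Independent S → Independent (map Vec.tail S)
independent-tail S h ind ws′ eq vanish with ws , p , ≡.refl ← Qc.onVectors⁻ Vec.tail S ws′ eq =
  Qc.onVectors-zero Vec.tail ws (ind ws p λ
    { Fin.zero    → first ws p
    ; (Fin.suc i) → ≡.trans (≡.sym (Qc.comb-cong ws (coord-tail i))) (≡.trans (≡.sym (Qc.comb-onVectors Vec.tail ws (coord i))) (vanish i)) })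
  where
  heads : ∀ ws → (∀ b → b ∈ Qc.vectors ws → Vec.head b ≡ ℤ.0ℤ) → All (λ w → coord Fin.zero (proj₂ w) ≡ ℤ.0ℤ) ws
  heads []                 h = []
  heads ((c , x ∷ b) ∷ ws) h = h _ (here ≡.refl) ∷ heads ws λ b b∈ → h b (there b∈)
  first : ∀ ws → Qc.vectors ws ≡ S → Qc.comb ws (coord Fin.zero) ≡ 0ℚ
  first ws ≡.refl = Qc.comb-zero ws (heads ws h)

independent-tail⁻ : ∀ {n} (S : List (Vecℤ (suc n))) → Independent (map Vec.tail S) → Independent S
independent-tail⁻ S ind ws ≡.refl vanish = Qc.onVectors-zero⁻ Vec.tail ws (ind (Qc.onVectors Vec.tail ws) (Qc.onVectors-vectors Vec.tail ws)
  λ i → ≡.trans (Qc.comb-onVectors Vec.tail ws (coord i)) (≡.trans (Qc.comb-cong ws (coord-tail i)) (vanish (Fin.suc i))))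

module _ {n} {a : ℤ} {v : Vecℤ n} (shape : Shape a v) where
  private
    instance _ = shape-nonZero shape
    φ = reduce (a ∷ v)
    drop-zero : ∀ s V → s ≡ s ℚ.+ toℚ a ℚ.* 0ℚ ℚ.* V
    drop-zero s V = ≡.sym (≡.trans (≡.cong (λ t → s ℚ.+ t ℚ.* V) (ℚ.*-zeroʳ (toℚ a))) (≡.trans (≡.cong (s ℚ.+_) (ℚ.*-zeroˡ V)) (ℚ.+-identityʳ s)))

    -- the combination ws extended by y · pivot, where y kills the first coordinate
    extended : ∀ {ws ws⁺ y} → Insertion (y , a ∷ v) ws ws⁺ → Qc.comb ws (coord Fin.zero) ℚ.+ y ℚ.* toℚ a ≡ 0ℚ →
               ∀ i → Qc.comb ws⁺ (coord (Fin.suc i)) ≡ Qc.comb (Qc.onVectors φ ws) (coord i)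
    extended {ws} {ws⁺} {y} ins h i = ≡.trans (Qc.comb-insertion ins (coord (Fin.suc i)))
      (≡.trans (Qc.pivot-correction a v (shape-a²v shape) i y (Qc.comb ws (coord Fin.zero)) 0ℚ (Qc.comb ws (coord (Fin.suc i))) h)
      (≡.trans (≡.sym (drop-zero _ (toℚ (coord i v))))
        (≡.trans (≡.sym (Qc.comb-reduce a v ws i)) (≡.sym (Qc.comb-onVectors φ ws (coord i))))))

  -- A relation among the reduced vectors lifts to one in S: keep the weights and add the multiple
  -- of the pivot that cancels the first coordinate.
  independent-reduce : ∀ {S⁻ S} → Insertion (a ∷ v) S⁻ S → Independent S → Independent (map φ S⁻)
  independent-reduce {S⁻} ins ind ws′ eq vanish with ws , p , ≡.refl ← Qc.onVectors⁻ φ S⁻ ws′ eq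
    with y , h ← divide a (Qc.comb ws (coord Fin.zero)) 0ℚ
    with ws⁺ , p⁺ , ins⁺ ← Qc.join-insertion ins y ws p =
    Qc.onVectors-zero φ ws (proj₂ (insertion-All⁻ ins⁺ (ind ws⁺ p⁺ λ
      { Fin.zero    → ≡.trans (Qc.comb-insertion ins⁺ (coord Fin.zero)) (≡.trans (ℚ.+-comm (y ℚ.* toℚ a) _) h)
      ; (Fin.suc i) → ≡.trans (extended ins⁺ h i) (vanish i) })))

  -- Conversely, a relation in S without its pivot term reduces to a relation, so these weights
  -- vanish; what remains is y a = 0, and a is nonzero.
  independent-reduce⁻ : ∀ {S⁻ S} → Insertion (a ∷ v) S⁻ S → Independent (map φ S⁻) → Independent S
  independent-reduce⁻ ins ind ws⁺ eq vanish with y , ws , ≡.refl , ins⁺ ← Qc.split-insertion ins ws⁺ eq =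
    insertion-All ins⁺ (divide-zero a y ya≡0) ws≡0
    where
    h : Qc.comb ws (coord Fin.zero) ℚ.+ y ℚ.* toℚ a ≡ 0ℚ
    h = ≡.trans (ℚ.+-comm _ (y ℚ.* toℚ a)) (≡.trans (≡.sym (Qc.comb-insertion ins⁺ (coord Fin.zero))) (vanish Fin.zero))
    ws≡0 : All (λ w → proj₁ w ≡ 0ℚ) ws
    ws≡0 = Qc.onVectors-zero⁻ φ ws (ind (Qc.onVectors φ ws) (Qc.onVectors-vectors φ ws)
      λ i → ≡.trans (≡.sym (extended ins⁺ h i)) (vanish (Fin.suc i)))
    comb≡0 : ∀ ws → All (λ w → proj₁ w ≡ 0ℚ) ws → Qc.comb ws (coord Fin.zero) ≡ 0ℚ
    comb≡0 []             []            = ≡.refl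
    comb≡0 ((_ , b) ∷ ws) (≡.refl ∷ ps) = ≡.trans (≡.cong₂ ℚ._+_ (ℚ.*-zeroˡ (toℚ (coord Fin.zero b))) (comb≡0 ws ps)) (ℚ.+-identityˡ 0ℚ)
    ya≡0 : y ℚ.* toℚ a ≡ 0ℚ
    ya≡0 = ≡.trans (≡.sym (ℚ.+-identityˡ _)) (≡.trans (≡.cong (ℚ._+ _) (≡.sym (comb≡0 ws ws≡0))) h)

  private
    zeroWeights : List (Vecℤ n) → Qc.Weighted n
    zeroWeights = map (0ℚ ,_)
    vectors-zeroWeights : ∀ T → Qc.vectors (zeroWeights T) ≡ T
    vectors-zeroWeights []      = ≡.refl
    vectors-zeroWeights (t ∷ T) = ≡.cong (t ∷_) (vectors-zeroWeights T)
    comb-zeroWeights : ∀ T i → Qc.comb (zeroWeights T) (coord i) ≡ 0ℚ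
    comb-zeroWeights []      i = ≡.refl
    comb-zeroWeights (t ∷ T) i = ≡.trans (≡.cong₂ ℚ._+_ (ℚ.*-zeroˡ (toℚ (coord i t))) (comb-zeroWeights T i)) (ℚ.+-identityˡ 0ℚ)

  -- The pivot reduces to the zero vector; giving it the weight 1 and all other vectors the weight 0
  -- is a nontrivial relation.
  independent-∌-pivot : ∀ {S} → Independent (map φ S) → (a ∷ v) ∉ S
  independent-∌-pivot {S} ind b∈S with S⁻ , ins ← ∈⇒insertion b∈S
    with ws , p , ins′ ← Qc.join-insertion (insertion-map φ ins) 1ℚ (zeroWeights (map φ S⁻)) (vectors-zeroWeights (map φ S⁻)) =
    1≢0 (proj₁ (insertion-All⁻ ins′ (ind ws p λ i → ≡.trans (Qc.comb-insertion ins′ (coord i))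
      (≡.trans (≡.cong₂ ℚ._+_ (≡.cong (λ t → 1ℚ ℚ.* toℚ t) (reduce-pivot shape i)) (comb-zeroWeights (map φ S⁻) i)) (ℚ.+-identityˡ 0ℚ)))))
    where
    1≢0 : 1ℚ ≢ 0ℚ
    1≢0 ()

-- Rank and index

LatticeIndex : ∀ {n} → List (Vecℤ n) → ℕ → Set
LatticeIndex {n} B m = Σ (Fin m → Vecℤ n) λ f →
    (∀ i → Qc.Spans B λ k → toℚ (coord k (f i)))
  × (∀ i j → Zc.Spans B (λ k → coord k (f i) ℤ.- coord k (f j)) → i ≡ j)
  × (∀ v → Qc.Spans B (λ k → toℚ (coord k v)) → ∃ λ i → Zc.Spans B (λ k → coord k v ℤ.- coord k (f i)))

toℚ-neg : ∀ x → toℚ (ℤ.- x) ≡ ℚ.- toℚ x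
toℚ-neg = Qc.neg-hom

toℚ-reduce : ∀ {n} a (v : Vecℤ n) x w i →
  toℚ (coord i (reduce (a ∷ v) (x ∷ w))) ≡ toℚ (coord i w) ℚ.+ ℚ.- (toℚ a ℚ.* toℚ x ℚ.* toℚ (coord i v))
toℚ-reduce a v x w i = ≡.trans (≡.cong toℚ (coord-reduce a v i (x ∷ w)))
  (≡.trans (toℚ-+ (coord i w) (ℤ.- k)) (≡.cong (toℚ (coord i w) ℚ.+_) (≡.trans (toℚ-neg k) (≡.cong (ℚ.-_)
    (≡.trans (toℚ-* (a ℤ.* x) (coord i v)) (≡.cong (ℚ._* toℚ (coord i v)) (toℚ-* a x)))))))
  where
  k : ℤ
  k = a ℤ.* x ℤ.* coord i v

comb-divisible : ∀ {n} a {B : List (Vecℤ (suc n))} → (∀ b → b ∈ B → a ∣ℤ Vec.head b) →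
                 ∀ ws → All (λ w → proj₂ w ∈ B) ws → a ∣ℤ Zc.comb ws (coord Fin.zero)
comb-divisible a h []                 []       = ℤ∣.divides ℤ.0ℤ ≡.refl
comb-divisible a h ((c , x ∷ b) ∷ ws) (p ∷ ps) = ℤ∣.∣m∣n⇒∣m+n (ℤ∣.∣n⇒∣m*n c (h _ p)) (comb-divisible a h ws ps)

residues-distinct : ∀ {a} ε ε′ → ε ℕ.< ℤ.∣ a ∣ → ε′ ℕ.< ℤ.∣ a ∣ → a ∣ℤ (ℤ.+ ε ℤ.- ℤ.+ ε′) → ε ≡ ε′
residues-distinct {a} ε ε′ ε< ε′< d with ℤ.∣ ℤ.+ ε ℤ.- ℤ.+ ε′ ∣ in eq
... | zero = ℤ.+-injective (ℤ.i-j≡0⇒i≡j (ℤ.+ ε) (ℤ.+ ε′) (ℤ.∣i∣≡0⇒i≡0 eq))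
... | suc k = contradiction (ℕ∣.∣⇒≤ {{≡.subst ℕ.NonZero (≡.sym eq) _}} (ℤ∣.∣⇒∣ᵤ d)) (ℕ.<⇒≱ (ℕ.≤-<-trans
    (≡.subst (ℕ._≤ ε ℕ.⊔ ε′) (≡.sym (≡.cong ℤ.∣_∣ (ℤ.m-n≡m⊖n ε ε′))) (ℤ.∣m⊝n∣≤m⊔n ε ε′)) (ℕ.⊔-pres-<m ε< ε′<)))

-- Rank, index and count are built by one recursion because each elimination step changes all three
-- together. The basis witnesses that the rank is at least ρ; that no independent sublist is longer
-- follows from the count, in `rank-unique`. The bound ρ ≤ n keeps n ∸ ρ a true difference, and μ >
-- 0 makes the growth of the count visible.
record Structure {n} (B : List (Vecℤ n)) : Set where
  field
    ρ μ             : ℕ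
    ρ≤n             : ρ ℕ.≤ n
    μ>0             : 0 ℕ.< μ
    solutions-count : ∀ s .{{_ : ℕ.NonZero s}} → solutions (2 ℕ.* s) B ≡ μ ℕ.* (2 ℕ.* s) ℕ.^ (n ∸ ρ)
    basis           : List (Vecℤ n)
    basis⊆          : basis ⊆ B
    basis-indep     : Independent basis
    basis-length    : length basis ≡ ρ
    index           : LatticeIndex B μ

zeros-power : ∀ {n k} μ q → k ℕ.≤ n → q ℕ.* (μ ℕ.* q ℕ.^ (n ∸ k)) ≡ μ ℕ.* q ℕ.^ (suc n ∸ k)
zeros-power {n} {k} μ q k≤n rewrite ℕ.+-∸-assoc 1 k≤n = x∙yz≈y∙xz q μ (q ℕ.^ (n ∸ k))
  where open CommutativeSemigroupProperties ℕ.*-commutativeSemigroup using (x∙yz≈y∙xz)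

structure-zeros : ∀ {n} {B : List (Vecℤ (suc n))} → (∀ b → b ∈ B → Vec.head b ≡ ℤ.0ℤ) → Structure (map Vec.tail B) → Structure B
structure-zeros {n} {B} heads st with T , T⊆B , eqT ← ⊆-map⁻ Vec.tail B (Structure.basis⊆ st) = record
  { ρ = ρ ; μ = μ ; ρ≤n = ℕ.m≤n⇒m≤1+n ρ≤n ; μ>0 = μ>0
  ; solutions-count = λ s → ≡.trans (solutions-zero-column (2 ℕ.* s) B heads)
      (≡.trans (≡.cong (2 ℕ.* s ℕ.*_) (solutions-count s)) (zeros-power μ (2 ℕ.* s) ρ≤n))
  ; basis = T ; basis⊆ = T⊆B
  ; basis-indep = independent-tail⁻ T (≡.subst Independent eqT basis-indep)
  ; basis-length = ≡.trans (≡.sym (List.length-map Vec.tail T)) (≡.trans (≡.cong length (≡.sym eqT)) basis-length)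
  ; index = (λ i → ℤ.0ℤ ∷ f i)
          , (λ i → Qc.spans-tail⁻ heads ≡.refl (in-span i))
          , (λ i j sp → distinct i j (Zc.spans-tail sp))
          , λ { (x ∷ w) sp → cover′ x w sp (cover w (Qc.spans-tail sp)) } }
  where
  open Structure st
  f = proj₁ index
  in-span = proj₁ (proj₂ index)
  distinct = proj₁ (proj₂ (proj₂ index))
  cover = proj₂ (proj₂ (proj₂ index))
  cover′ : ∀ x w → Qc.Spans B (λ k → toℚ (coord k (x ∷ w))) → ∃ (λ i → Zc.Spans (map Vec.tail B) (λ k → coord k w ℤ.- coord k (f i))) →
           ∃ λ i → Zc.Spans B (λ k → coord k (x ∷ w) ℤ.- coord k (ℤ.0ℤ ∷ f i))
  cover′ x w sp (i , sp′) = i , Zc.spans-tail⁻ heads (≡.trans (ℤ.+-identityʳ x) (toℚ-injective {x} {ℤ.0ℤ} (Qc.spans-zero-column heads sp))) sp′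

-- The representatives are (ε, f) with 0 ≤ ε < |a| and f a representative for the reduced list.
-- First coordinates of lattice vectors are the multiples of a, so ε is determined by the coset and
-- every residue is needed; once ε is matched, reduction decides the rest.
pivot-index : ∀ {n} {B : List (Vecℤ (suc n))} {a v μ} → (a ∷ v) ∈ B → (∀ b → b ∈ B → a ∣ℤ Vec.head b) → Shape a v →
              LatticeIndex (map (reduce (a ∷ v)) B) μ → LatticeIndex B (ℤ.∣ a ∣ ℕ.* μ)
pivot-index {n} {B} {a} {v} {μ} b₀∈B a∣ shape (f , in-span , distinct , cover) = F , F-in-span , F-distinct , F-cover
  where
  instance
    a-nonZero : ℕ.NonZero ℤ.∣ a ∣
    a-nonZero = shape-nonZero shape
  φ = reduce (a ∷ v)
  a²v = shape-a²v shape
  rep : Fin ℤ.∣ a ∣ × Fin μ → Vecℤ (suc n)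
  rep (ε , i) = ℤ.+ Fin.toℕ ε ∷ f i
  F : Fin (ℤ.∣ a ∣ ℕ.* μ) → Vecℤ (suc n)
  F j = rep (Fin.remQuot μ j)
  residue : ∀ (ε : Fin ℤ.∣ a ∣) i → a ℤ.* ℤ.+ Fin.toℕ ε ℤ.* coord i v ≡ ℤ.0ℤ
  residue ε = shape-residue shape (Fin.toℕ ε) (Fin.toℕ<n ε)

  rep-in-span : ∀ εi → Qc.Spans B (λ k → toℚ (coord k (rep εi)))
  rep-in-span (ε , i) = Qc.spans-reduce⁻ a v a²v b₀∈B (λ ws _ → divide a (Qc.comb ws (coord Fin.zero)) (toℚ (ℤ.+ Fin.toℕ ε)))
    (Qc.spans-cong (λ k → ≡.sym (≡.trans (≡.sym (toℚ-reduce a v (ℤ.+ Fin.toℕ ε) (f i) k))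
      (≡.cong toℚ (≡.trans (coord-reduce a v k (ℤ.+ Fin.toℕ ε ∷ f i)) (≡.trans (≡.cong (λ t → coord k (f i) ℤ.- t) (residue ε k)) (ℤ.+-identityʳ (coord k (f i))))))))
      (in-span i))
  F-in-span : ∀ j → Qc.Spans B (λ k → toℚ (coord k (F j)))
  F-in-span j = rep-in-span (Fin.remQuot μ j)

  rep-distinct : ∀ εi ε′j → Zc.Spans B (λ k → coord k (rep εi) ℤ.- coord k (rep ε′j)) → εi ≡ ε′j
  rep-distinct (ε , i) (ε′ , j) sp@(ws , p , q) = ≡.cong₂ _,_ ε≡ε′ (distinct i j (Zc.spans-cong simplify (Zc.spans-reduce a v sp)))
    where
    ε≡ε′ : ε ≡ ε′
    ε≡ε′ = Fin.toℕ-injective (residues-distinct {a} (Fin.toℕ ε) (Fin.toℕ ε′) (Fin.toℕ<n ε) (Fin.toℕ<n ε′)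
             (≡.subst (a ∣ℤ_) (q Fin.zero) (comb-divisible a a∣ ws p)))
    simplify : ∀ k → (coord k (f i) ℤ.- coord k (f j)) ℤ.+ ℤ.- (a ℤ.* (ℤ.+ Fin.toℕ ε ℤ.- ℤ.+ Fin.toℕ ε′) ℤ.* coord k v) ≡ coord k (f i) ℤ.- coord k (f j)
    simplify k = ≡.trans (≡.cong (λ t → (coord k (f i) ℤ.- coord k (f j)) ℤ.- a ℤ.* t ℤ.* coord k v)
        (≡.trans (≡.cong (λ t → ℤ.+ Fin.toℕ ε ℤ.- ℤ.+ Fin.toℕ t) (≡.sym ε≡ε′)) (ℤ.+-inverseʳ (ℤ.+ Fin.toℕ ε))))
      (vanish a (coord k v) (coord k (f i) ℤ.- coord k (f j)))
      where
      vanish : ∀ a v s → s ℤ.- a ℤ.* ℤ.0ℤ ℤ.* v ≡ s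
      vanish = solveℤ
  F-distinct : ∀ i j → Zc.Spans B (λ k → coord k (F i) ℤ.- coord k (F j)) → i ≡ j
  F-distinct i j sp = ≡.trans (≡.sym (Fin.combine-remQuot {ℤ.∣ a ∣} μ i)) (≡.trans
    (≡.cong (λ (ε , k) → Fin.combine ε k) (rep-distinct (Fin.remQuot μ i) (Fin.remQuot μ j) sp)) (Fin.combine-remQuot {ℤ.∣ a ∣} μ j))

  rep-cover : ∀ w → Qc.Spans B (λ k → toℚ (coord k w)) → ∃ λ εi → Zc.Spans B (λ k → coord k w ℤ.- coord k (rep εi))
  rep-cover (x ∷ w) sp = (ε , i) , Zc.spans-reduce⁻ a v a²v b₀∈B correct
      (Zc.spans-cong (λ k → ≡.sym (simplify k)) sp′)
    where
    reduced : Qc.Spans (map φ B) (λ k → toℚ (coord k (φ (x ∷ w))))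
    reduced = Qc.spans-cong (λ k → ≡.sym (toℚ-reduce a v x w k)) (Qc.spans-reduce a v sp)
    i = proj₁ (cover (φ (x ∷ w)) reduced)
    sp′ = proj₂ (cover (φ (x ∷ w)) reduced)
    -- The residue of x modulo |a| becomes the first coordinate of the representative, so that
    -- multiples of the pivot can make up the difference.
    r : ℕ
    r = x ℤ.%ℕ ℤ.∣ a ∣
    r< : r ℕ.< ℤ.∣ a ∣
    r< = ℤ.n%ℕd<d x ℤ.∣ a ∣
    ε = Fin.fromℕ< r<
    ε≡r : ℤ.+ Fin.toℕ ε ≡ ℤ.+ r
    ε≡r = ≡.cong ℤ.+_ (Fin.toℕ-fromℕ< r<)
    a∣x-ε : a ∣ℤ (x ℤ.- ℤ.+ Fin.toℕ ε)
    a∣x-ε = ≡.subst (a ∣ℤ_) (≡.sym (≡.trans (≡.cong₂ ℤ._-_ (ℤ.a≡a%ℕn+[a/ℕn]*n x ℤ.∣ a ∣) ε≡r) (cancel (ℤ.+ r) ((x ℤ./ℕ ℤ.∣ a ∣) ℤ.* ℤ.+ ℤ.∣ a ∣))))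
      (ℤ∣.∣n⇒∣m*n (x ℤ./ℕ ℤ.∣ a ∣) ℤ∣.m∣∣m∣)
      where
      cancel : ∀ r s → r ℤ.+ s ℤ.- r ≡ s
      cancel = solveℤ
    correct : ∀ ws → All (λ b → proj₂ b ∈ B) ws → ∃ λ y → Zc.comb ws (coord Fin.zero) ℤ.+ y ℤ.* a ≡ x ℤ.- ℤ.+ Fin.toℕ ε
    correct ws p with ℤ∣.divides y eq ← a∣x-ε | ℤ∣.divides t eq′ ← comb-divisible a a∣ ws p = y ℤ.- t ,
      ≡.trans (≡.cong (ℤ._+ (y ℤ.- t) ℤ.* a) eq′) (≡.trans (rearr t y a) (≡.sym eq))
      where
      rearr : ∀ t y a → t ℤ.* a ℤ.+ (y ℤ.- t) ℤ.* a ≡ y ℤ.* a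
      rearr = solveℤ
    simplify : ∀ k → (coord k w ℤ.- coord k (f i)) ℤ.+ ℤ.- (a ℤ.* (x ℤ.- ℤ.+ Fin.toℕ ε) ℤ.* coord k v) ≡ coord k (φ (x ∷ w)) ℤ.- coord k (f i)
    simplify k = ≡.trans (expand a x (ℤ.+ Fin.toℕ ε) (coord k v) (coord k w) (coord k (f i)))
      (≡.trans (≡.cong (ℤ._+_ (coord k w ℤ.- a ℤ.* x ℤ.* coord k v ℤ.- coord k (f i))) (residue ε k))
        (≡.trans (ℤ.+-identityʳ _) (≡.cong (ℤ._- coord k (f i)) (≡.sym (coord-reduce a v k (x ∷ w))))))
      where
      expand : ∀ a x e v w f → (w ℤ.- f) ℤ.+ ℤ.- (a ℤ.* (x ℤ.- e) ℤ.* v) ≡ (w ℤ.- a ℤ.* x ℤ.* v ℤ.- f) ℤ.+ a ℤ.* e ℤ.* v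
      expand = solveℤ
  F-cover : ∀ w → Qc.Spans B (λ k → toℚ (coord k w)) → ∃ λ j → Zc.Spans B (λ k → coord k w ℤ.- coord k (F j))
  F-cover w sp with (ε , i) , sp′ ← rep-cover w sp = Fin.combine ε i ,
    Zc.spans-cong (λ k → ≡.cong (λ εi → coord k w ℤ.- coord k (rep εi)) (≡.sym (Fin.remQuot-combine {ℤ.∣ a ∣} ε i))) sp′

-- The rank grows with the dimension, so the exponent n - ρ is unchanged, while the index and the
-- number of solutions are both multiplied by |a|. The basis is the lifted one with the pivot added.
structure-pivot : ∀ {n} {B : List (Vecℤ (suc n))} {a v} → (a ∷ v) ∈ B → (∀ b → b ∈ B → a ∣ℤ Vec.head b) → Shape a v →
                  Structure (map (reduce (a ∷ v)) B) → Structure B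
structure-pivot {n} {B} {a} {v} b₀∈B a∣ shape st
  with T , T⊆B , eqT ← ⊆-map⁻ (reduce (a ∷ v)) B (Structure.basis⊆ st)
  with sublist-insertion T⊆B b₀∈B
... | inj₁ b₀∈T = contradiction b₀∈T (independent-∌-pivot shape (≡.subst Independent eqT (Structure.basis-indep st)))
... | inj₂ (T⁺ , ins , T⁺⊆B) = record
  { ρ = suc ρ ; μ = ℤ.∣ a ∣ ℕ.* μ ; ρ≤n = s≤s ρ≤n ; μ>0 = ℕ.*-mono-≤ (ℕ.>-nonZero⁻¹ ℤ.∣ a ∣ {{shape-nonZero shape}}) μ>0
  ; solutions-count = λ s → ≡.trans
      (solutions-pivot (2 ℕ.* s) a v ℤ.∣ a ∣ b₀∈B (shape-a²v shape) a∣ (shape-count shape s))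
      (≡.trans (≡.cong (ℤ.∣ a ∣ ℕ.*_) (solutions-count s)) (≡.sym (ℕ.*-assoc ℤ.∣ a ∣ μ _)))
  ; basis = T⁺ ; basis⊆ = T⁺⊆B
  ; basis-indep = independent-reduce⁻ shape ins (≡.subst Independent eqT basis-indep)
  ; basis-length = ≡.trans (insertion-length ins) (≡.cong suc (≡.trans (≡.sym (List.length-map _ T)) (≡.trans (≡.cong length (≡.sym eqT)) basis-length)))
  ; index = pivot-index b₀∈B a∣ shape index }
  where open Structure st

structure-point : ∀ (B : List (Vecℤ 0)) → Structure B
structure-point B = record
  { ρ = 0 ; μ = 1 ; ρ≤n = z≤n ; μ>0 = s≤s z≤n
  ; solutions-count = λ s → ≡.trans (ℕCube.∏-cong B λ { [] _ → δ-yes (ℤ∣.divides ℤ.0ℤ ≡.refl) }) (ones B)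
  ; basis = [] ; basis⊆ = minimum B ; basis-indep = λ { [] _ _ → [] } ; basis-length = ≡.refl
  ; index = (λ _ → []) , (λ _ → [] , [] , λ ()) , (λ { Fin.zero Fin.zero _ → ≡.refl }) , λ _ _ → Fin.zero , [] , [] , λ () }
  where
  ones : ∀ (B : List (Vecℤ 0)) → ∏ B (λ _ → 1) ≡ 1
  ones []      = ≡.refl
  ones (b ∷ B) = ≡.trans (ℕ.*-identityˡ _) (ones B)

structure : ∀ {n} (B : List (Vecℤ n)) → Short B → Structure B
structure {zero}  B short = structure-point B
structure {suc n} B short with column B short
... | zeros heads                  = structure-zeros heads (structure (map Vec.tail B) (tail-short short))
... | pivot a v b₀∈B a∣ shape      = structure-pivot b₀∈B a∣ shape (structure (map (reduce (a ∷ v)) B) (reduce-short b₀∈B shape short))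

-- The same elimination, but the pivot is now deleted, since its reduction is a zero row and would
-- spoil independence. Each pivot lowers the length and the dimension by one, so the exponent of q
-- is n - length S. In dimension zero a nonempty list is dependent.
independent-count : ∀ {n} (S : List (Vecℤ n)) → Short S → Independent S → length S ℕ.≤ n ×
  ∃ λ μ → ∀ s .{{_ : ℕ.NonZero s}} → solutions (2 ℕ.* s) S ≡ μ ℕ.* (2 ℕ.* s) ℕ.^ (n ∸ length S)
independent-count {zero} []      short ind = z≤n , 1 , λ s → ≡.refl
independent-count {zero} (b ∷ S) short ind with ind (map (1ℚ ,_) (b ∷ S)) (vectors≡ (b ∷ S)) (λ ())
  where
  vectors≡ : ∀ {n} (S : List (Vecℤ n)) → Qc.vectors (map (1ℚ ,_) S) ≡ S
  vectors≡ []      = ≡.refl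
  vectors≡ (b ∷ S) = ≡.cong (b ∷_) (vectors≡ S)
... | () ∷ _
independent-count {suc n} S short ind with column S short
... | zeros heads
  with len , μ , count ← independent-count (map Vec.tail S) (tail-short short) (independent-tail S heads ind)
  rewrite List.length-map Vec.tail S =
    ℕ.m≤n⇒m≤1+n len , μ , λ s → ≡.trans (solutions-zero-column (2 ℕ.* s) S heads)
      (≡.trans (≡.cong (2 ℕ.* s ℕ.*_) (count s)) (zeros-power μ (2 ℕ.* s) len))
... | pivot a v b₀∈S a∣ shape with S⁻ , ins ← ∈⇒insertion b₀∈S
  with len , μ , count ← independent-count (map (reduce (a ∷ v)) S⁻)
        (λ c c∈ → reduce-short b₀∈S shape short c (insertion-∈ (insertion-map _ ins) c∈)) (independent-reduce shape ins ind)
  rewrite List.length-map (reduce (a ∷ v)) S⁻ | insertion-length ins =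
    s≤s len , ℤ.∣ a ∣ ℕ.* μ , λ s → ≡.trans
      (solutions-pivot (2 ℕ.* s) a v ℤ.∣ a ∣ b₀∈S (shape-a²v shape) a∣ (shape-count shape s))
      (≡.trans (≡.cong (ℤ.∣ a ∣ ℕ.*_) (≡.trans (solutions-zero-row (reduce-pivot shape) (insertion-map (reduce (a ∷ v)) ins)) (count s)))
        (≡.sym (ℕ.*-assoc ℤ.∣ a ∣ μ _)))

-- Comparison with the rank and index of the statement

lookup-lincombℚ : ∀ {n} (B : List (Vecℤ n)) c i → lookup (lincombℚ B c) i ≡ Qc.comb (Qc.weights B c) (coord i)
lookup-lincombℚ []      c i = Vec.lookup-replicate i 0ℚ
lookup-lincombℚ (b ∷ B) c i = ≡.trans (Vec.lookup-zipWith ℚ._+_ i (Vec.map _ b) _)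
  (≡.cong₂ ℚ._+_ (Vec.lookup-map i _ b) (lookup-lincombℚ B (c ∘ Fin.suc) i))

lookup-lincombℤ : ∀ {n} (B : List (Vecℤ n)) c i → lookup (lincombℤ B c) i ≡ Zc.comb (Zc.weights B c) (coord i)
lookup-lincombℤ []      c i = Vec.lookup-replicate i ℤ.0ℤ
lookup-lincombℤ (b ∷ B) c i = ≡.trans (Vec.lookup-zipWith ℤ._+_ i (Vec.map _ b) _)
  (≡.cong₂ ℤ._+_ (Vec.lookup-map i _ b) (lookup-lincombℤ B (c ∘ Fin.suc) i))

vec-ext : ∀ {A : Set} {n} (u v : Vec A n) → (∀ i → lookup u i ≡ lookup v i) → u ≡ v
vec-ext []      []      h = ≡.refl
vec-ext (x ∷ u) (y ∷ v) h = ≡.cong₂ _∷_ (h Fin.zero) (vec-ext u v (h ∘ Fin.suc))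

module _ {n} {B : List (Vecℤ n)} where
  inSpan⇒spans : ∀ {v} → InSpan B v → Qc.Spans B (λ k → toℚ (coord k v))
  inSpan⇒spans {v} (c , eq) = Qc.weights B c , Qc.weights-∈ B c , λ k →
    ≡.trans (≡.sym (lookup-lincombℚ B c k)) (≡.trans (≡.cong (λ u → lookup u k) eq) (Vec.lookup-map k toℚ v))

  spans⇒inSpan : ∀ {v} → Qc.Spans B (λ k → toℚ (coord k v)) → InSpan B v
  spans⇒inSpan {v} (ws , p , q) with c , h ← Qc.collect B ws p = c , vec-ext _ _ λ k →
    ≡.trans (lookup-lincombℚ B c k) (≡.trans (h (coord k)) (≡.trans (q k) (≡.sym (Vec.lookup-map k toℚ v))))

  inLattice⇒spans : ∀ {v} → InLattice B v → Zc.Spans B (λ k → coord k v)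
  inLattice⇒spans (c , eq) = Zc.weights B c , Zc.weights-∈ B c , λ k →
    ≡.trans (≡.sym (lookup-lincombℤ B c k)) (≡.cong (λ u → lookup u k) eq)

  spans⇒inLattice : ∀ {v} → Zc.Spans B (λ k → coord k v) → InLattice B v
  spans⇒inLattice (ws , p , q) with c , h ← Zc.collect B ws p = c , vec-ext _ _ λ k →
    ≡.trans (lookup-lincombℤ B c k) (≡.trans (h (coord k)) (q k))

  index⇒isIndex : ∀ {m} → LatticeIndex B m → IsIndex B m
  index⇒isIndex (f , in-span , distinct , cover) = f , (λ i → spans⇒inSpan (in-span i))
    , (λ i j l → distinct i j (Zc.spans-cong (λ k → Vec.lookup-zipWith ℤ._-_ k (f i) (f j)) (inLattice⇒spans l)))
    , λ v s → let i , l = cover v (inSpan⇒spans s) in i , spans⇒inLattice (Zc.spans-cong (λ k → ≡.sym (Vec.lookup-zipWith ℤ._-_ k v (f i))) l)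

  linIndep⇒independent : LinIndep B → Independent B
  linIndep⇒independent li ws ≡.refl vanish with c , eq , back ← Qc.weights-all ws = back (li c (vec-ext _ _ λ k →
    ≡.trans (lookup-lincombℚ B c k) (≡.trans (≡.cong (λ ws → Qc.comb ws (coord k)) eq) (≡.trans (vanish k) (≡.sym (Vec.lookup-replicate k 0ℚ))))))

  independent⇒linIndep : Independent B → LinIndep B
  independent⇒linIndep ind c eq = Qc.weights-zero B c (ind (Qc.weights B c) (Qc.weights-vectors B c) λ k →
    ≡.trans (≡.sym (lookup-lincombℚ B c k)) (≡.trans (≡.cong (λ u → lookup u k) eq) (Vec.lookup-replicate k 0ℚ)))

  spans-sub : ∀ {u w} → Zc.Spans B u → Zc.Spans B w → Zc.Spans B (λ k → u k ℤ.- w k)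
  spans-sub (ws , p , q) (ws′ , p′ , q′) = ws ++ negate ws′ , all++ ws p (allNeg ws′ p′)
    , λ k → ≡.trans (comb++ ws (negate ws′) (coord k)) (≡.cong₂ ℤ._+_ (q k) (≡.trans (combNeg ws′ (coord k)) (≡.cong (ℤ.-_) (q′ k))))
    where
    negate : Zc.Weighted n → Zc.Weighted n
    negate = map λ (c , b) → ℤ.- c , b
    all++ : ∀ ws {ws′} → All (λ w → proj₂ w ∈ B) ws → All (λ w → proj₂ w ∈ B) ws′ → All (λ w → proj₂ w ∈ B) (ws ++ ws′)
    all++ []       []       qs = qs
    all++ (w ∷ ws) (p ∷ ps) qs = p ∷ all++ ws ps qs
    allNeg : ∀ ws → All (λ w → proj₂ w ∈ B) ws → All (λ w → proj₂ w ∈ B) (negate ws)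
    allNeg []       []       = []
    allNeg (w ∷ ws) (p ∷ ps) = p ∷ allNeg ws ps
    comb++ : ∀ ws ws′ g → Zc.comb (ws ++ ws′) g ≡ Zc.comb ws g ℤ.+ Zc.comb ws′ g
    comb++ []             ws′ g = ≡.sym (ℤ.+-identityˡ _)
    comb++ ((c , b) ∷ ws) ws′ g = ≡.trans (≡.cong (ℤ._+_ (c ℤ.* g b)) (comb++ ws ws′ g)) (≡.sym (ℤ.+-assoc (c ℤ.* g b) _ _))
    combNeg : ∀ ws g → Zc.comb (negate ws) g ≡ ℤ.- Zc.comb ws g
    combNeg []             g = ≡.refl
    combNeg ((c , b) ∷ ws) g = ≡.trans (≡.cong₂ ℤ._+_ (≡.sym (ℤ.neg-distribˡ-* c (g b))) (combNeg ws g)) (≡.sym (ℤ.neg-distrib-+ (c ℤ.* g b) _))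

  inLattice-difference : ∀ {u v w} → InLattice B (u -v w) → InLattice B (v -v w) → InLattice B (u -v v)
  inLattice-difference {u} {v} {w} l l′ = spans⇒inLattice (Zc.spans-cong eq (spans-sub (inLattice⇒spans {v = u -v w} l) (inLattice⇒spans {v = v -v w} l′)))
    where
    cancel : ∀ u v w → (u ℤ.- w) ℤ.- (v ℤ.- w) ≡ u ℤ.- v
    cancel = solveℤ
    eq : ∀ k → coord k (u -v w) ℤ.- coord k (v -v w) ≡ coord k (u -v v)
    eq k = ≡.trans (≡.cong₂ ℤ._-_ (Vec.lookup-zipWith ℤ._-_ k u w) (Vec.lookup-zipWith ℤ._-_ k v w))
      (≡.trans (cancel (coord k u) (coord k v) (coord k w)) (≡.sym (Vec.lookup-zipWith ℤ._-_ k u v)))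

  -- Send each representative of the first system to the one of its coset in the second. Two with
  -- the same image differ by a lattice vector, hence are equal, so the map is injective.
  index-≤ : ∀ {m m′} → IsIndex B m → IsIndex B m′ → m ℕ.≤ m′
  index-≤ (f , in-span , distinct , _) (f′ , _ , _ , cover) = Fin.injective⇒≤ {f = λ i → proj₁ (cover (f i) (in-span i))}
    λ {i} {j} eq → distinct i j (inLattice-difference (proj₂ (cover (f i) (in-span i)))
      (≡.subst (λ k → InLattice B (f j -v f′ k)) (≡.sym eq) (proj₂ (cover (f j) (in-span j)))))

  index-unique : ∀ {m m′} → IsIndex B m → IsIndex B m′ → m ≡ m′
  index-unique p q = ℕ.≤-antisym (index-≤ p q) (index-≤ q p)

-- Growth in q, tested at the single even number q = 2 (μ′ + 1), which exceeds μ′. If ρ < k, then μ′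
-- qⁿ⁻ᵏ < qⁿ⁻ᵏ⁺¹ ≤ qⁿ⁻ᵖ ≤ μ qⁿ⁻ᵖ with p = ρ, against the assumed inequality.
exponent-≤ : ∀ {n ρ k μ μ′} → k ℕ.≤ n → 0 ℕ.< μ →
             (∀ s .{{_ : ℕ.NonZero s}} → μ ℕ.* (2 ℕ.* s) ℕ.^ (n ∸ ρ) ℕ.≤ μ′ ℕ.* (2 ℕ.* s) ℕ.^ (n ∸ k)) → k ℕ.≤ ρ
exponent-≤ {n} {ρ} {k} {μ} {μ′} k≤n μ>0 h = ℕ.≮⇒≥ λ ρ<k → ℕ.<-irrefl ≡.refl (begin-strict
  q ℕ.^ (n ∸ ρ) ≡⟨ ℕ.*-identityˡ _ ⟨
  1 ℕ.* q ℕ.^ (n ∸ ρ) ≤⟨ ℕ.*-monoˡ-≤ (q ℕ.^ (n ∸ ρ)) μ>0 ⟩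
  μ ℕ.* q ℕ.^ (n ∸ ρ) ≤⟨ h (suc μ′) ⟩
  μ′ ℕ.* q ℕ.^ (n ∸ k) <⟨ ℕ.*-monoˡ-< (q ℕ.^ (n ∸ k)) {{ℕ.m^n≢0 q (n ∸ k)}} (ℕ.m≤m+n (suc μ′) _) ⟩
  q ℕ.^ suc (n ∸ k) ≤⟨ ℕ.^-monoʳ-≤ q (ℕ.∸-monoʳ-< ρ<k k≤n) ⟩
  q ℕ.^ (n ∸ ρ) ∎)
  where
  open ℕ.≤-Reasoning
  q : ℕ
  q = 2 ℕ.* suc μ′

-- The basis found by elimination gives one inequality. For the other, an independent sublist S of B
-- imposes fewer conditions, so it has at least as many solutions as B, and comparing the two counts
-- gives length S ≤ ρ. This takes the place of an exchange argument.
rank-unique : ∀ {n} {B : List (Vecℤ n)} {r} → Short B → IsRank B r → (st : Structure B) → r ≡ Structure.ρ st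
rank-unique {n} {B} short ((S , S∈ , S-indep , ≡.refl) , max) st = ℕ.≤-antisym upper
  (≡.subst (ℕ._≤ _) basis-length (max basis (⊆⇒∈-sublists basis⊆) (independent⇒linIndep basis-indep)))
  where
  open Structure st
  S⊆B : S ⊆ B
  S⊆B = ∈-sublists⇒⊆ B S∈
  upper : length S ℕ.≤ ρ
  upper with len , μ′ , count ← independent-count S (⊆-short S⊆B short) (linIndep⇒independent S-indep) =
    exponent-≤ {μ = μ} {μ′} len μ>0 λ s → ≡.subst₂ ℕ._≤_ (solutions-count s) (count s) (solutions-⊆ S⊆B)

solutions-formula : ∀ {n} {B : List (Vecℤ n)} {r m} → Short B → IsRank B r → IsIndex B m → r ℕ.≤ n ×
  (∀ s .{{_ : ℕ.NonZero s}} → solutions (2 ℕ.* s) B ≡ m ℕ.* (2 ℕ.* s) ℕ.^ (n ∸ r))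
solutions-formula {n} {B} short isRank isIndex
  rewrite rank-unique short isRank (structure B short)
        | index-unique {B = B} isIndex (index⇒isIndex (Structure.index (structure B short))) = ρ≤n , solutions-count
  where open Structure (structure B short)

-- Weighted colourings

module CoordinateProducts (R : CommutativeSemiring 0ℓ 0ℓ) where
  open CommutativeSemiring R
  private module RC = Cube R
  open SetoidReasoning setoid
  open Exponentiation semiring using (_^_; ^-congˡ)
  open CommutativeSemigroupProperties *-commutativeSemigroup using (interchange)

  prodV : ∀ {n} → Vecℤ n → (ℤ → Carrier) → Carrier
  prodV []      f = 1#
  prodV (c ∷ p) f = f c * prodV p f

  pairProduct : (ℤ → ℤ → Carrier) → ∀ {n} → Vecℤ n → Carrier
  pairProduct g []      = 1#
  pairProduct g (c ∷ p) = prodV p (g c) * pairProduct g p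

  prodV-* : ∀ {n} (p : Vecℤ n) f g → prodV p (λ c → f c * g c) ≈ prodV p f * prodV p g
  prodV-* []      f g = sym (*-identityˡ 1#)
  prodV-* (c ∷ p) f g = trans (*-congˡ (prodV-* p f g)) (interchange (f c) (g c) (prodV p f) (prodV p g))

  prodV-cong : ∀ {n} (p : Vecℤ n) {f f′} → (∀ d → f d ≈ f′ d) → prodV p f ≈ prodV p f′
  prodV-cong []      e = refl
  prodV-cong (d ∷ p) e = *-cong (e d) (prodV-cong p e)

  prodV-one : ∀ {n} (p : Vecℤ n) → prodV p (λ _ → 1#) ≈ 1#
  prodV-one []      = refl
  prodV-one (c ∷ p) = trans (*-identityˡ _) (prodV-one p)

  pairProduct-* : ∀ f g {n} (p : Vecℤ n) → pairProduct (λ c d → f c d * g c d) p ≈ pairProduct f p * pairProduct g p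
  pairProduct-* f g []      = sym (*-identityˡ 1#)
  pairProduct-* f g (c ∷ p) = trans (*-cong (prodV-* p (f c) (g c)) (pairProduct-* f g p)) (interchange _ _ _ _)

  cube-prodV : ∀ q n f → RC.cube q n (λ p → prodV p f) ≈ RC.range q (f ∘ ℤ.+_) ^ n
  cube-prodV q zero    f = refl
  cube-prodV q (suc n) f = begin
    RC.range q (λ c → RC.cube q n (λ p → f (ℤ.+ c) * prodV p f)) ≈⟨ RC.range-cong q (λ c _ → trans (RC.cube-*ˡ q n _ _) (trans (*-congˡ (cube-prodV q n f)) (*-comm _ _))) ⟩
    RC.range q (λ c → Σᶠ ^ n * f (ℤ.+ c)) ≈⟨ RC.range-*ˡ q (Σᶠ ^ n) (f ∘ ℤ.+_) ⟩
    Σᶠ ^ n * Σᶠ ≈⟨ *-comm _ _ ⟩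
    Σᶠ ^ suc n ∎
    where
    Σᶠ : Carrier
    Σᶠ = RC.range q (f ∘ ℤ.+_)

  prodF : ∀ n → (Fin n → Carrier) → Carrier
  prodF zero    f = 1#
  prodF (suc n) f = f Fin.zero * prodF n (f ∘ Fin.suc)

  prodF-cong : ∀ n {f g : Fin n → Carrier} → (∀ i → f i ≈ g i) → prodF n f ≈ prodF n g
  prodF-cong zero    h = refl
  prodF-cong (suc n) h = *-cong (h Fin.zero) (prodF-cong n (h ∘ Fin.suc))

  prodF-lookup : ∀ {n} (p : Vecℤ n) f → prodF n (λ i → f (lookup p i)) ≈ prodV p f
  prodF-lookup []      f = refl
  prodF-lookup (c ∷ p) f = *-congˡ (prodF-lookup p f)

  ∏-tabulate : ∀ {A : Set} n (h : Fin n → A) f → RC.∏ (List.tabulate h) f ≈ prodF n (f ∘ h)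
  ∏-tabulate zero    h f = refl
  ∏-tabulate (suc n) h f = *-congˡ (∏-tabulate n (h ∘ Fin.suc) f)

  ∏-concatMap : ∀ {A B : Set} (h : A → List B) xs f → RC.∏ (concatMap h xs) f ≈ RC.∏ xs (λ x → RC.∏ (h x) f)
  ∏-concatMap h []       f = refl
  ∏-concatMap h (x ∷ xs) f = trans (RC.∏-++ (h x) (concatMap h xs) f) (*-congˡ (∏-concatMap h xs f))

  ∏-pairs : ∀ {n} (p : Vecℤ n) G → RC.∏ (pairs n) (λ (i , j) → G (lookup p i) (lookup p j)) ≈ pairProduct G p
  ∏-pairs {n} p G = begin
    RC.∏ (pairs n) F
      ≈⟨ ∏-concatMap _ (allFin n) F ⟩
    RC.∏ (allFin n) (λ i → RC.∏ (concatMap (λ j → if Fin.toℕ i ℕ.<ᵇ Fin.toℕ j then (i , j) ∷ [] else []) (allFin n)) F)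
      ≈⟨ ∏-tabulate n (λ i → i) _ ⟩
    prodF n (λ i → RC.∏ (concatMap (λ j → if Fin.toℕ i ℕ.<ᵇ Fin.toℕ j then (i , j) ∷ [] else []) (allFin n)) F)
      ≈⟨ prodF-cong n (λ i → trans (∏-concatMap _ (allFin n) F) (trans (∏-tabulate n (λ j → j) _) (prodF-cong n (single i)))) ⟩
    prodF n (λ i → prodF n (λ j → entry G p i j))
      ≈⟨ triangle p ⟩
    pairProduct G p ∎
    where
    F : Fin n × Fin n → Carrier
    F (i , j) = G (lookup p i) (lookup p j)
    entry : (ℤ → ℤ → Carrier) → ∀ {n} → Vecℤ n → Fin n → Fin n → Carrier
    entry G p i j = if Fin.toℕ i ℕ.<ᵇ Fin.toℕ j then G (lookup p i) (lookup p j) else 1#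
    single : ∀ i j → RC.∏ (if Fin.toℕ i ℕ.<ᵇ Fin.toℕ j then (i , j) ∷ [] else []) F ≈ entry G p i j
    single i j with Fin.toℕ i ℕ.<ᵇ Fin.toℕ j
    ... | true  = *-identityʳ _
    ... | false = refl
    triangle : ∀ {n} (p : Vecℤ n) → prodF n (λ i → prodF n (λ j → entry G p i j)) ≈ pairProduct G p
    triangle []      = refl
    triangle {suc n} (c ∷ p) = *-cong (trans (*-identityˡ _) (prodF-lookup p (G c)))
      (trans (prodF-cong n (λ i → *-identityˡ _)) (triangle p))

module WeightedColourings (R : CommutativeRing 0ℓ 0ℓ) where
  open CommutativeRing R
  open RingExtras R
  open Hurwitz R
  open SetoidReasoning setoid
  open Exponentiation semiring using (_^_; ^-congˡ; ^-congʳ; ^-homo-*)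
  module RC = Cube commutativeSemiring
  open CoordinateProducts commutativeSemiring using (prodV; pairProduct; prodV-*; prodV-cong)
  module HC = Cube HR.commutativeSemiring
  private module S = SemiringSolver commutativeSemiring

  -- The deformed exponential F(αZ, β), as an exponential series in Z.
  dexp : Carrier → Carrier → H
  dexp α β n = α ^ n * β ^ (n choose 2)

  ^-distrib : ∀ x y n → (x * y) ^ n ≈ x ^ n * y ^ n
  ^-distrib x y zero    = sym (*-identityˡ 1#)
  ^-distrib x y (suc n) = trans (*-congˡ (^-distrib x y n)) (interchange x y (x ^ n) (y ^ n))
    where open CommutativeSemigroupProperties *-commutativeSemigroup using (interchange)

  ^-cong : ∀ {x y} n → x ≈ y → x ^ n ≈ y ^ n
  ^-cong n p = ^-congˡ n p

  dexp-cong : ∀ {α α′ β β′} → α ≈ α′ → β ≈ β′ → dexp α β ≋ dexp α′ β′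
  dexp-cong p q n = *-cong (^-cong n p) (^-cong (n choose 2) q)

  suc-C-2 : ∀ n → suc n choose 2 ≡ n ℕ.+ n choose 2
  suc-C-2 n = ≡.trans (≡.sym (nCk+nC[k+1]≡[n+1]C[k+1] n 1)) (≡.cong (ℕ._+ n choose 2) (nC1≡n n))

  -- The derivative of F(αZ, β) in Z is α F(αβZ, β): taking one element out of a block of n + 1
  -- removes n pairs, and the lost factor βⁿ turns α into αβ.
  D-dexp : ∀ α β → D (dexp α β) ≋ const α ⋆ dexp (α * β) β
  D-dexp α β n = begin
    α * α ^ n * β ^ (suc n choose 2) ≡⟨ ≡.cong (λ m → α * α ^ n * β ^ m) (suc-C-2 n) ⟩
    α * α ^ n * β ^ (n ℕ.+ n choose 2) ≈⟨ *-congˡ (^-homo-* β n (n choose 2)) ⟩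
    α * α ^ n * (β ^ n * β ^ (n choose 2))
      ≈⟨ S.solve 4 (λ a x y z → a S.:* x S.:* (y S.:* z) S.:= a S.:* (x S.:* y S.:* z)) refl α (α ^ n) (β ^ n) (β ^ (n choose 2)) ⟩
    α * (α ^ n * β ^ n * β ^ (n choose 2)) ≈⟨ *-congˡ (*-congʳ (^-distrib α β n)) ⟨
    α * dexp (α * β) β n ≈⟨ const-⋆ α (dexp (α * β) β) n ⟨
    (const α ⋆ dexp (α * β) β) n ∎

  classProduct : ℕ → (ℕ → H) → H
  classProduct zero    F = const 1#
  classProduct (suc k) F = F 0 ⋆ classProduct k (F ∘ suc)

  classProduct-cong : ∀ k {F G} → (∀ κ → κ ℕ.< k → F κ ≋ G κ) → classProduct k F ≋ classProduct k G
  classProduct-cong zero    h = HR.refl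
  classProduct-cong (suc k) h = HR.*-cong (h 0 (s≤s z≤n)) (classProduct-cong k λ κ κ<k → h (suc κ) (s≤s κ<k))

  classProduct-power : ∀ s {F E J} → (∀ κ → κ ℕ.< s → F κ ≋ E) → F s ≋ J → classProduct (suc s) F ≋ E ^⋆ s ⋆ J
  classProduct-power zero    {F} {E} {J} h p = HR.trans (HR.*-identityʳ (F 0)) (HR.trans p (HR.sym (HR.*-identityˡ J)))
  classProduct-power (suc s) {F} {E} {J} h p = HR.trans
    (HR.*-cong (h 0 (s≤s z≤n)) (classProduct-power s (λ κ κ<s → h (suc κ) (s≤s κ<s)) p)) (HR.sym (HR.*-assoc E (E ^⋆ s) J))

  -- The effect of reading one coordinate of class κ: each later coordinate of that class gains the
  -- factor β κ.
  update : (ℕ → Carrier) → ℕ → (ℕ → Carrier) → ℕ → Carrier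
  update β κ α κ′ = if κ ℕ.≡ᵇ κ′ then α κ′ * β κ′ else α κ′

  D-classProduct : ∀ k (α β : ℕ → Carrier) → D (classProduct k λ κ → dexp (α κ) (β κ)) ≋
    HC.range k λ κ → const (α κ) ⋆ classProduct k λ κ′ → dexp (update β κ α κ′) (β κ′)
  D-classProduct zero    α β = HR.refl
  D-classProduct (suc k) α β = HR.+-cong
    (HR.trans (HR.*-congʳ {P} (D-dexp (α 0) (β 0))) (HR.*-assoc (const (α 0)) (dexp (α 0 * β 0) (β 0)) P))
    (HR.trans (HR.*-congˡ {F₀} (D-classProduct k (α ∘ suc) (β ∘ suc)))
      (HR.trans (HR.sym (HC.range-*ˡ k F₀ _))
        (HC.range-cong k λ κ _ → x∙yz≈y∙xz F₀ (const (α (suc κ))) _)))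
    where
    open CommutativeSemigroupProperties HR.*-commutativeSemigroup using (x∙yz≈y∙xz)
    F₀ P : H
    F₀ = dexp (α 0) (β 0)
    P  = classProduct k λ κ → dexp (α (suc κ)) (β (suc κ))

  range-coeff : ∀ k (f : ℕ → H) n → HC.range k f n ≈ RC.range k (λ κ → f κ n)
  range-coeff zero    f n = refl
  range-coeff (suc k) f n = +-congˡ (range-coeff k (f ∘ suc) n)

  classProduct-suc : ∀ k (α β : ℕ → Carrier) n → classProduct k (λ κ → dexp (α κ) (β κ)) (suc n) ≈
    RC.range k λ κ → α κ * classProduct k (λ κ′ → dexp (update β κ α κ′) (β κ′)) n
  classProduct-suc k α β n = trans (D-classProduct k α β n)
    (trans (range-coeff k _ n) (RC.range-cong k λ κ _ → const-⋆ (α κ) (classProduct k λ κ′ → dexp (update β κ α κ′) (β κ′)) n))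

  classProduct-zero : ∀ k (α β : ℕ → Carrier) → classProduct k (λ κ → dexp (α κ) (β κ)) 0 ≈ 1#
  classProduct-zero zero    α β = refl
  classProduct-zero (suc k) α β = trans (*-cong (*-identityˡ 1#) (classProduct-zero k (α ∘ suc) (β ∘ suc))) (*-identityˡ 1#)

  module _ (s : ℤ → Carrier) (g : ℤ → ℤ → Carrier) where

    -- the weight of a colouring, read off one coordinate at a time: h d is the
    -- interaction of a further coordinate d with those already read
    weight : (ℤ → Carrier) → ∀ {n} → Vecℤ n → Carrier
    weight h []      = 1#
    weight h (c ∷ p) = s c * h c * weight (λ d → h d * g c d) p

    weight-product : ∀ h {n} (p : Vecℤ n) → weight h p ≈ prodV p (λ c → s c * h c) * pairProduct g p
    weight-product h []      = sym (*-identityˡ 1#)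
    weight-product h (c ∷ p) = begin
      x * weight (λ d → h d * g c d) p ≈⟨ *-congˡ (weight-product _ p) ⟩
      x * (prodV p (λ d → s d * (h d * g c d)) * pairProduct g p) ≈⟨ *-congˡ (*-congʳ (trans (prodV-cong p λ d → sym (*-assoc _ _ _)) (prodV-* p _ _))) ⟩
      x * (prodV p (λ d → s d * h d) * prodV p (g c) * pairProduct g p)
        ≈⟨ S.solve 4 (λ x a b c → x S.:* (a S.:* b S.:* c) S.:= x S.:* a S.:* (b S.:* c)) refl _ _ _ _ ⟩
      x * prodV p (λ d → s d * h d) * (prodV p (g c) * pairProduct g p) ∎
      where
      x : Carrier
      x = s c * h c

    module _ (q k : ℕ) (class : ℕ → ℕ) (size σ β : ℕ → Carrier)
      (class-range : ∀ (f : ℕ → Carrier) → RC.range q (f ∘ class) ≈ RC.range k (λ κ → size κ * f κ))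
      (s-class : ∀ c → c ℕ.< q → s (ℤ.+ c) ≈ σ (class c))
      (g-class : ∀ c d → c ℕ.< q → d ℕ.< q → g (ℤ.+ c) (ℤ.+ d) ≈ (if class c ℕ.≡ᵇ class d then β (class c) else 1#)) where

      -- Both sides obey one recursion in n. On the left the first coordinate is summed over all
      -- residues, size κ of them in class κ, and changes the weights of later coordinates by
      -- `update`; on the right the Leibniz rule differentiates one class factor at a time. The
      -- weights γ must be arbitrary because the recursion changes them.
      sum-weight : ∀ n (h : ℤ → Carrier) (γ : ℕ → Carrier) → (∀ c → c ℕ.< q → h (ℤ.+ c) ≈ γ (class c)) →
        RC.cube q n (weight h) ≈ classProduct k (λ κ → dexp (size κ * (σ κ * γ κ)) (β κ)) n
      sum-weight zero    h γ hγ = sym (classProduct-zero k (λ κ → size κ * (σ κ * γ κ)) β)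
      sum-weight (suc n) h γ hγ = begin
        RC.range q (λ c → RC.cube q n (λ p → s (ℤ.+ c) * h (ℤ.+ c) * weight (λ d → h d * g (ℤ.+ c) d) p))
          ≈⟨ RC.range-cong q (λ c c<q → trans (RC.cube-*ˡ q n _ _) (*-cong (*-cong (s-class c c<q) (hγ c c<q))
               (sum-weight n (λ d → h d * g (ℤ.+ c) d) (update β (class c) γ) λ d d<q → next c d c<q d<q))) ⟩
        RC.range q (λ c → f (class c))
          ≈⟨ class-range f ⟩
        RC.range k (λ κ → size κ * f κ)
          ≈⟨ RC.range-cong k (λ κ _ → trans (sym (*-assoc _ _ _)) (*-congˡ (classProduct-cong k (λ κ′ _ → dexp-cong (move κ κ′) refl) n))) ⟩
        RC.range k (λ κ → α κ * classProduct k (λ κ′ → dexp (update β κ α κ′) (β κ′)) n)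
          ≈⟨ classProduct-suc k α β n ⟨
        classProduct k (λ κ → dexp (α κ) (β κ)) (suc n) ∎
        where
        α f : ℕ → Carrier
        α κ = size κ * (σ κ * γ κ)
        f κ = σ κ * γ κ * classProduct k (λ κ′ → dexp (size κ′ * (σ κ′ * update β κ γ κ′)) (β κ′)) n
        next : ∀ c d → c ℕ.< q → d ℕ.< q → h (ℤ.+ d) * g (ℤ.+ c) (ℤ.+ d) ≈ update β (class c) γ (class d)
        next c d c<q d<q = trans (*-cong (hγ d d<q) (g-class c d c<q d<q)) (merge (class c) (class d))
          where
          merge : ∀ κ κ′ → γ κ′ * (if κ ℕ.≡ᵇ κ′ then β κ else 1#) ≈ update β κ γ κ′
          merge κ κ′ with κ ℕ.≡ᵇ κ′ | ℕ.≡ᵇ⇒≡ κ κ′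
          ... | true  | eq = *-congˡ (reflexive (≡.cong β (eq _)))
          ... | false | _  = *-identityʳ _
        move : ∀ κ κ′ → size κ′ * (σ κ′ * update β κ γ κ′) ≈ update β κ α κ′
        move κ κ′ with κ ℕ.≡ᵇ κ′
        ... | true  = S.solve 4 (λ a b c d → a S.:* (b S.:* (c S.:* d)) S.:= a S.:* (b S.:* c) S.:* d) refl _ _ _ _
        ... | false = refl

-- Residues up to sign and the weights of the classical systems

module ClassicalSums (R : CommutativeRing 0ℓ 0ℓ) (Y : CommutativeRing.Carrier R) where
  open CommutativeRing R
  open RingExtras R
  open Hurwitz R
  open WeightedColourings R
  open SetoidReasoning setoid

  -- The factor of a root with value z at a point: Y if q divides z, and 1 otherwise. In this form a
  -- product of such factors expands into a sum over sublists with powers of Y - 1.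
  ω : ℕ → ℤ → Carrier
  ω q z = 1# + nat (δ q z) * (Y + - 1#)

  ω-δ : ∀ {q z z′} → δ q z ≡ δ q z′ → ω q z ≈ ω q z′
  ω-δ p = reflexive (≡.cong (λ d → 1# + nat d * (Y + - 1#)) p)

  ω-yes : ∀ {q z} → ℤ.+ q ∣ℤ z → ω q z ≈ Y
  ω-yes {q} {z} q∣z rewrite δ-yes q∣z = begin
    1# + (1# + 0#) * (Y + - 1#) ≈⟨ +-congˡ (trans (*-congʳ (+-identityʳ 1#)) (*-identityˡ _)) ⟩
    1# + (Y + - 1#) ≈⟨ +-comm _ _ ⟩
    (Y + - 1#) + 1# ≈⟨ trans (+-assoc _ _ _) (trans (+-congˡ (-‿inverseˡ 1#)) (+-identityʳ Y)) ⟩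
    Y ∎

  ω-no : ∀ {q z} → ¬ (ℤ.+ q ∣ℤ z) → ω q z ≈ 1#
  ω-no {q} {z} q∤z rewrite δ-no q∤z = trans (+-congˡ (zeroˡ _)) (+-identityʳ 1#)

  private
    divisible-difference : ∀ {q c d} → c ℕ.< q → d ℕ.< q → ℤ.+ q ∣ℤ (ℤ.+ c ℤ.- ℤ.+ d) → c ≡ d
    divisible-difference {q} {c} {d} c<q d<q = residues-distinct {ℤ.+ q} c d c<q d<q

  ≡ᵇ-refl : ∀ n → (n ℕ.≡ᵇ n) ≡ true
  ≡ᵇ-refl zero    = ≡.refl
  ≡ᵇ-refl (suc n) = ≡ᵇ-refl n

  typeA : ∀ q n → RC.cube q n (weight (λ _ → 1#) (λ c d → ω q (c ℤ.- d)) (λ _ → 1#)) ≈ (dexp 1# Y ^⋆ q) n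
  typeA q n = begin
    RC.cube q n (weight (λ _ → 1#) (λ c d → ω q (c ℤ.- d)) (λ _ → 1#))
      ≈⟨ sum-weight (λ _ → 1#) (λ c d → ω q (c ℤ.- d)) q q (λ c → c) (λ _ → 1#) (λ _ → 1#) (λ _ → Y)
           (λ f → RC.range-cong q λ _ _ → sym (*-identityˡ _)) (λ _ _ → refl) same n (λ _ → 1#) (λ _ → 1#) (λ _ _ → refl) ⟩
    classProduct q (λ κ → dexp (1# * (1# * 1#)) Y) n
      ≈⟨ power q n ⟩
    (dexp 1# Y ^⋆ q) n ∎
    where
    power : ∀ q → classProduct q (λ κ → dexp (1# * (1# * 1#)) Y) ≋ dexp 1# Y ^⋆ q
    power zero    = HR.refl
    power (suc q) = HR.*-cong (dexp-cong (trans (*-identityˡ _) (*-identityˡ _)) refl) (power q)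
    same : ∀ c d → c ℕ.< q → d ℕ.< q → ω q (ℤ.+ c ℤ.- ℤ.+ d) ≈ (if c ℕ.≡ᵇ d then Y else 1#)
    same c d c<q d<q with c ℕ.≟ d
    ... | yes ≡.refl rewrite ≡ᵇ-refl c = ω-yes {q} (ℤ∣.divides ℤ.0ℤ (ℤ.+-inverseʳ (ℤ.+ c)))
    ... | no c≢d with c ℕ.≡ᵇ d | ℕ.≡ᵇ⇒≡ c d
    ... | true  | eq = contradiction (eq _) c≢d
    ... | false | _  = ω-no (c≢d ∘ divisible-difference c<q d<q)

  module Folded (s q : ℕ) (q≡ : q ≡ suc (suc s) ℕ.+ s) where
    q≡1+s+1+s : q ≡ suc s ℕ.+ suc s
    q≡1+s+1+s = ≡.trans q≡ (≡.cong suc (≡.sym (ℕ.+-suc s s)))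

    -- representatives of ℤ/q modulo negation: 0, …, s + 1
    class : ℕ → ℕ
    class c = c ℕ.⊓ (q ∸ c)

    -- Only 0 and s + 1 = q/2 are their own negatives modulo q; each of the s classes between them
    -- has two residues.
    size : ℕ → Carrier
    size zero    = 1#
    size (suc κ) = if κ ℕ.<ᵇ s then nat 2 else 1#

    class-small : ∀ c → c ℕ.< suc (suc s) → class c ≡ c
    class-small c (s≤s c≤1+s) = ℕ.m≤n⇒m⊓n≡m (ℕ.≤-trans c≤1+s (ℕ.≤-trans (ℕ.≤-reflexive (≡.sym (≡.trans (≡.cong (_∸ suc s) q≡1+s+1+s) (ℕ.m+n∸n≡m (suc s) (suc s)))))
      (ℕ.∸-monoʳ-≤ q c≤1+s)))

    class-large : ∀ j → class (suc (suc s) ℕ.+ j) ≡ s ∸ j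
    class-large j = ≡.trans (≡.cong (ℕ._⊓_ (suc (suc s) ℕ.+ j)) eq) (ℕ.m≥n⇒m⊓n≡n (ℕ.≤-trans (ℕ.m∸n≤m s j) (ℕ.≤-trans (ℕ.m≤n+m s 2) (ℕ.m≤m+n (suc (suc s)) j))))
      where
      eq : q ∸ (suc (suc s) ℕ.+ j) ≡ s ∸ j
      eq = ≡.trans (≡.cong (_∸ (suc (suc s) ℕ.+ j)) q≡) (ℕ.[m+n]∸[m+o]≡n∸o (suc (suc s)) s j)

    size-inner : ∀ {κ} → κ ℕ.< s → size (suc κ) ≡ nat 2
    size-inner {κ} κ<s with κ ℕ.<ᵇ s | ℕ.<⇒<ᵇ κ<s
    ... | true | _ = ≡.refl

    size-last : size (suc s) ≡ 1#
    size-last with s ℕ.<ᵇ s | ℕ.<ᵇ⇒< s s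
    ... | true  | lt = contradiction (lt _) (ℕ.<-irrefl ≡.refl)
    ... | false | _  = ≡.refl

    range-reverse : ∀ m (f : ℕ → Carrier) → RC.range m (λ j → f (m ∸ j)) ≈ RC.range m (f ∘ suc)
    range-reverse zero    f = refl
    range-reverse (suc m) f = trans (+-congˡ (range-reverse m f)) (trans (+-comm _ _) (sym (RC.range-snoc m (f ∘ suc))))

    -- The residues 0, ..., s + 1 meet every class once, and those beyond run backwards through the
    -- classes s, ..., 1.
    class-range : ∀ (f : ℕ → Carrier) → RC.range q (f ∘ class) ≈ RC.range (suc (suc s)) (λ κ → size κ * f κ)
    class-range f = begin
      RC.range q (f ∘ class) ≡⟨ ≡.cong (λ m → RC.range m (f ∘ class)) q≡ ⟩
      RC.range (suc (suc s) ℕ.+ s) (f ∘ class) ≈⟨ RC.range-split (suc (suc s)) s (f ∘ class) ⟩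
      RC.range (suc (suc s)) (f ∘ class) + RC.range s (λ j → f (class (suc (suc s) ℕ.+ j)))
        ≈⟨ +-cong (RC.range-cong (suc (suc s)) λ c c< → reflexive (≡.cong f (class-small c c<)))
                  (trans (RC.range-cong s λ j _ → reflexive (≡.cong f (class-large j))) (range-reverse s f)) ⟩
      f 0 + RC.range (suc s) (f ∘ suc) + Σ′ ≈⟨ +-congʳ (+-congˡ (RC.range-snoc s (f ∘ suc))) ⟩
      f 0 + (Σ′ + f (suc s)) + Σ′
        ≈⟨ S.solve 3 (λ a b c → a S.:+ (b S.:+ c) S.:+ b S.:= S.con 1 S.:* a S.:+ ((S.con 1 S.:+ (S.con 1 S.:+ S.con 0)) S.:* b S.:+ S.con 1 S.:* c)) refl (f 0) Σ′ (f (suc s)) ⟩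
      1# * f 0 + (nat 2 * Σ′ + 1# * f (suc s))
        ≈⟨ +-congˡ (+-cong (sym (RC.range-*ˡ s (nat 2) (f ∘ suc))) (*-congʳ (reflexive (≡.sym size-last)))) ⟩
      1# * f 0 + (RC.range s (λ κ → nat 2 * f (suc κ)) + size (suc s) * f (suc s))
        ≈⟨ +-congˡ (+-congʳ (RC.range-cong s λ κ κ<s → *-congʳ (reflexive (≡.sym (size-inner κ<s))))) ⟩
      1# * f 0 + (RC.range s (λ κ → size (suc κ) * f (suc κ)) + size (suc s) * f (suc s))
        ≈⟨ +-congˡ (RC.range-snoc s (λ κ → size (suc κ) * f (suc κ))) ⟨
      RC.range (suc (suc s)) (λ κ → size κ * f κ) ∎
      where
      module S = SemiringSolver commutativeSemiring
      Σ′ : Carrier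
      Σ′ = RC.range s (f ∘ suc)

    class-either : ∀ {c} → c ℕ.< q → class c ≡ c ⊎ class c ℕ.+ c ≡ q
    class-either {c} c<q with ℕ.⊓-sel c (q ∸ c)
    ... | inj₁ eq = inj₁ eq
    ... | inj₂ eq = inj₂ (≡.trans (≡.cong (ℕ._+ c) eq) (ℕ.m∸n+n≡m (ℕ.<⇒≤ c<q)))

    class-≡ : ∀ {c d} → c ℕ.< q → d ℕ.< q → class c ≡ class d → c ≡ d ⊎ c ℕ.+ d ≡ q
    class-≡ {c} {d} c<q d<q eq with class-either c<q | class-either d<q
    ... | inj₁ p | inj₁ r = inj₁ (≡.trans (≡.sym p) (≡.trans eq r))
    ... | inj₁ p | inj₂ r = inj₂ (≡.trans (≡.cong (ℕ._+ d) (≡.trans (≡.sym p) eq)) r)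
    ... | inj₂ p | inj₁ r = inj₂ (≡.trans (ℕ.+-comm c d) (≡.trans (≡.cong (ℕ._+ c) (≡.trans (≡.sym r) (≡.sym eq))) p))
    ... | inj₂ p | inj₂ r = inj₁ (ℕ.+-cancelˡ-≡ (class c) c d (≡.trans p (≡.trans (≡.sym r) (≡.cong (ℕ._+ d) (≡.sym eq)))))

    class-complement : ∀ {c d} → c ℕ.+ d ≡ q → class c ≡ class d
    class-complement {c} {d} eq = ≡.trans (≡.cong₂ ℕ._⊓_ (complement (≡.trans (ℕ.+-comm d c) eq)) (≡.sym (complement eq))) (ℕ.⊓-comm (q ∸ d) d)
      where
      complement : ∀ {c d} → c ℕ.+ d ≡ q → d ≡ q ∸ c
      complement {c} {d} eq = ≡.sym (≡.trans (≡.cong (_∸ c) (≡.sym eq)) (ℕ.m+n∸m≡n c d))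

    δ-fold : ∀ {c d} m → c ℕ.+ d ≡ q → δ q (m ℤ.* ℤ.+ c) ≡ δ q (m ℤ.* ℤ.+ d)
    δ-fold {c} {d} m eq = ≡.trans (≡.cong (δ q) expand)
      (≡.trans (δ-+-multiple (ℤ.- (m ℤ.* ℤ.+ d)) (ℤ∣.∣n⇒∣m*n m ℤ∣.∣-refl)) (δ-neg q (m ℤ.* ℤ.+ d)))
      where
      identity : ∀ m c d → m ℤ.* c ≡ ℤ.- (m ℤ.* d) ℤ.+ m ℤ.* (c ℤ.+ d)
      identity = solveℤ
      expand : m ℤ.* ℤ.+ c ≡ ℤ.- (m ℤ.* ℤ.+ d) ℤ.+ m ℤ.* ℤ.+ q
      expand = ≡.trans (identity m (ℤ.+ c) (ℤ.+ d)) (≡.cong (λ t → ℤ.- (m ℤ.* ℤ.+ d) ℤ.+ m ℤ.* ℤ.+ t) eq)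

    δ-class : ∀ m {c} → c ℕ.< q → δ q (m ℤ.* ℤ.+ c) ≡ δ q (m ℤ.* ℤ.+ class c)
    δ-class m {c} c<q with class-either c<q
    ... | inj₁ eq = ≡.cong (λ t → δ q (m ℤ.* ℤ.+ t)) (≡.sym eq)
    ... | inj₂ eq = δ-fold m (≡.trans (ℕ.+-comm c _) eq)

    g : ℤ → ℤ → Carrier
    g c d = ω q (c ℤ.- d) * ω q (c ℤ.+ d)

    -- Coordinates c and d of one class agree up to sign, so q divides c - d or c + d, which gives
    -- one factor Y. The other of the two is ±2κ modulo q and gives a second Y exactly for κ = 0 and
    -- κ = q/2. Hence the base Y² in the two special factors and Y in all others.
    β : ℕ → Carrier
    β κ = Y * ω q (ℤ.+ 2 ℤ.* ℤ.+ κ)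

    g-class : ∀ c d → c ℕ.< q → d ℕ.< q → g (ℤ.+ c) (ℤ.+ d) ≈ (if class c ℕ.≡ᵇ class d then β (class c) else 1#)
    g-class c d c<q d<q with class c ℕ.≟ class d
    ... | yes eq = trans (equal (class-≡ c<q d<q eq)) (sym (reflexive (≡.cong (λ b → if b then β (class c) else 1#) (≡.trans (≡.cong (class c ℕ.≡ᵇ_) (≡.sym eq)) (≡ᵇ-refl (class c))))))
      where
      equal : c ≡ d ⊎ c ℕ.+ d ≡ q → g (ℤ.+ c) (ℤ.+ d) ≈ β (class c)
      equal (inj₁ ≡.refl) = *-cong (ω-yes {q} (ℤ∣.divides ℤ.0ℤ (ℤ.+-inverseʳ (ℤ.+ c))))
        (ω-δ (≡.trans (≡.cong (δ q) (twice (ℤ.+ c))) (δ-class (ℤ.+ 2) c<q)))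
        where
        twice : ∀ c → c ℤ.+ c ≡ ℤ.+ 2 ℤ.* c
        twice = solveℤ
      equal (inj₂ c+d≡q) = trans (*-comm _ _) (*-cong (ω-yes (ℤ∣.∣-reflexive (≡.cong ℤ.+_ (≡.sym c+d≡q))))
        (ω-δ (≡.trans (≡.cong (δ q) (≡.trans (twice (ℤ.+ c) (ℤ.+ d)) (≡.cong (λ t → ℤ.+ 2 ℤ.* ℤ.+ c ℤ.+ ℤ.- (ℤ.+ t)) c+d≡q)))
          (≡.trans (δ-+-multiple (ℤ.+ 2 ℤ.* ℤ.+ c) (ℤ∣.∣m⇒∣-m ℤ∣.∣-refl)) (δ-class (ℤ.+ 2) c<q)))))
        where
        twice : ∀ c d → c ℤ.- d ≡ ℤ.+ 2 ℤ.* c ℤ.+ ℤ.- (c ℤ.+ d)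
        twice = solveℤ
    ... | no neq with class c ℕ.≡ᵇ class d | ℕ.≡ᵇ⇒≡ (class c) (class d)
    ... | true  | eq = contradiction (eq _) neq
    ... | false | _  = trans (*-cong (ω-no λ q∣ → neq (≡.cong class (divisible-difference c<q d<q q∣))) (ω-no sum)) (*-identityˡ 1#)
      where
      -- a multiple of q below 2 q is 0 or q
      sum : ¬ (ℤ.+ q ∣ℤ (ℤ.+ c ℤ.+ ℤ.+ d))
      sum q∣ with ℤ∣.∣⇒∣ᵤ q∣
      ... | ℕ∣.divides 0 eq = neq (≡.cong class (≡.trans (ℕ.m+n≡0⇒m≡0 c eq) (≡.sym (ℕ.m+n≡0⇒n≡0 c eq))))
      ... | ℕ∣.divides 1 eq = neq (class-complement (≡.trans eq (ℕ.*-identityˡ q)))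
      ... | ℕ∣.divides (suc (suc k)) eq = ℕ.<⇒≱ (ℕ.+-mono-< c<q d<q) (≡.subst (q ℕ.+ q ℕ.≤_) (≡.sym eq)
              (≡.subst (q ℕ.+ q ℕ.≤_) (ℕ.+-assoc q q (k ℕ.* q)) (ℕ.m≤m+n (q ℕ.+ q) (k ℕ.* q))))

    -- The coefficient of Z in a factor is the size of the class times its weight σ: it is 2 for the
    -- s inner classes, and σ₀ and σ₁ for the classes of 0 and q/2. The function σ collects the
    -- roots that involve a single coordinate.
    folded-sum : ∀ n (σ : ℤ → Carrier) σ₀ σ₁ →
      (∀ c → c ℕ.< q → σ (ℤ.+ c) ≈ σ (ℤ.+ class c)) →
      σ (ℤ.+ 0) ≈ σ₀ → (∀ κ → κ ℕ.< s → σ (ℤ.+ suc κ) ≈ 1#) → σ (ℤ.+ suc s) ≈ σ₁ →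
      RC.cube q n (weight σ g (λ _ → 1#)) ≈ (dexp (nat 2) Y ^⋆ s ⋆ (dexp σ₀ (Y * Y) ⋆ dexp σ₁ (Y * Y))) n
    folded-sum n σ σ₀ σ₁ even p₀ pᵢ p₁ = begin
      RC.cube q n (weight σ g (λ _ → 1#))
        ≈⟨ sum-weight σ g q (suc (suc s)) class size (σ ∘ ℤ.+_) β class-range even g-class n (λ _ → 1#) (λ _ → 1#) (λ _ _ → refl) ⟩
      (F 0 ⋆ classProduct (suc s) (F ∘ suc)) n
        ≈⟨ HR.*-cong {F 0} {A} {classProduct (suc s) (F ∘ suc)} {E ^⋆ s ⋆ B} (dexp-cong (trans (*-identityˡ _) (trans (*-identityʳ _) p₀)) (*-congˡ (ω-yes {q} {ℤ.+ 2 ℤ.* ℤ.+ 0} (ℤ∣.divides ℤ.0ℤ ≡.refl))))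
             (classProduct-power s {F ∘ suc} {E} {B} inner (dexp-cong (trans (*-congʳ (reflexive size-last)) (trans (*-identityˡ _) (trans (*-identityʳ _) p₁)))
               (*-congˡ (ω-yes (ℤ∣.∣-reflexive (≡.cong ℤ.+_ (≡.trans q≡1+s+1+s (≡.cong (suc s ℕ.+_) (≡.sym (ℕ.+-identityʳ (suc s))))))))))) n ⟩
      (A ⋆ (E ^⋆ s ⋆ B)) n
        ≈⟨ x∙yz≈y∙xz A (E ^⋆ s) B n ⟩
      (E ^⋆ s ⋆ (A ⋆ B)) n ∎
      where
      open CommutativeSemigroupProperties HR.*-commutativeSemigroup using (x∙yz≈y∙xz)
      F : ℕ → H
      F κ = dexp (size κ * (σ (ℤ.+ κ) * 1#)) (β κ)
      A B E : H
      A = dexp σ₀ (Y * Y)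
      B = dexp σ₁ (Y * Y)
      E = dexp (nat 2) Y
      double≡q : 2 ℕ.* suc s ≡ q
      double≡q = ≡.trans (≡.cong (suc s ℕ.+_) (ℕ.+-identityʳ (suc s))) (≡.sym q≡1+s+1+s)
      inner : ∀ κ → κ ℕ.< s → F (suc κ) ≋ E
      inner κ κ<s = dexp-cong
        (trans (*-cong (reflexive (size-inner κ<s)) (trans (*-identityʳ _) (pᵢ κ κ<s))) (*-identityʳ _))
        (trans (*-congˡ (ω-no λ q∣ → ℕ.<⇒≱ (≡.subst (2 ℕ.* suc κ ℕ.<_) double≡q (ℕ.*-monoʳ-< 2 (s≤s κ<s))) (ℕ∣.∣⇒≤ (ℤ∣.∣⇒∣ᵤ q∣)))) (*-identityʳ Y))

-- Classical roots

dot-+ : ∀ {n} (u w p : Vecℤ n) → dot (u +v w) p ≡ dot u p ℤ.+ dot w p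
dot-+ []      []      []      = ≡.refl
dot-+ (x ∷ u) (y ∷ w) (c ∷ p) = ≡.trans (≡.cong (ℤ._+_ ((x ℤ.+ y) ℤ.* c)) (dot-+ u w p)) (expand x y c (dot u p) (dot w p))
  where
  expand : ∀ x y c s t → (x ℤ.+ y) ℤ.* c ℤ.+ (s ℤ.+ t) ≡ (x ℤ.* c ℤ.+ s) ℤ.+ (y ℤ.* c ℤ.+ t)
  expand = solveℤ

dot-- : ∀ {n} (u w p : Vecℤ n) → dot (u -v w) p ≡ dot u p ℤ.- dot w p
dot-- []      []      []      = ≡.refl
dot-- (x ∷ u) (y ∷ w) (c ∷ p) = ≡.trans (≡.cong (ℤ._+_ ((x ℤ.- y) ℤ.* c)) (dot-- u w p)) (expand x y c (dot u p) (dot w p))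
  where
  expand : ∀ x y c s t → (x ℤ.- y) ℤ.* c ℤ.+ (s ℤ.- t) ≡ (x ℤ.* c ℤ.+ s) ℤ.- (y ℤ.* c ℤ.+ t)
  expand = solveℤ

zeroVec : ∀ n → Vecℤ n
zeroVec n = Vec.tabulate λ _ → ℤ.0ℤ

e-suc : ∀ {n} (i : Fin n) → e (Fin.suc i) ≡ ℤ.0ℤ ∷ e i
e-suc i = ≡.cong (ℤ.0ℤ ∷_) (Vec.tabulate-cong λ j → ≡.cong (λ b → if b then ℤ.1ℤ else ℤ.0ℤ) (eq i j))
  where
  eq : ∀ {n} (i j : Fin n) → ⌊ Fin.suc i Fin.≟ Fin.suc j ⌋ ≡ ⌊ i Fin.≟ j ⌋
  eq i j with i Fin.≟ j
  ... | yes _ = ≡.refl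
  ... | no  _ = ≡.refl

dot-zeroVec : ∀ {n} (p : Vecℤ n) → dot (zeroVec n) p ≡ ℤ.0ℤ
dot-zeroVec p = dot-zeroˡ (zeroVec _) p λ i → Vec.lookup∘tabulate (λ _ → ℤ.0ℤ) i

dot-e : ∀ {n} (i : Fin n) (p : Vecℤ n) → dot (e i) p ≡ lookup p i
dot-e Fin.zero    (c ∷ p) = ≡.trans (≡.cong₂ ℤ._+_ (ℤ.*-identityˡ c) (dot-zeroVec p)) (ℤ.+-identityʳ c)
dot-e (Fin.suc i) (c ∷ p) = ≡.trans (≡.cong (λ u → dot u (c ∷ p)) (e-suc i)) (≡.trans (ℤ.+-identityˡ _) (dot-e i p))

norm-e : ∀ {n} (i : Fin n) → norm (e i) ≡ 1
norm-e {suc n} Fin.zero = ≡.cong suc (zeroNorm n)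
  where
  zeroNorm : ∀ n → norm (zeroVec n) ≡ 0
  zeroNorm zero    = ≡.refl
  zeroNorm (suc n) = zeroNorm n
norm-e (Fin.suc i) = ≡.trans (≡.cong norm (e-suc i)) (norm-e i)

norm-zipWith : ∀ {n} (_∙_ : ℤ → ℤ → ℤ) → (∀ x y → ℤ.∣ x ∙ y ∣ ℕ.≤ ℤ.∣ x ∣ ℕ.+ ℤ.∣ y ∣) →
               ∀ (u w : Vecℤ n) → norm (Vec.zipWith _∙_ u w) ℕ.≤ norm u ℕ.+ norm w
norm-zipWith _∙_ h []      []      = z≤n
norm-zipWith _∙_ h (x ∷ u) (y ∷ w) = ℕ.≤-trans (ℕ.+-mono-≤ (h x y) (norm-zipWith _∙_ h u w))
  (ℕ.≤-reflexive (interchange ℤ.∣ x ∣ ℤ.∣ y ∣ (norm u) (norm w)))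
  where open CommutativeSemigroupProperties ℕ.+-commutativeSemigroup using (interchange)

norm-e±e : ∀ {n} (_∙_ : ℤ → ℤ → ℤ) → (∀ x y → ℤ.∣ x ∙ y ∣ ℕ.≤ ℤ.∣ x ∣ ℕ.+ ℤ.∣ y ∣) →
           ∀ (i j : Fin n) → norm (Vec.zipWith _∙_ (e i) (e j)) ℕ.≤ 2
norm-e±e _∙_ h i j = ℕ.≤-trans (norm-zipWith _∙_ h (e i) (e j)) (ℕ.≤-reflexive (≡.cong₂ ℕ._+_ (norm-e i) (norm-e j)))

short-++ : ∀ {n} {A B : List (Vecℤ n)} → Short A → Short B → Short (A ++ B)
short-++ {A = A} f g b b∈ with ∈-++⁻ A b∈
... | inj₁ p = f b p
... | inj₂ p = g b p

short-map : ∀ {n} {A : Set} (f : A → Vecℤ n) {xs} → (∀ x → norm (f x) ℕ.≤ 2) → Short (map f xs)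
short-map f h b b∈ with x , _ , ≡.refl ← ∈-map⁻ f b∈ = h x

short-A : ∀ n → Short (rootA n)
short-A n = short-map _ λ { (i , j) → norm-e±e ℤ._-_ ℤ.∣i-j∣≤∣i∣+∣j∣ i j }

short-D : ∀ n → Short (rootD n)
short-D n = short-++ (short-A n) (short-map _ λ { (i , j) → norm-e±e ℤ._+_ ℤ.∣i+j∣≤∣i∣+∣j∣ i j })

short-B : ∀ n → Short (rootB n)
short-B n = short-++ (short-D n) (short-map e λ i → ℕ.≤-trans (ℕ.≤-reflexive (norm-e i)) (s≤s z≤n))

short-C : ∀ n → Short (rootC n)
short-C n = short-++ (short-D n) (short-map _ λ i → norm-e±e ℤ._+_ ℤ.∣i+j∣≤∣i∣+∣j∣ i i)

range-≥ : ∀ {q c} f → c ℕ.< q → f c ℕ.≤ range q f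
range-≥ {suc q} {zero}  f _         = ℕ.m≤m+n (f 0) _
range-≥ {suc q} {suc c} f (s≤s c<q) = ℕ.≤-trans (range-≥ (f ∘ suc) c<q) (ℕ.m≤n+m _ (f 0))

cube-≥-diagonal : ∀ {q c} n f → c ℕ.< q → f (Vec.replicate n (ℤ.+ c)) ℕ.≤ cube q n f
cube-≥-diagonal zero    f c<q = ℕ.≤-refl
cube-≥-diagonal {q} {c} (suc n) f c<q = ℕ.≤-trans (cube-≥-diagonal n (λ p → f (ℤ.+ c ∷ p)) c<q) (range-≥ _ c<q)

-- The solutions are the points with all coordinates equal modulo q. For the upper bound, keep only
-- the pairs with the first coordinate, which leave one choice for each other coordinate, and
-- estimate the remaining factors by 1. For the lower bound, count the points of the diagonal.
solutions-A : ∀ q .{{_ : ℕ.NonZero q}} n → solutions q (rootA (suc n)) ≡ q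
solutions-A q n = ℕ.≤-antisym upper lower
  where
  open ℕ.≤-Reasoning
  open CoordinateProducts ℕ.+-*-commutativeSemiring
  G : ℤ → ℤ → ℕ
  G c d = δ q (c ℤ.- d)
  pair-form : ∀ (p : Vecℤ (suc n)) → ∏ (rootA (suc n)) (λ a → δ q (dot a p)) ≡ pairProduct G p
  pair-form p = ≡.trans (ℕCube.∏-map _ (pairs (suc n)) _)
    (≡.trans (ℕCube.∏-cong (pairs (suc n)) λ { (i , j) _ → ≡.cong (δ q) (≡.trans (dot-- (e i) (e j) p) (≡.cong₂ ℤ._-_ (dot-e i p) (dot-e j p))) })
      (∏-pairs p G))
  prodV≤1 : ∀ {n} (p : Vecℤ n) {f} → (∀ c → f c ℕ.≤ 1) → prodV p f ℕ.≤ 1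
  prodV≤1 []      h = ℕ.≤-refl
  prodV≤1 (c ∷ p) h = ℕ.*-mono-≤ (h c) (prodV≤1 p h)
  pairProduct≤1 : ∀ {n} (p : Vecℤ n) → pairProduct G p ℕ.≤ 1
  pairProduct≤1 []      = ℕ.≤-refl
  pairProduct≤1 (c ∷ p) = ℕ.*-mono-≤ (prodV≤1 p λ d → δ≤1 q (c ℤ.- d)) (pairProduct≤1 p)
  row : ∀ c → range q (λ d → G c (ℤ.+ d)) ≡ 1
  row c = ≡.trans (range-cong q λ d _ → ≡.cong (δ q) (flip c (ℤ.+ d))) (range-δ-unit q ℤ.-1ℤ c ≡.refl)
    where
    flip : ∀ c d → c ℤ.- d ≡ ℤ.-1ℤ ℤ.* d ℤ.+ c
    flip = solveℤ
  upper : solutions q (rootA (suc n)) ℕ.≤ q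
  upper = begin
    solutions q (rootA (suc n)) ≡⟨ cube-cong q (suc n) pair-form ⟩
    range q (λ c → cube q n (λ p → prodV p (G (ℤ.+ c)) ℕ.* pairProduct G p))
      ≤⟨ range-mono q (λ c _ → cube-mono q n λ p → ℕ.≤-trans (ℕ.*-monoʳ-≤ (prodV p (G (ℤ.+ c))) (pairProduct≤1 p)) (ℕ.≤-reflexive (ℕ.*-identityʳ _))) ⟩
    range q (λ c → cube q n (λ p → prodV p (G (ℤ.+ c))))
      ≡⟨ range-cong q (λ c _ → ≡.trans (cube-prodV q n (G (ℤ.+ c))) (≡.trans (Exponentiation.^-congˡ ℕ.+-*-semiring n (row (ℤ.+ c))) (ones n))) ⟩
    range q (λ _ → 1) ≡⟨ ≡.trans (range-const q 1) (ℕ.*-identityʳ q) ⟩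
    q ∎
    where
    ones : ∀ n → Exponentiation._^_ ℕ.+-*-semiring 1 n ≡ 1
    ones zero    = ≡.refl
    ones (suc n) = ≡.trans (ℕ.*-identityˡ _) (ones n)
  lower : q ℕ.≤ solutions q (rootA (suc n))
  lower = begin
    q ≡⟨ ≡.trans (range-const q 1) (ℕ.*-identityʳ q) ⟨
    range q (λ _ → 1) ≤⟨ range-mono q (λ c c<q → ℕ.≤-trans (ℕ.≤-reflexive (≡.sym (diagonal c))) (cube-≥-diagonal n _ c<q)) ⟩
    solutions q (rootA (suc n)) ∎
    where
    diagonal : ∀ c → ∏ (rootA (suc n)) (λ a → δ q (dot a (Vec.replicate (suc n) (ℤ.+ c)))) ≡ 1
    diagonal c = ≡.trans (pair-form _) (constant (suc n))
      where
      row-one : ∀ n → prodV (Vec.replicate n (ℤ.+ c)) (G (ℤ.+ c)) ≡ 1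
      row-one zero    = ≡.refl
      row-one (suc n) = ≡.cong₂ ℕ._*_ (δ-yes {q} (ℤ∣.divides ℤ.0ℤ (ℤ.+-inverseʳ (ℤ.+ c)))) (row-one n)
      constant : ∀ n → pairProduct G (Vec.replicate n (ℤ.+ c)) ≡ 1
      constant zero    = ≡.refl
      constant (suc n) = ≡.cong₂ ℕ._*_ (row-one n) (constant n)

-- The series for type A has the fixed factor X in place of a power depending on the rank, so the
-- rank itself is required. It is read off from the count: m qⁿ⁺¹⁻ʳ equals q for all even q, and
-- growth is compared in both directions; q = 2 shows that m is positive.
rank-A : ∀ n {r m} → IsRank (rootA (suc n)) r → IsIndex (rootA (suc n)) m → r ≡ n
rank-A n {r} {m} isRank isIndex with r≤1+n , count ← solutions-formula (short-A (suc n)) isRank isIndex =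
  ℕ.≤-antisym
    (exponent-≤ {suc n} {n} {r} {1} {m} r≤1+n ℕ.≤-refl λ s → ℕ.≤-reflexive (≡.trans (q^1 s) (both s)))
    (exponent-≤ {suc n} {r} {n} {m} {1} (ℕ.n≤1+n n) m>0 λ s → ℕ.≤-reflexive (≡.trans (≡.sym (both s)) (≡.sym (q^1 s))))
  where
  both : ∀ s .{{_ : ℕ.NonZero s}} → 2 ℕ.* s ≡ m ℕ.* (2 ℕ.* s) ℕ.^ (suc n ∸ r)
  both s = ≡.trans (≡.sym (solutions-A (2 ℕ.* s) {{ℕ.m*n≢0 2 s}} n)) (count s)
  q^1 : ∀ s .{{_ : ℕ.NonZero s}} → 1 ℕ.* (2 ℕ.* s) ℕ.^ (suc n ∸ n) ≡ 2 ℕ.* s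
  q^1 s = ≡.trans (ℕ.*-identityˡ _) (≡.trans (≡.cong ((2 ℕ.* s) ℕ.^_) (ℕ.m+n∸n≡m 1 n)) (ℕ.^-identityʳ (2 ℕ.* s)))
  m>0 : 0 ℕ.< m
  m>0 = ℕ.n≢0⇒n>0 λ m≡0 → contradiction (≡.trans (both 1) (≡.cong (ℕ._* 2 ℕ.^ (suc n ∸ r)) m≡0)) λ ()

-- Sums over sublists as sums over points

module RootSums (R : CommutativeRing 0ℓ 0ℓ) (Y : CommutativeRing.Carrier R) where
  open CommutativeRing R
  open RingExtras R
  open Hurwitz R
  open WeightedColourings R
  open ClassicalSums R Y
  open CoordinateProducts commutativeSemiring
  open Exponentiation semiring using (_^_)
  open SetoidReasoning setoid
  open CommutativeSemigroupProperties *-commutativeSemigroup using (interchange)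

  ∑L : ∀ {A : Set} → List A → (A → Carrier) → Carrier
  ∑L []       f = 0#
  ∑L (x ∷ xs) f = f x + ∑L xs f

  ∑L-cong : ∀ {A : Set} (xs : List A) {f g} → (∀ x → x ∈ xs → f x ≈ g x) → ∑L xs f ≈ ∑L xs g
  ∑L-cong []       h = refl
  ∑L-cong (x ∷ xs) h = +-cong (h x (here ≡.refl)) (∑L-cong xs λ y y∈ → h y (there y∈))

  ∑L-*ˡ : ∀ {A : Set} (xs : List A) c f → ∑L xs (λ x → c * f x) ≈ c * ∑L xs f
  ∑L-*ˡ []       c f = sym (zeroʳ c)
  ∑L-*ˡ (x ∷ xs) c f = trans (+-congˡ (∑L-*ˡ xs c f)) (sym (distribˡ c _ _))

  private
    ∑L-++ : ∀ {A : Set} (xs ys : List A) f → ∑L (xs ++ ys) f ≈ ∑L xs f + ∑L ys f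
    ∑L-++ []       ys f = sym (+-identityˡ _)
    ∑L-++ (x ∷ xs) ys f = trans (+-congˡ (∑L-++ xs ys f)) (sym (+-assoc _ _ _))

    ∑L-map : ∀ {A B : Set} (g : A → B) xs f → ∑L (map g xs) f ≡ ∑L xs (f ∘ g)
    ∑L-map g []       f = ≡.refl
    ∑L-map g (x ∷ xs) f = ≡.cong (_ +_) (∑L-map g xs f)

    ∑L-cube : ∀ {A : Set} q n (xs : List A) (f : A → Vecℤ n → Carrier) →
              ∑L xs (λ x → RC.cube q n (f x)) ≈ RC.cube q n (λ p → ∑L xs (λ x → f x p))
    ∑L-cube q n []       f = sym (RC.cube-zero q n)
    ∑L-cube q n (x ∷ xs) f = trans (+-congˡ (∑L-cube q n xs f)) (sym (RC.cube-+ q n (f x) _))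

    nat-range : ∀ q f → nat (range q f) ≈ RC.range q (nat ∘ f)
    nat-range zero    f = refl
    nat-range (suc q) f = trans (nat-+ (f 0) _) (+-congˡ (nat-range q (f ∘ suc)))

    nat-cube : ∀ q n f → nat (cube q n f) ≈ RC.cube q n (nat ∘ f)
    nat-cube q zero    f = refl
    nat-cube q (suc n) f = trans (nat-range q _) (RC.range-cong q λ c _ → nat-cube q n _)

    nat-∏ : ∀ {A : Set} (xs : List A) f → nat (∏ xs f) ≈ RC.∏ xs (nat ∘ f)
    nat-∏ []       f = +-identityʳ 1#
    nat-∏ (x ∷ xs) f = trans (nat-* (f x) _) (*-congˡ (nat-∏ xs f))

    ∏-scale : ∀ {A : Set} (xs : List A) f y → RC.∏ xs (λ x → f x * y) ≈ RC.∏ xs f * y ^ length xs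
    ∏-scale []       f y = sym (*-identityˡ 1#)
    ∏-scale (x ∷ xs) f y = trans (*-congˡ (∏-scale xs f y)) (interchange (f x) y _ _)

  expand-sublists : ∀ {A : Set} (xs : List A) w → ∑L (sublists xs) (λ B → RC.∏ B w) ≈ RC.∏ xs (λ x → 1# + w x)
  expand-sublists []       w = +-identityʳ 1#
  expand-sublists (x ∷ xs) w = begin
    ∑L (sublists xs ++ map (x ∷_) (sublists xs)) (λ B → RC.∏ B w) ≈⟨ ∑L-++ (sublists xs) _ _ ⟩
    P + ∑L (map (x ∷_) (sublists xs)) (λ B → RC.∏ B w) ≡⟨ ≡.cong (P +_) (∑L-map (x ∷_) (sublists xs) _) ⟩
    P + ∑L (sublists xs) (λ B → w x * RC.∏ B w) ≈⟨ +-cong (sym (*-identityˡ P)) (∑L-*ˡ (sublists xs) (w x) _) ⟩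
    1# * P + w x * P ≈⟨ distribʳ P 1# (w x) ⟨
    (1# + w x) * P ≈⟨ *-congˡ (expand-sublists xs w) ⟩
    (1# + w x) * RC.∏ xs (λ x → 1# + w x) ∎
    where
    P : Carrier
    P = ∑L (sublists xs) (λ B → RC.∏ B w)

  -- By the count of solutions this is the coboundary polynomial of A at X = q, multiplied by q to
  -- the power n - r(A), for even q and short A.
  pointSum : ∀ {n} → ℕ → List (Vecℤ n) → Carrier
  pointSum q A = ∑L (sublists A) λ B → nat (solutions q B) * (Y + - 1#) ^ length B

  -- Exchange the sums over sublists and over points. At a fixed point the summand is a product over
  -- the members of B, so the sum over all B factors over the roots of A.
  pointSum-cube : ∀ {n} q (A : List (Vecℤ n)) → pointSum q A ≈ RC.cube q n (λ p → RC.∏ A (λ a → ω q (dot a p)))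
  pointSum-cube {n} q A = begin
    pointSum q A
      ≈⟨ ∑L-cong (sublists A) (λ B _ → pointwise B) ⟩
    ∑L (sublists A) (λ B → RC.cube q n (λ p → RC.∏ B (λ b → nat (δ q (dot b p)) * y)))
      ≈⟨ ∑L-cube q n (sublists A) _ ⟩
    RC.cube q n (λ p → ∑L (sublists A) (λ B → RC.∏ B (λ b → nat (δ q (dot b p)) * y)))
      ≈⟨ RC.cube-cong q n (λ p → expand-sublists A (λ b → nat (δ q (dot b p)) * y)) ⟩
    RC.cube q n (λ p → RC.∏ A (λ a → ω q (dot a p))) ∎
    where
    y : Carrier
    y = Y + - 1#
    pointwise : ∀ B → nat (solutions q B) * y ^ length B ≈ RC.cube q n (λ p → RC.∏ B (λ b → nat (δ q (dot b p)) * y))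
    pointwise B = begin
      nat (solutions q B) * y ^ length B ≈⟨ *-comm _ _ ⟩
      y ^ length B * nat (solutions q B) ≈⟨ *-congˡ (nat-cube q n _) ⟩
      y ^ length B * RC.cube q n (λ p → nat (∏ B (λ b → δ q (dot b p)))) ≈⟨ RC.cube-*ˡ q n (y ^ length B) _ ⟨
      RC.cube q n (λ p → y ^ length B * nat (∏ B (λ b → δ q (dot b p))))
        ≈⟨ RC.cube-cong q n (λ p → trans (*-comm _ _) (trans (*-congʳ (nat-∏ B _)) (sym (∏-scale B _ y)))) ⟩
      RC.cube q n (λ p → RC.∏ B (λ b → nat (δ q (dot b p)) * y)) ∎

  private
    A-ω : ∀ q {n} (p : Vecℤ n) → RC.∏ (rootA n) (λ a → ω q (dot a p)) ≈ pairProduct (λ c d → ω q (c ℤ.- d)) p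
    A-ω q {n} p = trans (reflexive (RC.∏-map _ (pairs n) _))
      (trans (RC.∏-cong (pairs n) (λ { (i , j) _ → reflexive (≡.cong (ω q) (≡.trans (dot-- (e i) (e j) p) (≡.cong₂ ℤ._-_ (dot-e i p) (dot-e j p)))) }))
        (∏-pairs p (λ c d → ω q (c ℤ.- d))))

    D-ω : ∀ q {n} (p : Vecℤ n) → RC.∏ (rootD n) (λ a → ω q (dot a p)) ≈ pairProduct (λ c d → ω q (c ℤ.- d) * ω q (c ℤ.+ d)) p
    D-ω q {n} p = trans (RC.∏-++ (rootA n) _ _) (trans (*-cong (A-ω q p) (trans (reflexive (RC.∏-map _ (pairs n) _))
      (trans (RC.∏-cong (pairs n) (λ { (i , j) _ → reflexive (≡.cong (ω q) (≡.trans (dot-+ (e i) (e j) p) (≡.cong₂ ℤ._+_ (dot-e i p) (dot-e j p)))) }))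
        (∏-pairs p (λ c d → ω q (c ℤ.+ d))))))
      (sym (pairProduct-* (λ c d → ω q (c ℤ.- d)) (λ c d → ω q (c ℤ.+ d)) p)))

    single-ω : ∀ q {n} (f : Fin n → Vecℤ n) (σ : ℤ → ℤ) (p : Vecℤ n) → (∀ i → dot (f i) p ≡ σ (lookup p i)) →
               RC.∏ (map f (allFin n)) (λ a → ω q (dot a p)) ≈ prodV p (λ c → ω q (σ c))
    single-ω q {n} f σ p h = trans (reflexive (RC.∏-map f (allFin n) _)) (trans (∏-tabulate n (λ i → i) _)
      (trans (prodF-cong n λ i → reflexive (≡.cong (ω q) (h i))) (prodF-lookup p (λ c → ω q (σ c)))))

    as-weight : ∀ σ g {n} (p : Vecℤ n) → pairProduct g p * prodV p σ ≈ weight σ g (λ _ → 1#) p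
    as-weight σ g p = trans (*-comm _ _) (trans (*-congʳ (prodV-cong p λ c → sym (*-identityʳ (σ c)))) (sym (weight-product σ g (λ _ → 1#) p)))

    as-weight₁ : ∀ g {n} (p : Vecℤ n) → pairProduct g p ≈ weight (λ _ → 1#) g (λ _ → 1#) p
    as-weight₁ g p = trans (sym (trans (*-congˡ (prodV-one p)) (*-identityʳ _))) (as-weight (λ _ → 1#) g p)

  pointSum-A : ∀ q n → pointSum q (rootA n) ≈ (dexp 1# Y ^⋆ q) n
  pointSum-A q n = trans (pointSum-cube q (rootA n))
    (trans (RC.cube-cong q n λ p → trans (A-ω q p) (as-weight₁ _ p)) (typeA q n))

  module _ (s : ℕ) where
    private
      q : ℕ
      q = 2 ℕ.* suc s
      q≡ : q ≡ suc (suc s) ℕ.+ s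
      q≡ = ≡.cong suc (≡.trans (≡.cong (s ℕ.+_) (ℕ.+-identityʳ (suc s))) (ℕ.+-suc s s))
    open Folded s q q≡ using (folded-sum; δ-class; class; q≡1+s+1+s)

    private
      small : ∀ {c} → suc c ℕ.< q → ω q (ℤ.+ suc c) ≈ 1#
      small c<q = ω-no λ q∣ → ℕ.<⇒≱ c<q (ℕ∣.∣⇒≤ (ℤ∣.∣⇒∣ᵤ q∣))
      s<q : ∀ {κ} → κ ℕ.≤ s → suc κ ℕ.< q
      s<q {κ} κ≤s = ≡.subst (suc κ ℕ.<_) (≡.sym q≡) (ℕ.≤-trans (s≤s (s≤s κ≤s)) (ℕ.m≤m+n (suc (suc s)) s))
      at-zero : ω q (ℤ.+ 0) ≈ Y
      at-zero = ω-yes {q} {ℤ.+ 0} (ℤ∣.divides ℤ.0ℤ ≡.refl)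

    pointSum-D : ∀ n → pointSum q (rootD n) ≈ (dexp (nat 2) Y ^⋆ s ⋆ (dexp 1# (Y * Y) ⋆ dexp 1# (Y * Y))) n
    pointSum-D n = trans (pointSum-cube q (rootD n))
      (trans (RC.cube-cong q n λ p → trans (D-ω q p) (as-weight₁ _ p))
        (folded-sum n (λ _ → 1#) 1# 1# (λ _ _ → refl) refl (λ _ _ → refl) refl))

    -- The value of eᵢ at a point is its i-th coordinate, divisible by q only in the class of 0. So
    -- this class has the weight Y and the class of q/2 the weight 1.
    pointSum-B : ∀ n → pointSum q (rootB n) ≈ (dexp (nat 2) Y ^⋆ s ⋆ (dexp Y (Y * Y) ⋆ dexp 1# (Y * Y))) n
    pointSum-B n = trans (pointSum-cube q (rootB n))
      (trans (RC.cube-cong q n λ p → trans (RC.∏-++ (rootD n) _ _) (trans (*-cong (D-ω q p) (single-ω q e (λ c → c) p (λ i → dot-e i p))) (as-weight (ω q) _ p)))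
        (folded-sum n (ω q) Y 1# even at-zero (λ κ κ<s → small (s<q (ℕ.<⇒≤ κ<s))) (small (s<q ℕ.≤-refl))))
      where
      even : ∀ c → c ℕ.< q → ω q (ℤ.+ c) ≈ ω q (ℤ.+ class c)
      even c c<q = ω-δ (≡.trans (≡.cong (δ q) (≡.sym (ℤ.*-identityˡ (ℤ.+ c)))) (≡.trans (δ-class ℤ.1ℤ c<q) (≡.cong (δ q) (ℤ.*-identityˡ (ℤ.+ class c)))))

    -- The value of 2eᵢ is twice the coordinate, which is divisible by q in the classes of 0 and of
    -- q/2; both have the weight Y.
    pointSum-C : ∀ n → pointSum q (rootC n) ≈ (dexp (nat 2) Y ^⋆ s ⋆ (dexp Y (Y * Y) ⋆ dexp Y (Y * Y))) n
    pointSum-C n = trans (pointSum-cube q (rootC n))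
      (trans (RC.cube-cong q n λ p → trans (RC.∏-++ (rootD n) _ _) (trans (*-cong (D-ω q p)
          (single-ω q (λ i → e i +v e i) (λ c → c ℤ.+ c) p (λ i → ≡.trans (dot-+ (e i) (e i) p) (≡.cong₂ ℤ._+_ (dot-e i p) (dot-e i p)))))
          (as-weight (λ c → ω q (c ℤ.+ c)) _ p)))
        (folded-sum n (λ c → ω q (c ℤ.+ c)) Y Y even at-zero inner (ω-yes (ℤ∣.∣-reflexive (≡.cong ℤ.+_ q≡1+s+1+s)))))
      where
      twice : ∀ c → c ℤ.+ c ≡ ℤ.+ 2 ℤ.* c
      twice = solveℤ
      even : ∀ c → c ℕ.< q → ω q (ℤ.+ c ℤ.+ ℤ.+ c) ≈ ω q (ℤ.+ class c ℤ.+ ℤ.+ class c)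
      even c c<q = ω-δ (≡.trans (≡.cong (δ q) (twice (ℤ.+ c))) (≡.trans (δ-class (ℤ.+ 2) c<q) (≡.cong (δ q) (≡.sym (twice (ℤ.+ class c))))))
      inner : ∀ κ → κ ℕ.< s → ω q (ℤ.+ suc κ ℤ.+ ℤ.+ suc κ) ≈ 1#
      inner κ κ<s = small (≡.subst (suc κ ℕ.+ suc κ ℕ.<_) (≡.sym q≡1+s+1+s) (ℕ.+-mono-< (s≤s κ<s) (s≤s κ<s)))

-- From ordinary to exponential series

module OrdinaryProduct (R : CommutativeRing 0ℓ 0ℓ) where
  open CommutativeRing R
  open RingExtras R
  open Hurwitz R
  open SetoidReasoning setoid

  ∑-swap : ∀ p q (f : ℕ → ℕ → Carrier) → ∑ p (λ i → ∑ q (f i)) ≈ ∑ q (λ j → ∑ p (λ i → f i j))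
  ∑-swap zero    q f = refl
  ∑-swap (suc p) q f = trans (+-congʳ (∑-swap p q f)) (sym (∑-+ q _ (f (suc p))))

  convolution : H → H → H
  convolution f g n = ∑ n λ a → f a * g (n ∸ a)

  derivative : H → H
  derivative f n = nat (suc n) * f (suc n)

  -- In the summand with indices a and n + 1 - a the two derivatives contribute the factors a and n
  -- + 1 - a, whose sum is n + 1. Each of the two sums is first extended by the summand whose factor
  -- is 0.
  convolution-leibniz : ∀ f g n → convolution (derivative f) g n + convolution f (derivative g) n ≈ nat (suc n) * convolution f g (suc n)
  convolution-leibniz f g n = begin
    ∑ n (λ a → nat (suc a) * f (suc a) * g (n ∸ a)) + ∑ n (λ a → f a * (nat (suc (n ∸ a)) * g (suc (n ∸ a))))
      ≈⟨ +-cong first second ⟩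
    ∑ (suc n) (λ a → nat a * t a) + ∑ (suc n) (λ a → nat (suc n ∸ a) * t a)
      ≈⟨ ∑-+ (suc n) _ _ ⟨
    ∑ (suc n) (λ a → nat a * t a + nat (suc n ∸ a) * t a)
      ≈⟨ ∑-cong (suc n) (λ a a≤1+n → trans (sym (distribʳ (t a) _ _)) (*-congʳ (trans (sym (nat-+ a _)) (reflexive (≡.cong nat (ℕ.m+[n∸m]≡n a≤1+n)))))) ⟩
    ∑ (suc n) (λ a → nat (suc n) * t a)
      ≈⟨ ∑-*ˡ (suc n) (nat (suc n)) t ⟩
    nat (suc n) * convolution f g (suc n) ∎
    where
    t : ℕ → Carrier
    t a = f a * g (suc n ∸ a)
    first : ∑ n (λ a → nat (suc a) * f (suc a) * g (n ∸ a)) ≈ ∑ (suc n) (λ a → nat a * t a)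
    first = begin
      ∑ n (λ a → nat (suc a) * f (suc a) * g (n ∸ a)) ≈⟨ ∑-cong n (λ a _ → *-assoc _ _ _) ⟩
      ∑ n (λ a → nat (suc a) * t (suc a)) ≈⟨ +-identityˡ _ ⟨
      0# + ∑ n (λ a → nat (suc a) * t (suc a)) ≈⟨ +-congʳ (zeroˡ (t 0)) ⟨
      0# * t 0 + ∑ n (λ a → nat (suc a) * t (suc a)) ≈⟨ ∑-suc n (λ a → nat a * t a) ⟨
      ∑ (suc n) (λ a → nat a * t a) ∎
    second : ∑ n (λ a → f a * (nat (suc (n ∸ a)) * g (suc (n ∸ a)))) ≈ ∑ (suc n) (λ a → nat (suc n ∸ a) * t a)
    second = begin
      ∑ n (λ a → f a * (nat (suc (n ∸ a)) * g (suc (n ∸ a))))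
        ≈⟨ ∑-cong n (λ a a≤n → trans (x∙yz≈y∙xz _ _ _) (reflexive (≡.cong (λ m → nat m * (f a * g m)) (≡.sym (ℕ.+-∸-assoc 1 a≤n))))) ⟩
      ∑ n (λ a → nat (suc n ∸ a) * t a) ≈⟨ +-identityʳ _ ⟨
      ∑ n (λ a → nat (suc n ∸ a) * t a) + 0# ≈⟨ +-congˡ (trans (*-congʳ (reflexive (≡.cong nat (ℕ.n∸n≡0 n)))) (zeroˡ _)) ⟨
      ∑ (suc n) (λ a → nat (suc n ∸ a) * t a) ∎
      where open CommutativeSemigroupProperties *-commutativeSemigroup using (x∙yz≈y∙xz)

  scaled : H → H
  scaled f n = nat (n !) * f n

  D-scaled : ∀ f → D (scaled f) ≋ scaled (derivative f)
  D-scaled f n = trans (*-congʳ (trans (nat-* (suc n) (n !)) (*-comm _ _))) (*-assoc _ _ _)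

  -- Multiplication by n! carries the Cauchy product into the product defined by the Leibniz rule.
  -- In the step both sides are differentiated, and `convolution-leibniz` recombines the two terms.
  scaled-⋆ : ∀ f g → scaled f ⋆ scaled g ≋ scaled (convolution f g)
  scaled-⋆ f g zero    = begin
    nat 1 * f 0 * (nat 1 * g 0) ≈⟨ *-cong (1* (f 0)) (1* (g 0)) ⟩
    f 0 * g 0 ≈⟨ 1* (f 0 * g 0) ⟨
    nat 1 * (f 0 * g 0) ∎
    where
    1* : ∀ x → nat 1 * x ≈ x
    1* x = trans (*-congʳ (+-identityʳ 1#)) (*-identityˡ x)
  scaled-⋆ f g (suc n) = begin
    (D (scaled f) ⋆ scaled g) n + (scaled f ⋆ D (scaled g)) n
      ≈⟨ +-cong (HR.*-congʳ {scaled g} (D-scaled f) n) (HR.*-congˡ {scaled f} (D-scaled g) n) ⟩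
    (scaled (derivative f) ⋆ scaled g) n + (scaled f ⋆ scaled (derivative g)) n
      ≈⟨ +-cong (scaled-⋆ (derivative f) g n) (scaled-⋆ f (derivative g) n) ⟩
    nat (n !) * convolution (derivative f) g n + nat (n !) * convolution f (derivative g) n
      ≈⟨ distribˡ _ _ _ ⟨
    nat (n !) * (convolution (derivative f) g n + convolution f (derivative g) n)
      ≈⟨ *-congˡ (convolution-leibniz f g n) ⟩
    nat (n !) * (nat (suc n) * convolution f g (suc n))
      ≈⟨ *-assoc _ _ _ ⟨
    nat (n !) * nat (suc n) * convolution f g (suc n)
      ≈⟨ *-congʳ (trans (*-comm _ _) (sym (nat-* (suc n) (n !)))) ⟩
    scaled (convolution f g) (suc n) ∎

module DeformedExponential (A : ℚAlgebra) where
  open ℚAlgebra A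
  open Hurwitz commRing
  open WeightedColourings commRing using (dexp)
  open Exponentiation semiring using (_^_)
  open SetoidReasoning setoid

  const-^ : ∀ a n → const a ^⋆ n ≋ const (a ^ n)
  const-^ a zero    = HR.refl
  const-^ a (suc n) = HR.trans (HR.*-congˡ {const a} (const-^ a n)) (HR.sym (const-* a (a ^ n)))

  var-^ : ∀ n k → (var ^⋆ n) k ≈ (if n ℕ.≡ᵇ k then nat (n !) else 0#)
  var-^ zero    zero    = sym (+-identityʳ 1#)
  var-^ zero    (suc k) = refl
  var-^ (suc n) zero    = zeroˡ _
  var-^ (suc n) (suc k) = trans (var-⋆-suc (var ^⋆ n) k) (trans (*-congˡ (var-^ n k)) (step n k))
    where
    step : ∀ n k → nat (suc k) * (if n ℕ.≡ᵇ k then nat (n !) else 0#) ≈ (if n ℕ.≡ᵇ k then nat (suc n !) else 0#)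
    step n k with n ℕ.≡ᵇ k | ℕ.≡ᵇ⇒≡ n k
    ... | true  | eq = trans (*-congʳ (reflexive (≡.cong (nat ∘ suc) (≡.sym (eq _))))) (sym (nat-* (suc n) (n !)))
    ... | false | _  = zeroʳ _

  term : ∀ a b n k → ((const a ⋆ var) ^⋆ n ⋆ const b ^⋆ (n choose 2)) k ≈ (a ^ n * b ^ (n choose 2)) * (if n ℕ.≡ᵇ k then nat (n !) else 0#)
  term a b n k = begin
    ((const a ⋆ var) ^⋆ n ⋆ const b ^⋆ m) k
      ≈⟨ HR.*-cong {(const a ⋆ var) ^⋆ n} {const a ^⋆ n ⋆ var ^⋆ n} {const b ^⋆ m} (WeightedColourings.^-distrib hurwitzRing (const a) var n) (const-^ b m) k ⟩
    (const a ^⋆ n ⋆ var ^⋆ n ⋆ const (b ^ m)) k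
      ≈⟨ HR.*-congʳ {const (b ^ m)} (HR.*-congʳ {var ^⋆ n} (const-^ a n)) k ⟩
    (const (a ^ n) ⋆ var ^⋆ n ⋆ const (b ^ m)) k
      ≈⟨ xy∙z≈xz∙y (const (a ^ n)) (var ^⋆ n) (const (b ^ m)) k ⟩
    (const (a ^ n) ⋆ const (b ^ m) ⋆ var ^⋆ n) k
      ≈⟨ HR.*-congʳ {var ^⋆ n} (HR.sym (const-* (a ^ n) (b ^ m))) k ⟩
    (const (a ^ n * b ^ m) ⋆ var ^⋆ n) k
      ≈⟨ const-⋆ _ (var ^⋆ n) k ⟩
    (a ^ n * b ^ m) * (var ^⋆ n) k
      ≈⟨ *-congˡ (var-^ n k) ⟩
    (a ^ n * b ^ m) * (if n ℕ.≡ᵇ k then nat (n !) else 0#) ∎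
    where
    open CommutativeSemigroupProperties HR.*-commutativeSemigroup using (xy∙z≈xz∙y)
    m : ℕ
    m = n choose 2

  ∑-last : ∀ k f → (∀ n → n ℕ.< k → f n ≈ 0#) → ∑ k f ≈ f k
  ∑-last zero    f h = refl
  ∑-last (suc k) f h = trans (+-congʳ (∑-zero k λ n n≤k → h n (s≤s n≤k))) (+-identityˡ _)

  -- The n-th power of aZ is concentrated in degree n, where its exponential coefficient carries n!.
  -- So only n = k survives in degree k, and 1/k! cancels.
  dexp-series : ∀ a b k → ∑ k (λ n → ι (invℕ (n !)) * ((const a ⋆ var) ^⋆ n ⋆ const b ^⋆ (n choose 2)) k) ≈ dexp a b k
  dexp-series a b k = begin
    ∑ k (λ n → ι (invℕ (n !)) * ((const a ⋆ var) ^⋆ n ⋆ const b ^⋆ (n choose 2)) k) ≈⟨ ∑-cong k (λ n _ → *-congˡ (term a b n k)) ⟩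
    ∑ k f ≈⟨ ∑-last k f below ⟩
    f k ≈⟨ diagonal ⟩
    dexp a b k ∎
    where
    f : ℕ → Carrier
    f n = ι (invℕ (n !)) * ((a ^ n * b ^ (n choose 2)) * (if n ℕ.≡ᵇ k then nat (n !) else 0#))
    below : ∀ n → n ℕ.< k → f n ≈ 0#
    below n n<k with n ℕ.≡ᵇ k | ℕ.≡ᵇ⇒≡ n k
    ... | true  | eq = contradiction (eq _) (ℕ.<⇒≢ n<k)
    ... | false | _  = trans (*-congˡ (zeroʳ _)) (zeroʳ _)
    diagonal : f k ≈ dexp a b k
    diagonal with k ℕ.≡ᵇ k | ℕ.≡⇒≡ᵇ k k ≡.refl
    ... | true | _ = begin
      ι (invℕ (k !)) * (dexp a b k * nat (k !)) ≈⟨ x∙yz≈xz∙y _ _ _ ⟩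
      ι (invℕ (k !)) * nat (k !) * dexp a b k ≈⟨ *-congʳ (invnat-nat (k !) {{ℕ._!≢0 k}}) ⟩
      1# * dexp a b k ≈⟨ *-identityˡ _ ⟩
      dexp a b k ∎
      where open CommutativeSemigroupProperties *-commutativeSemigroup using (x∙yz≈xz∙y)

-- series in Y, and series in X with such series as coefficients; HS below adds Z
K-algebra R-algebra : ℚAlgebra
K-algebra = hurwitzAlgebra ℚ-algebra
R-algebra = hurwitzAlgebra K-algebra

module HQ = Hurwitz ℚ.+-*-commutativeRing
module HK = Hurwitz (ℚAlgebra.commRing K-algebra)
module HS = Hurwitz (ℚAlgebra.commRing R-algebra)
module NQ = RingExtras ℚ.+-*-commutativeRing
module NK = RingExtras (ℚAlgebra.commRing K-algebra)
module NR = RingExtras (ℚAlgebra.commRing R-algebra)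
module OQ = OrdinaryProduct ℚ.+-*-commutativeRing
module OK = OrdinaryProduct (ℚAlgebra.commRing K-algebra)
module OR = OrdinaryProduct (ℚAlgebra.commRing R-algebra)
module ES = ExpLog R-algebra

fact : ℕ → ℚ
fact n = NQ.nat (n !)

-- The ring homomorphism from ordinary power series in X, Y, Z to exponential ones,
-- with Z as the outermost variable.
τ : Series → HS.H
τ f k i j = fact k ℚ.* (fact i ℚ.* (fact j ℚ.* f i j k))

nat-⋆ᴷ : ∀ n a j → (NK.nat n HQ.⋆ a) j ≡ NQ.nat n ℚ.* a j
nat-⋆ᴷ n a j = ≡.trans (HQ.HR.*-congʳ {a} (HQ.nat-const n) j) (HQ.const-⋆ (NQ.nat n) a j)

nat-⋆ᴿ : ∀ n a i j → (NR.nat n HK.⋆ a) i j ≡ NQ.nat n ℚ.* a i j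
nat-⋆ᴿ n a i j = ≡.trans (HK.HR.*-congʳ {a} (HK.nat-const n) i j) (≡.trans (HK.const-⋆ (NK.nat n) a i j) (nat-⋆ᴷ n (a i) j))

∑-coeffᴿ : ∀ n f i j → NR.∑ n f i j ≡ NQ.∑ n (λ m → f m i j)
∑-coeffᴿ n f i j = ≡.trans (HK.∑-coeff n f i j) (HQ.∑-coeff n (λ m → f m i) j)

sumTo-cong : ∀ n {f g} → (∀ m → f m ≡ g m) → sumTo n f ≡ sumTo n g
sumTo-cong zero    h = h 0
sumTo-cong (suc n) h = ≡.cong₂ ℚ._+_ (sumTo-cong n h) (h (suc n))

sumTo-∑ : ∀ n {f g} → (∀ m → f m ≡ g m) → sumTo n f ≡ NQ.∑ n g
sumTo-∑ zero    h = h 0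
sumTo-∑ (suc n) h = ≡.cong₂ ℚ._+_ (sumTo-∑ n h) (h (suc n))

-- `scaled-⋆` is applied once for each variable, from Z inwards to Y. The sums then have to be
-- exchanged, since `_*S_` sums over the exponent of X outermost and that of Z innermost.
τ-* : ∀ f g → τ (f *S g) HS.≋ τ f HS.⋆ τ g
τ-* f g k i j = ≡.sym (begin
  (τ f HS.⋆ τ g) k i j
    ≡⟨ HS.HR.*-cong {τ f} {OR.scaled F} {τ g} {OR.scaled G} (rescale f) (rescale g) k i j ⟩
  (OR.scaled F HS.⋆ OR.scaled G) k i j
    ≡⟨ OR.scaled-⋆ F G k i j ⟩
  (NR.nat (k !) HK.⋆ OR.convolution F G k) i j
    ≡⟨ nat-⋆ᴿ (k !) (OR.convolution F G k) i j ⟩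
  fact k ℚ.* OR.convolution F G k i j
    ≡⟨ ≡.cong (fact k ℚ.*_) (∑-coeffᴿ k (λ c → F c HK.⋆ G (k ∸ c)) i j) ⟩
  fact k ℚ.* NQ.∑ k (λ c → (F c HK.⋆ G (k ∸ c)) i j)
    ≡⟨ ≡.cong (fact k ℚ.*_) (NQ.∑-cong k λ c _ → inner c) ⟩
  fact k ℚ.* NQ.∑ k (λ c → fact i ℚ.* (fact j ℚ.* NQ.∑ i (λ a → NQ.∑ j (λ b → t a b c))))
    ≡⟨ ≡.cong (fact k ℚ.*_) (≡.trans (NQ.∑-*ˡ k (fact i) _) (≡.cong (fact i ℚ.*_) (NQ.∑-*ˡ k (fact j) _))) ⟩
  fact k ℚ.* (fact i ℚ.* (fact j ℚ.* NQ.∑ k (λ c → NQ.∑ i (λ a → NQ.∑ j (λ b → t a b c)))))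
    ≡⟨ ≡.cong (λ x → fact k ℚ.* (fact i ℚ.* (fact j ℚ.* x))) (≡.trans (OQ.∑-swap k i _) (NQ.∑-cong i λ a _ → OQ.∑-swap k j _)) ⟩
  fact k ℚ.* (fact i ℚ.* (fact j ℚ.* NQ.∑ i (λ a → NQ.∑ j (λ b → NQ.∑ k (t a b)))))
    ≡⟨ ≡.cong (λ x → fact k ℚ.* (fact i ℚ.* (fact j ℚ.* x)))
         (≡.sym (sumTo-∑ i λ a → sumTo-∑ j λ b → sumTo-∑ k λ c → ≡.refl)) ⟩
  τ (f *S g) k i j ∎)
  where
  open ≡.≡-Reasoning
  t : ℕ → ℕ → ℕ → ℚ
  t a b c = f a b c ℚ.* g (i ∸ a) (j ∸ b) (k ∸ c)
  F G : ℕ → HK.H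
  F c i j = fact i ℚ.* (fact j ℚ.* f i j c)
  G c i j = fact i ℚ.* (fact j ℚ.* g i j c)
  rescale : ∀ f → τ f HS.≋ OR.scaled (λ c i j → fact i ℚ.* (fact j ℚ.* f i j c))
  rescale f k i j = ≡.sym (nat-⋆ᴿ (k !) (λ i j → fact i ℚ.* (fact j ℚ.* f i j k)) i j)
  slice : (f : Series) → ℕ → ℕ → HQ.H
  slice f c a j = fact j ℚ.* f a j c
  inner : ∀ c → (F c HK.⋆ G (k ∸ c)) i j ≡ fact i ℚ.* (fact j ℚ.* NQ.∑ i (λ a → NQ.∑ j (λ b → t a b c)))
  inner c = begin
    (F c HK.⋆ G (k ∸ c)) i j
      ≡⟨ HK.HR.*-cong {F c} {OK.scaled (slice f c)} {G (k ∸ c)} {OK.scaled (slice g (k ∸ c))}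
           (λ i j → ≡.sym (nat-⋆ᴷ (i !) (slice f c i) j)) (λ i j → ≡.sym (nat-⋆ᴷ (i !) (slice g (k ∸ c) i) j)) i j ⟩
    (OK.scaled (slice f c) HK.⋆ OK.scaled (slice g (k ∸ c))) i j
      ≡⟨ OK.scaled-⋆ (slice f c) (slice g (k ∸ c)) i j ⟩
    (NK.nat (i !) HQ.⋆ OK.convolution (slice f c) (slice g (k ∸ c)) i) j
      ≡⟨ nat-⋆ᴷ (i !) (OK.convolution (slice f c) (slice g (k ∸ c)) i) j ⟩
    fact i ℚ.* OK.convolution (slice f c) (slice g (k ∸ c)) i j
      ≡⟨ ≡.cong (fact i ℚ.*_) (HQ.∑-coeff i (λ a → slice f c a HQ.⋆ slice g (k ∸ c) (i ∸ a)) j) ⟩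
    fact i ℚ.* NQ.∑ i (λ a → (slice f c a HQ.⋆ slice g (k ∸ c) (i ∸ a)) j)
      ≡⟨ ≡.cong (fact i ℚ.*_) (NQ.∑-cong i λ a _ → OQ.scaled-⋆ (λ j → f a j c) (λ j → g (i ∸ a) j (k ∸ c)) j) ⟩
    fact i ℚ.* NQ.∑ i (λ a → fact j ℚ.* NQ.∑ j (λ b → t a b c))
      ≡⟨ ≡.cong (fact i ℚ.*_) (NQ.∑-*ˡ i (fact j) _) ⟩
    fact i ℚ.* (fact j ℚ.* NQ.∑ i (λ a → NQ.∑ j (λ b → t a b c))) ∎

scale : ℕ → ℕ → ℕ → ℚ → ℚ
scale k i j x = fact k ℚ.* (fact i ℚ.* (fact j ℚ.* x))

scale-0 : ∀ k i j → scale k i j 0ℚ ≡ 0ℚ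
scale-0 k i j = ≡.trans (≡.cong (fact k ℚ.*_) (≡.trans (≡.cong (fact i ℚ.*_) (ℚ.*-zeroʳ (fact j))) (ℚ.*-zeroʳ (fact i)))) (ℚ.*-zeroʳ (fact k))

scale-+ : ∀ k i j x y → scale k i j (x ℚ.+ y) ≡ scale k i j x ℚ.+ scale k i j y
scale-+ k i j x y = ≡.trans (≡.cong (λ z → fact k ℚ.* (fact i ℚ.* z)) (ℚ.*-distribˡ-+ (fact j) x y))
  (≡.trans (≡.cong (fact k ℚ.*_) (ℚ.*-distribˡ-+ (fact i) _ _)) (ℚ.*-distribˡ-+ (fact k) _ _))

scale-* : ∀ k i j q x → scale k i j (q ℚ.* x) ≡ q ℚ.* scale k i j x
scale-* k i j q x = ≡.trans (≡.cong (λ z → fact k ℚ.* (fact i ℚ.* z)) (x∙yz≈y∙xz (fact j) q x))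
  (≡.trans (≡.cong (fact k ℚ.*_) (x∙yz≈y∙xz (fact i) q _)) (x∙yz≈y∙xz (fact k) q _))
  where open CommutativeSemigroupProperties (CommutativeRing.*-commutativeSemigroup ℚ.+-*-commutativeRing) using (x∙yz≈y∙xz)

scale-neg : ∀ k i j x → scale k i j (ℚ.- x) ≡ ℚ.- scale k i j x
scale-neg k i j x = ≡.trans (≡.cong (scale k i j) (-‿as-* x)) (≡.trans (scale-* k i j (ℚ.- 1ℚ) x) (≡.sym (-‿as-* _)))
  where
  -‿as-* : ∀ x → ℚ.- x ≡ (ℚ.- 1ℚ) ℚ.* x
  -‿as-* x = ≡.trans (≡.cong (ℚ.-_) (≡.sym (ℚ.*-identityˡ x))) (ℚ.neg-distribˡ-* 1ℚ x)

scale-sum : ∀ k i j n {f g} → (∀ m → scale k i j (f m) ≡ g m) → scale k i j (sumTo n f) ≡ NQ.∑ n g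
scale-sum k i j zero    h = h 0
scale-sum k i j (suc n) h = ≡.trans (scale-+ k i j _ _) (≡.cong₂ ℚ._+_ (scale-sum k i j n h) (h (suc n)))

τ-cong : ∀ {f g} → f ≈S g → τ f HS.≋ τ g
τ-cong h k i j = ≡.cong (scale k i j) (h i j k)

τ-injective : ∀ {f g} → τ f HS.≋ τ g → f ≈S g
τ-injective h i j k = cancel j (cancel i (cancel k (h k i j)))
  where
  cancel : ∀ n {x y} → fact n ℚ.* x ≡ fact n ℚ.* y → x ≡ y
  cancel n {x} {y} eq = ≡.trans (≡.sym (unscale x)) (≡.trans (≡.cong (invℕ (n !) ℚ.*_) eq) (unscale y))
    where
    unscale : ∀ x → invℕ (n !) ℚ.* (fact n ℚ.* x) ≡ x
    unscale x = ≡.trans (≡.sym (ℚ.*-assoc (invℕ (n !)) (fact n) x))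
      (≡.trans (≡.cong (ℚ._* x) (ℚAlgebra.invnat-nat ℚ-algebra (n !) {{ℕ._!≢0 n}})) (ℚ.*-identityˡ x))

τ-+ : ∀ f g → τ (f +S g) HS.≋ τ f HS.⊕ τ g
τ-+ f g k i j = scale-+ k i j (f i j k) (g i j k)

τ-- : ∀ f g → τ (f -S g) HS.≋ τ f HS.⊕ (HS.⊖ τ g)
τ-- f g k i j = ≡.trans (scale-+ k i j (f i j k) (ℚ.- g i j k)) (≡.cong (τ f k i j ℚ.+_) (scale-neg k i j (g i j k)))

constᴿ : ℚ → HK.H
constᴿ = ℚAlgebra.ι R-algebra

constᴿ-⋆ : ∀ q a i j → (constᴿ q HK.⋆ a) i j ≡ q ℚ.* a i j
constᴿ-⋆ q a i j = ≡.trans (HK.const-⋆ (HQ.const q) a i j) (HQ.const-⋆ q (a i) j)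

τ-· : ∀ q f → τ (q ·S f) HS.≋ HS.const (constᴿ q) HS.⋆ τ f
τ-· q f k i j = ≡.trans (scale-* k i j q (f i j k))
  (≡.sym (≡.trans (HS.const-⋆ (constᴿ q) (τ f) k i j) (constᴿ-⋆ q (τ f k) i j)))

τ-one : τ oneS HS.≋ HS.const (HK.const (HQ.const 1ℚ))
τ-one zero    zero    zero    = ≡.refl
τ-one zero    zero    (suc j) = scale-0 0 0 (suc j)
τ-one zero    (suc i) j       = scale-0 0 (suc i) j
τ-one (suc k) zero    zero    = scale-0 (suc k) 0 0
τ-one (suc k) zero    (suc j) = scale-0 (suc k) 0 (suc j)
τ-one (suc k) (suc i) j       = scale-0 (suc k) (suc i) j

τ-X : τ Xs HS.≋ HS.const HK.var
τ-X zero    zero          j       = scale-0 0 0 j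
τ-X zero    (suc zero)    zero    = ≡.refl
τ-X zero    (suc zero)    (suc j) = scale-0 0 1 (suc j)
τ-X zero    (suc (suc i)) j       = scale-0 0 (suc (suc i)) j
τ-X (suc k) zero          j       = scale-0 (suc k) 0 j
τ-X (suc k) (suc zero)    zero    = scale-0 (suc k) 1 0
τ-X (suc k) (suc zero)    (suc j) = scale-0 (suc k) 1 (suc j)
τ-X (suc k) (suc (suc i)) j       = scale-0 (suc k) (suc (suc i)) j

τ-Y : τ Ys HS.≋ HS.const (HK.const HQ.var)
τ-Y zero    zero    zero          = ≡.refl
τ-Y zero    zero    (suc zero)    = ≡.refl
τ-Y zero    zero    (suc (suc j)) = scale-0 0 0 (suc (suc j))
τ-Y zero    (suc i) j             = scale-0 0 (suc i) j
τ-Y (suc k) zero    zero          = scale-0 (suc k) 0 0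
τ-Y (suc k) zero    (suc zero)    = scale-0 (suc k) 0 1
τ-Y (suc k) zero    (suc (suc j)) = scale-0 (suc k) 0 (suc (suc j))
τ-Y (suc k) (suc i) j             = scale-0 (suc k) (suc i) j

τ-Z : τ Zs HS.≋ HS.var
τ-Z zero          zero    zero    = ≡.refl
τ-Z zero          zero    (suc j) = scale-0 0 0 (suc j)
τ-Z zero          (suc i) j       = scale-0 0 (suc i) j
τ-Z (suc zero)    zero    zero    = ≡.refl
τ-Z (suc zero)    zero    (suc j) = scale-0 1 0 (suc j)
τ-Z (suc zero)    (suc i) j       = scale-0 1 (suc i) j
τ-Z (suc (suc k)) zero    zero    = scale-0 (suc (suc k)) 0 0
τ-Z (suc (suc k)) zero    (suc j) = scale-0 (suc (suc k)) 0 (suc j)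
τ-Z (suc (suc k)) (suc i) j       = scale-0 (suc (suc k)) (suc i) j

τ-^ : ∀ f n → τ (f ^S n) HS.≋ τ f HS.^⋆ n
τ-^ f zero    = τ-one
τ-^ f (suc n) = HS.HR.trans (τ-* f (f ^S n)) (HS.HR.*-congˡ {τ f} (τ-^ f n))

private
  τ-series : ∀ (c : ℕ → ℚ) (f : ℕ → Series) (g : ℕ → HS.H) → (∀ m → τ (f m) HS.≋ g m) → ∀ k i j →
             scale k i j (sumTo k λ m → c m ℚ.* f m i j k) ≡ NR.∑ k (λ m → constᴿ (c m) HK.⋆ g m k) i j
  τ-series c f g h k i j = ≡.trans
    (scale-sum k i j k λ m → ≡.trans (scale-* k i j (c m) (f m i j k)) (≡.trans (≡.cong (c m ℚ.*_) (h m k i j)) (≡.sym (constᴿ-⋆ (c m) (g m k) i j))))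
    (≡.sym (∑-coeffᴿ k (λ m → constᴿ (c m) HK.⋆ g m k) i j))

τ-exp : ∀ f → τ (expS f) HS.≋ ES.expH (τ f)
τ-exp f = τ-series (λ m → invℕ (m !)) (f ^S_) (τ f HS.^⋆_) (τ-^ f)

τ-log : ∀ f → τ (logS f) HS.≋ ES.logH (τ f)
τ-log f k i j = ≡.trans (≡.cong (scale k i j) (signs f i j k))
  (τ-series (λ m → altSign m ℚ.* invℕ m) ((f -S oneS) ^S_) ((τ f HS.⊕ (HS.⊖ HS.const (HK.const (HQ.const 1ℚ)))) HS.^⋆_)
    (λ m → HS.HR.trans (τ-^ (f -S oneS) m) (WeightedColourings.^-cong HS.hurwitzRing m
      (HS.HR.trans (τ-- f oneS) (HS.HR.+-congˡ {τ f} (HS.HR.-‿cong τ-one))))) k i j)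
  where
  -- The defining equations determine the sign function, so the local one in `logS` is recognised
  -- without being named.
  altSign-unique : ∀ (s : ℕ → ℚ) → s 0 ≡ 0ℚ → s 1 ≡ 1ℚ → (∀ m → s (suc (suc m)) ≡ ℚ.- s (suc m)) → ∀ m → s m ≡ altSign m
  altSign-unique s p q r zero          = p
  altSign-unique s p q r (suc zero)    = q
  altSign-unique s p q r (suc (suc m)) = ≡.trans (r m) (≡.cong (ℚ.-_) (altSign-unique s p q r (suc m)))
  signs : ∀ f i j k → logS f i j k ≡ sumTo k (λ m → altSign m ℚ.* invℕ m ℚ.* ((f -S oneS) ^S m) i j k)
  -- the sign in logS is local to its definition; it can only be inferred once
  -- multiplication is an opaque operation
  signs f i j k with ℚ._*_
  ... | _·_ = replace (altSign-unique _ ≡.refl ≡.refl (λ _ → ≡.refl))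
    where
    replace : ∀ {s : ℕ → ℚ} → (∀ m → s m ≡ altSign m) →
              sumTo k (λ m → (s m · invℕ m) · ((f -S oneS) ^S m) i j k) ≡ sumTo k (λ m → (altSign m · invℕ m) · ((f -S oneS) ^S m) i j k)
    replace h = sumTo-cong k λ m → ≡.cong (λ s → (s · invℕ m) · ((f -S oneS) ^S m) i j k) (h m)

module DR = DeformedExponential R-algebra
module WR = WeightedColourings (ℚAlgebra.commRing R-algebra)

τ-Fdef : ∀ α β a b → τ α HS.≋ HS.const a HS.⋆ HS.var → τ β HS.≋ HS.const b → τ (Fdef α β) HS.≋ WR.dexp a b
τ-Fdef α β a b hα hβ k i j = ≡.trans
  (τ-series (λ n → invℕ (n !)) (λ n → α ^S n *S β ^S (n choose 2)) (λ n → (HS.const a HS.⋆ HS.var) HS.^⋆ n HS.⋆ HS.const b HS.^⋆ (n choose 2))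
    (λ n → HS.HR.trans (τ-* (α ^S n) (β ^S (n choose 2)))
      (HS.HR.*-cong (HS.HR.trans (τ-^ α n) (WeightedColourings.^-cong HS.hurwitzRing n hα))
                    (HS.HR.trans (τ-^ β (n choose 2)) (WeightedColourings.^-cong HS.hurwitzRing (n choose 2) hβ)))) k i j)
  (DR.dexp-series a b k i j)

-- Coboundary polynomials

private
  module KA = ℚAlgebra K-algebra
  module RA = ℚAlgebra R-algebra
  module DK = DeformedExponential K-algebra
  module WK = WeightedColourings KA.commRing
  module KE = Exponentiation KA.semiring
  module RE = Exponentiation RA.semiring

open PowerFormula K-algebra using (lift; power-formula)
open Polynomials K-algebra

yᴷ : HQ.H
yᴷ = HQ.var

module RS = RootSums KA.commRing yᴷ

lift-⋆ : ∀ a b → lift (a HK.⋆ b) HS.≋ lift a HS.⋆ lift b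
lift-⋆ a b zero    = HK.const-* (a 0) (b 0)
lift-⋆ a b (suc n) = HK.HR.trans (HK.const-+ _ _) (HK.HR.+-cong (lift-⋆ (HK.D a) b n) (lift-⋆ a (HK.D b) n))

lift-1 : lift (HK.const KA.1#) HS.≋ HS.const (HK.const KA.1#)
lift-1 zero    = HK.HR.refl
lift-1 (suc n) = RingHom.0-hom (constHom KA.commRing)

lift-dexp : ∀ a b → WR.dexp (HK.const a) (HK.const b) HS.≋ lift (WK.dexp a b)
lift-dexp a b n = HK.HR.trans (HK.HR.*-cong (DK.const-^ a n) (DK.const-^ b (n choose 2)))
  (HK.HR.sym (HK.const-* (a KE.^ n) (b KE.^ (n choose 2))))

expH-cong : ∀ {f g} → f HS.≋ g → ES.expH f HS.≋ ES.expH g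
expH-cong {f} {g} p k = NR.∑-cong k λ m _ → HK.HR.*-congˡ {RA.ι (invℕ (m !))} (WeightedColourings.^-cong HS.hurwitzRing m p k)

logH-cong : ∀ {f g} → f HS.≋ g → ES.logH f HS.≋ ES.logH g
logH-cong {f} {g} p k = NR.∑-cong k λ m _ → HK.HR.*-congˡ {RA.ι (altSign m ℚ.* invℕ m)}
  (WeightedColourings.^-cong HS.hurwitzRing m (HS.HR.+-congʳ p) k)

τ-power : ∀ F c G cᴿ → τ F HS.≋ lift G → τ c HS.≋ HS.const cᴿ → τ (F ^^ c) HS.≋ ES.expH (HS.const cᴿ HS.⋆ ES.logH (lift G))
τ-power F c G cᴿ hF hc = HS.HR.trans (τ-exp (c *S logS F)) (expH-cong (HS.HR.trans (τ-* c (logS F))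
  (HS.HR.*-cong hc (HS.HR.trans (τ-log F) (logH-cong hF)))))

τ-Fdef-lift : ∀ α β a b → τ α HS.≋ HS.const (HK.const a) HS.⋆ HS.var → τ β HS.≋ HS.const (HK.const b) → τ (Fdef α β) HS.≋ lift (WK.dexp a b)
τ-Fdef-lift α β a b hα hβ = HS.HR.trans (τ-Fdef α β (HK.const a) (HK.const b) hα hβ) (lift-dexp a b)

τ-Z′ : τ Zs HS.≋ HS.const (HK.const KA.1#) HS.⋆ HS.var
τ-Z′ = HS.HR.trans τ-Z (HS.HR.sym (HS.HR.*-identityˡ HS.var))

τ-2Z : τ (fromℕ 2 ·S Zs) HS.≋ HS.const (HK.const (KA.nat 2)) HS.⋆ HS.var
τ-2Z = HS.HR.trans (τ-· (fromℕ 2) Zs) (HS.HR.*-cong (HS.const-cong (HK.const-cong (KA.ι-nat 2))) τ-Z)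

τ-YZ : τ (Ys *S Zs) HS.≋ HS.const (HK.const yᴷ) HS.⋆ HS.var
τ-YZ = HS.HR.trans (τ-* Ys Zs) (HS.HR.*-cong τ-Y τ-Z)

τ-Y² : τ (Ys ^S 2) HS.≋ HS.const (HK.const (yᴷ KA.* yᴷ))
τ-Y² = HS.HR.trans (τ-^ Ys 2) (HS.HR.trans (HS.HR.*-cong τ-Y (HS.HR.trans (HS.HR.*-identityʳ (τ Ys)) τ-Y))
  (HS.HR.sym (HS.HR.trans (HS.const-cong (HK.const-* yᴷ yᴷ)) (HS.const-* (HK.const yᴷ) (HK.const yᴷ)))))

coefficient : Series → HK.H
coefficient f = τ f 0

-- The factor k! of the transform cancels the 1/k! of the generating function, so its coefficients
-- become the members of the family themselves.
τ-egf : ∀ p k → τ (egf p) k HK.≋ coefficient (p k)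
τ-egf p k i j = begin
  fact k ℚ.* (fact i ℚ.* (fact j ℚ.* (invℕ (k !) ℚ.* p k i j 0))) ≡⟨ scale-* k i j (invℕ (k !)) (p k i j 0) ⟩
  invℕ (k !) ℚ.* (fact k ℚ.* x) ≡⟨ ℚ.*-assoc (invℕ (k !)) (fact k) x ⟨
  invℕ (k !) ℚ.* fact k ℚ.* x
    ≡⟨ ≡.cong (ℚ._* x) (ℚAlgebra.invnat-nat ℚ-algebra (k !) {{ℕ._!≢0 k}}) ⟩
  1ℚ ℚ.* x ∎
  where
  open ≡.≡-Reasoning
  x : ℚ
  x = fact i ℚ.* (fact j ℚ.* p k i j 0)

HasPolyValues : Series → (ℕ → KA.Carrier) → Set
HasPolyValues f = HasValues (coefficient f)

polyValues-* : ∀ f g {φ ψ} → HasPolyValues f φ → HasPolyValues g ψ → HasPolyValues (f *S g) (λ k → φ k KA.* ψ k)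
polyValues-* f g vf vg = values-cong (HK.HR.sym (τ-* f g 0)) (λ k → KA.refl) (values-* vf vg)

polyValues-one : HasPolyValues oneS (λ _ → KA.1#)
polyValues-one = values-cong (HK.HR.sym (τ-one 0)) (λ k → KA.refl) (values-const KA.1#)

polyValues-^ : ∀ f {φ} n → HasPolyValues f φ → HasPolyValues (f ^S n) (λ k → φ k KE.^ n)
polyValues-^ f zero    v = polyValues-one
polyValues-^ f (suc n) v = polyValues-* f (f ^S n) v (polyValues-^ f n v)

polyValues-X : HasPolyValues Xs (λ k → KA.nat (points k))
polyValues-X = values-cong (HK.HR.sym (τ-X 0)) (λ k → KA.refl) values-var

const-neg : HK.const (KA.- KA.1#) HK.≋ HK.⊖ HK.const KA.1#
const-neg zero    = KA.refl
const-neg (suc n) = KA.sym -0#≈0#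
  where open RingProperties KA.ring using (-0#≈0#)

polyValues-Y-1 : HasPolyValues (Ys -S oneS) (λ _ → yᴷ KA.+ KA.- KA.1#)
polyValues-Y-1 = values-cong
  (HK.HR.sym (HK.HR.trans (τ-- Ys oneS 0) (HK.HR.+-cong (τ-Y 0) (HK.HR.trans (HK.HR.-‿cong (τ-one 0)) (HK.HR.sym const-neg)))))
  (λ k → KA.refl) (values-+ (values-const yᴷ) (values-const (KA.- KA.1#)))

polyValues-· : ∀ n f {φ} → HasPolyValues f φ → HasPolyValues (fromℕ n ·S f) (λ k → KA.nat n KA.* φ k)
polyValues-· n f v = values-cong (HK.HR.sym (τ-· (fromℕ n) f 0)) (λ k → KA.*-congʳ (KA.ι-nat n))
  (values-* (values-const (KA.ι (fromℕ n))) v)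

polyValues-sum : ∀ {A : Set} (xs : List A) f {φ : A → ℕ → KA.Carrier} → (∀ x → HasPolyValues (f x) (φ x)) →
                 HasPolyValues (sumList f xs) (λ k → RS.∑L xs (λ x → φ x k))
polyValues-sum []       f h = values-cong (λ i j → ≡.sym (scale-0 0 i j)) (λ k → KA.refl) values-0
polyValues-sum (x ∷ xs) f h = values-cong (HK.HR.sym (τ-+ (f x) (sumList f xs) 0)) (λ k → KA.refl)
  (values-+ (h x) (polyValues-sum xs f h))

nat-^ : ∀ q n → KA.nat (q ℕ.^ n) KA.≈ KA.nat q KE.^ n
nat-^ q zero    = KA.+-identityʳ KA.1#
nat-^ q (suc n) = KA.trans (KA.nat-* q (q ℕ.^ n)) (KA.*-congˡ {KA.nat q} (nat-^ q n))

module Coboundary (r : RankFn) (m : MultFn)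
  (isRank : ∀ {n} (B : List (Vecℤ n)) → IsRank B (r B)) (isIndex : ∀ {n} (B : List (Vecℤ n)) → IsIndex B (m B)) where

  Yᴷ-1 : KA.Carrier
  Yᴷ-1 = yᴷ KA.+ KA.- KA.1#

  ψ-value : ∀ {n} → List (Vecℤ n) → ℕ → KA.Carrier
  ψ-value A q = RS.∑L (sublists A) λ B → KA.nat (m B) KA.* (KA.nat q KE.^ (r A ∸ r B) KA.* Yᴷ-1 KE.^ length B)

  polyValues-ψ : ∀ {n} (A : List (Vecℤ n)) → HasPolyValues (ψ r m A) (λ k → ψ-value A (points k))
  polyValues-ψ A = polyValues-sum (sublists A) _ λ B → polyValues-· (m B) (Xs ^S (r A ∸ r B) *S (Ys -S oneS) ^S length B)
    (polyValues-* (Xs ^S (r A ∸ r B)) ((Ys -S oneS) ^S length B) (polyValues-^ Xs (r A ∸ r B) polyValues-X)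
      (polyValues-^ (Ys -S oneS) (length B) polyValues-Y-1))

  -- Keeps the exponents `r A ∸ r B` in ψ from being truncated, so that exponents of X can be added.
  rank-mono : ∀ {n} {A B : List (Vecℤ n)} → B ∈ sublists A → r B ℕ.≤ r A
  rank-mono {A = A} {B} B∈ with (S , S∈ , S-indep , eq) , _ ← isRank B =
    ≡.subst (ℕ._≤ r A) eq (proj₂ (isRank A) S (⊆⇒∈-sublists (⊆-trans (∈-sublists⇒⊆ B S∈) (∈-sublists⇒⊆ A B∈))) S-indep)

  -- The exponent d is n - r(A), kept as an argument with an equation because in type A it is the
  -- literal 1. Since d + (r(A) - r(B)) = n - r(B), each summand becomes the number of solutions for
  -- B.
  ψ-pointSum : ∀ {n} (A : List (Vecℤ n)) → Short A → ∀ d → d ℕ.+ r A ≡ n → ∀ k →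
               KA.nat (points k) KE.^ d KA.* ψ-value A (points k) KA.≈ RS.pointSum (points k) A
  ψ-pointSum {n} A short d d+r≡n k = KA.trans (KA.sym (RS.∑L-*ˡ (sublists A) (q KE.^ d) _)) (RS.∑L-cong (sublists A) λ B B∈ → begin
    q KE.^ d KA.* (KA.nat (m B) KA.* (q KE.^ (r A ∸ r B) KA.* Yᴷ-1 KE.^ length B))
      ≈⟨ solve 4 (λ a b c z → a :* (b :* (c :* z)) := b :* (a :* c) :* z) KA.refl (q KE.^ d) (KA.nat (m B)) (q KE.^ (r A ∸ r B)) (Yᴷ-1 KE.^ length B) ⟩
    KA.nat (m B) KA.* (q KE.^ d KA.* q KE.^ (r A ∸ r B)) KA.* Yᴷ-1 KE.^ length B
      ≈⟨ KA.*-congʳ {Yᴷ-1 KE.^ length B} (KA.*-congˡ {KA.nat (m B)} (KA.sym (KE.^-homo-* q d (r A ∸ r B)))) ⟩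
    KA.nat (m B) KA.* q KE.^ (d ℕ.+ (r A ∸ r B)) KA.* Yᴷ-1 KE.^ length B
      ≡⟨ ≡.cong (λ t → KA.nat (m B) KA.* q KE.^ t KA.* Yᴷ-1 KE.^ length B) (exponent B B∈) ⟩
    KA.nat (m B) KA.* q KE.^ (n ∸ r B) KA.* Yᴷ-1 KE.^ length B
      ≈⟨ KA.*-congʳ {Yᴷ-1 KE.^ length B} (KA.trans (KA.*-congˡ {KA.nat (m B)} (KA.sym (nat-^ (points k) (n ∸ r B)))) (KA.sym (KA.nat-* (m B) (points k ℕ.^ (n ∸ r B))))) ⟩
    KA.nat (m B ℕ.* points k ℕ.^ (n ∸ r B)) KA.* Yᴷ-1 KE.^ length B
      ≡⟨ ≡.cong (λ t → KA.nat t KA.* Yᴷ-1 KE.^ length B) (≡.sym (count B B∈)) ⟩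
    KA.nat (solutions (points k) B) KA.* Yᴷ-1 KE.^ length B ∎)
    where
    open SetoidReasoning KA.setoid
    open SemiringSolver KA.commutativeSemiring using (solve; _:=_; _:*_)
    q : KA.Carrier
    q = KA.nat (points k)
    exponent : ∀ B → B ∈ sublists A → d ℕ.+ (r A ∸ r B) ≡ n ∸ r B
    exponent B B∈ = ≡.trans (≡.sym (ℕ.+-∸-assoc d (rank-mono B∈))) (≡.cong (_∸ r B) d+r≡n)
    count : ∀ B → B ∈ sublists A → solutions (points k) B ≡ m B ℕ.* points k ℕ.^ (n ∸ r B)
    count B B∈ = proj₂ (solutions-formula (⊆-short (∈-sublists⇒⊆ A B∈) short) (isRank B) (isIndex B)) (2 ℕ.^ k) {{ℕ.m^n≢0 2 k}}

  -- The value of X/2 - 1 at X = `points k`, which is a natural number.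
  half : ℕ → ℕ
  half k = ℕ.pred (2 ℕ.^ k)

  2*[1+half] : ∀ k → 2 ℕ.* suc (half k) ≡ points k
  2*[1+half] k = ≡.cong (2 ℕ.*_) (ℕ.suc-pred (2 ℕ.^ k) {{ℕ.m^n≢0 2 k}})

  exponentᴿ : HK.H
  exponentᴿ = (constᴿ ½ HK.⋆ HK.var) HK.⊕ HK.const (KA.- KA.1#)

  τ-exponent : τ (½ ·S Xs -S oneS) HS.≋ HS.const exponentᴿ
  τ-exponent = HS.HR.trans (τ-- (½ ·S Xs) oneS) (HS.HR.trans (HS.HR.+-cong
      (HS.HR.trans (τ-· ½ Xs) (HS.HR.trans (HS.HR.*-congˡ {HS.const (constᴿ ½)} τ-X) (HS.HR.sym (HS.const-* (constᴿ ½) HK.var))))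
      (HS.HR.trans (HS.HR.-‿cong τ-one) neg))
    (HS.HR.sym (HS.const-+ (constᴿ ½ HK.⋆ HK.var) (HK.const (KA.- KA.1#)))))
    where
    neg : HS.⊖ HS.const (HK.const KA.1#) HS.≋ HS.const (HK.const (KA.- KA.1#))
    neg zero    = HK.HR.sym const-neg
    neg (suc k) i j = ≡.refl

  exponent-values : HasValues exponentᴿ (λ k → KA.nat (half k))
  exponent-values = values-cong HK.HR.refl halve (values-+ (values-* (values-const (KA.ι ½)) values-var) (values-const (KA.- KA.1#)))
    where
    open SetoidReasoning KA.setoid
    halve : ∀ k → KA.ι ½ KA.* KA.nat (points k) KA.+ KA.- KA.1# KA.≈ KA.nat (half k)
    halve k = begin
      KA.ι ½ KA.* KA.nat (points k) KA.+ KA.- KA.1#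
        ≡⟨ ≡.cong (λ t → KA.ι ½ KA.* KA.nat t KA.+ KA.- KA.1#) (≡.sym (2*[1+half] k)) ⟩
      KA.ι ½ KA.* KA.nat (2 ℕ.* suc (half k)) KA.+ KA.- KA.1#
        ≈⟨ KA.+-congʳ {KA.- KA.1#} (KA.trans (KA.*-congˡ {KA.ι ½} (KA.nat-* 2 (suc (half k)))) (KA.sym (KA.*-assoc (KA.ι ½) (KA.nat 2) (KA.nat (suc (half k)))))) ⟩
      KA.ι ½ KA.* KA.nat 2 KA.* KA.nat (suc (half k)) KA.+ KA.- KA.1#
        ≈⟨ KA.+-congʳ {KA.- KA.1#} (KA.trans (KA.*-congʳ {KA.nat (suc (half k))} (KA.invnat-nat 2)) (KA.*-identityˡ (KA.nat (suc (half k))))) ⟩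
      KA.1# KA.+ KA.nat (half k) KA.+ KA.- KA.1#
        ≈⟨ xyx⁻¹≈y KA.1# (KA.nat (half k)) ⟩
      KA.nat (half k) ∎
      where open RingProperties KA.ring using (xyx⁻¹≈y)

  module _ (Φ : ∀ n → List (Vecℤ n)) (short : ∀ n → Short (Φ n)) (a b : KA.Carrier)
    (sum : ∀ s n → RS.pointSum (2 ℕ.* suc s) (Φ n) KA.≈
      (WK.dexp (KA.nat 2) yᴷ HK.^⋆ s HK.⋆ (WK.dexp a (yᴷ KA.* yᴷ) HK.⋆ WK.dexp b (yᴷ KA.* yᴷ))) n) where

    private
      G J : HK.H
      G = WK.dexp (KA.nat 2) yᴷ
      J = WK.dexp a (yᴷ KA.* yᴷ) HK.⋆ WK.dexp b (yᴷ KA.* yᴷ)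

      dexp₀ : ∀ a b → WK.dexp a b 0 KA.≈ KA.1#
      dexp₀ a b = KA.*-identityˡ KA.1#

      F : Series
      F = Fdef (fromℕ 2 ·S Zs) Ys

    Ψ-formula : τ (ΨΦ r m Φ) HS.≋ τ (F ^^ (½ ·S Xs -S oneS)) HS.⋆ (lift (WK.dexp a (yᴷ KA.* yᴷ)) HS.⋆ lift (WK.dexp b (yᴷ KA.* yᴷ)))
    Ψ-formula = HS.HR.trans
      (power-formula (τ (ΨΦ r m Φ)) G J exponentᴿ half (dexp₀ (KA.nat 2) yᴷ) (KA.trans (KA.*-cong (dexp₀ a (yᴷ KA.* yᴷ)) (dexp₀ b (yᴷ KA.* yᴷ))) (KA.*-identityˡ KA.1#)) exponent-values values)
      (HS.HR.*-cong (HS.HR.sym (τ-power F (½ ·S Xs -S oneS) G exponentᴿ (τ-Fdef-lift (fromℕ 2 ·S Zs) Ys (KA.nat 2) yᴷ τ-2Z τ-Y) τ-exponent)) (lift-⋆ (WK.dexp a (yᴷ KA.* yᴷ)) (WK.dexp b (yᴷ KA.* yᴷ))))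
      where
      values : ∀ n → HasValues (τ (ΨΦ r m Φ) n) (λ k → (G HK.^⋆ half k HK.⋆ J) n)
      values n = values-cong (HK.HR.sym (τ-egf (λ n → Xs ^S (n ∸ r (Φ n)) *S ψ r m (Φ n)) n))
        (λ k → KA.trans (ψ-pointSum (Φ n) (short n) (n ∸ r (Φ n)) (ℕ.m∸n+n≡m (proj₁ (solutions-formula (short n) (isRank (Φ n)) (isIndex (Φ n))))) k)
          (KA.trans (KA.reflexive (≡.cong (λ q → RS.pointSum q (Φ n)) (≡.sym (2*[1+half] k)))) (sum (half k) n)))
        (polyValues-* (Xs ^S (n ∸ r (Φ n))) (ψ r m (Φ n)) (polyValues-^ Xs (n ∸ r (Φ n)) polyValues-X) (polyValues-ψ (Φ n)))

  ψA : ℕ → Series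
  ψA zero    = zeroS
  ψA (suc n) = ψ r m (rootA (suc n))

  -- the family inside ΨA is local to its definition, so the type of ΨA-term is left
  -- to be inferred from its use in ΨA-unfold
  ΨA-term : (i j k a b c : ℕ) → _

  ΨA-unfold : ΨA r m ≈S oneS +S Xs *S egf ψA
  ΨA-unfold i j k = ≡.cong (oneS i j k ℚ.+_) (sumTo-cong i λ a → sumTo-cong j λ b → sumTo-cong k λ c → ΨA-term i j k a b c)

  ΨA-term i j k a b c with k ∸ c
  ... | zero  = ≡.refl
  ... | suc n = ≡.refl

  -- The power formula with J = 1 and c = X. The coefficient of Z⁰ is the separate summand 1 of
  -- `ΨA`; in all others the factor X supplies the missing power, as the rank is one less than the
  -- number of coordinates.
  ΨA-formula : τ (ΨA r m) HS.≋ τ (Fdef Zs Ys ^^ Xs)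
  ΨA-formula = HS.HR.trans (power-formula (τ (ΨA r m)) G (HK.const KA.1#) HK.var points (KA.*-identityˡ KA.1#) KA.refl values-var values)
    (HS.HR.trans (HS.HR.*-cong (HS.HR.sym (τ-power (Fdef Zs Ys) Xs G HK.var (τ-Fdef-lift Zs Ys KA.1# yᴷ τ-Z′ τ-Y) τ-X)) lift-1)
      (HS.HR.*-identityʳ (τ (Fdef Zs Ys ^^ Xs))))
    where
    G : HK.H
    G = WK.dexp KA.1# yᴷ
    G^-zero : ∀ q → (G HK.^⋆ q) 0 KA.≈ KA.1#
    G^-zero zero    = KA.refl
    G^-zero (suc q) = KA.trans (KA.*-cong (KA.*-identityˡ KA.1#) (G^-zero q)) (KA.*-identityˡ KA.1#)
    expand : ∀ n → τ (ΨA r m) n HK.≋ HS.const (HK.const KA.1#) n HK.⊕ HK.var HK.⋆ coefficient (ψA n)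
    expand n = HK.HR.trans (τ-cong ΨA-unfold n) (HK.HR.trans (τ-+ oneS (Xs *S egf ψA) n) (HK.HR.+-cong (τ-one n)
      (HK.HR.trans (τ-* Xs (egf ψA) n) (HK.HR.trans (HS.HR.*-congʳ {τ (egf ψA)} τ-X n)
        (HK.HR.trans (HS.const-⋆ HK.var (τ (egf ψA)) n) (HK.HR.*-congˡ {HK.var} (τ-egf ψA n)))))))
    values : ∀ n → HasValues (τ (ΨA r m) n) (λ k → (G HK.^⋆ points k HK.⋆ HK.const KA.1#) n)
    values zero    = values-cong (HK.HR.sym (HK.HR.trans (expand 0) (HK.HR.trans (HK.HR.+-congˡ {HK.const KA.1#}
        (HK.HR.trans (HK.HR.*-congˡ {HK.var} (λ i j → scale-0 0 i j)) (HK.HR.zeroʳ HK.var))) (HK.HR.+-identityʳ (HK.const KA.1#)))))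
      (λ k → KA.sym (KA.trans (KA.*-identityʳ _) (G^-zero (points k)))) (values-const KA.1#)
    values (suc n) = values-cong (HK.HR.sym (HK.HR.trans (expand (suc n)) (HK.HR.+-identityˡ _)))
      (λ k → KA.trans (KA.*-congʳ {ψ-value A (points k)} (KA.sym (KA.*-identityʳ (KA.nat (points k)))))
        (KA.trans (ψ-pointSum A (short-A (suc n)) 1 (≡.cong suc (rank-A n (isRank A) (isIndex A))) k)
          (KA.trans (RS.pointSum-A (points k) (suc n)) (KA.sym (HK.HR.*-identityʳ (G HK.^⋆ points k) (suc n))))))
      (values-* values-var (polyValues-ψ A))
      where
      A : List (Vecℤ (suc n))
      A = rootA (suc n)

τ-product : ∀ E f g {u v} → τ f HS.≋ u → τ g HS.≋ v → τ (E *S f *S g) HS.≋ τ E HS.⋆ (u HS.⋆ v)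
τ-product E f g {u} {v} hf hg = HS.HR.trans (τ-* (E *S f) g) (HS.HR.trans (HS.HR.*-cong (HS.HR.trans (τ-* E f) (HS.HR.*-congˡ {τ E} hf)) hg)
  (HS.HR.*-assoc (τ E) u v))

τ-square : ∀ E f {u} → τ f HS.≋ u → τ (E *S f ^S 2) HS.≋ τ E HS.⋆ (u HS.⋆ u)
τ-square E f {u} hf = HS.HR.trans (τ-* E (f ^S 2)) (HS.HR.*-congˡ {τ E} (HS.HR.trans (τ-^ f 2)
  (HS.HR.*-cong hf (HS.HR.trans (HS.HR.*-identityʳ (τ f)) hf))))

theorem1p9 : (r : RankFn) (m : MultFn)
    → (∀ {n} (B : List (Vecℤ n)) → IsRank B (r B))
    → (∀ {n} (B : List (Vecℤ n)) → IsIndex B (m B))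
    → (ΨA r m ≈S Fdef Zs Ys ^^ Xs)
    × (ΨΦ r m rootB ≈S Fdef (fromℕ 2 ·S Zs) Ys ^^ (½ ·S Xs -S oneS) *S Fdef Zs (Ys ^S 2) *S Fdef (Ys *S Zs) (Ys ^S 2))
    × (ΨΦ r m rootC ≈S Fdef (fromℕ 2 ·S Zs) Ys ^^ (½ ·S Xs -S oneS) *S Fdef (Ys *S Zs) (Ys ^S 2) ^S 2)
    × (ΨΦ r m rootD ≈S Fdef (fromℕ 2 ·S Zs) Ys ^^ (½ ·S Xs -S oneS) *S Fdef Zs (Ys ^S 2) ^S 2)
theorem1p9 r m isRank isIndex =
    τ-injective ΨA-formula
  , τ-injective (HS.HR.trans (Ψ-formula rootB short-B KA.1# yᴷ sumB) (HS.HR.sym (τ-product E (Fdef Zs (Ys ^S 2)) (Fdef (Ys *S Zs) (Ys ^S 2)) FZ FYZ)))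
  , τ-injective (HS.HR.trans (Ψ-formula rootC short-C yᴷ yᴷ RS.pointSum-C) (HS.HR.sym (τ-square E (Fdef (Ys *S Zs) (Ys ^S 2)) FYZ)))
  , τ-injective (HS.HR.trans (Ψ-formula rootD short-D KA.1# KA.1# RS.pointSum-D) (HS.HR.sym (τ-square E (Fdef Zs (Ys ^S 2)) FZ)))
  where
  open Coboundary r m isRank isIndex
  E : Series
  E = Fdef (fromℕ 2 ·S Zs) Ys ^^ (½ ·S Xs -S oneS)
  FZ : τ (Fdef Zs (Ys ^S 2)) HS.≋ lift (WK.dexp KA.1# (yᴷ KA.* yᴷ))
  FZ = τ-Fdef-lift Zs (Ys ^S 2) KA.1# (yᴷ KA.* yᴷ) τ-Z′ τ-Y²
  FYZ : τ (Fdef (Ys *S Zs) (Ys ^S 2)) HS.≋ lift (WK.dexp yᴷ (yᴷ KA.* yᴷ))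
  FYZ = τ-Fdef-lift (Ys *S Zs) (Ys ^S 2) yᴷ (yᴷ KA.* yᴷ) τ-YZ τ-Y²
  -- The sum lists the class of 0, with F(YZ, Y²), before that of q/2, with F(Z, Y²); the statement
  -- has them in the other order.
  sumB : ∀ s n → RS.pointSum (2 ℕ.* suc s) (rootB n) KA.≈
    (WK.dexp (KA.nat 2) yᴷ HK.^⋆ s HK.⋆ (WK.dexp KA.1# (yᴷ KA.* yᴷ) HK.⋆ WK.dexp yᴷ (yᴷ KA.* yᴷ))) n
  sumB s n = KA.trans (RS.pointSum-B s n) (HK.HR.*-congˡ {WK.dexp (KA.nat 2) yᴷ HK.^⋆ s}
    (HK.HR.*-comm (WK.dexp yᴷ (yᴷ KA.* yᴷ)) (WK.dexp KA.1# (yᴷ KA.* yᴷ))) n)
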